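{- Let $H$ be a finite hypergraph with no Berge cycle of length congruent to $0$ or $1$ modulo $3$. Then either $I(H)$ is homology equivalent to a contractible space, or $I(H)$ is homology equivalent to the sphere $S^{\gamma(H)-1}$.
   Context: A hypergraph $H$ on a finite vertex set $V(H)$ is a collection of nonempty subsets (edges) of $V(H)$. An independent set of $H$ is a vertex subset containing no edge of $H$; the independence complex $I(H)$ is the simplicial complex of independent sets. A Berge cycle of length $k$ is an alternating sequence $v_1e_1v_2e_2\ldots v_ke_k$ of distinct vertices and distinct edges with $v_i,v_{i+1}\in e_i$ for all $i$ (indices mod $k$). Two complexes are homology equivalent if they have isomorphic reduced integral homology groups in all dimensions. It is known that if $H$ has no Berge cycle of length $0$ modulo $3$ then $I(H)$ is homology equivalent to a contractible space or to a sphere. A vertex $v$ is dominated by $W\subseteq V(H)$ if $v\in W$ or $\{v\}\cup W'\in H$ for some $W'\subseteq W$; $W$ is a dominating set if it dominates every vertex, and $\gamma(H)$ is the minimum size of a dominating set. -}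

module Defs where

open import Data.Bool using (Bool; true; false; if_then_else_; _∧_; not)
open import Data.Nat using (ℕ; zero; suc; _%_; _<ᵇ_)
import Data.Nat
open import Data.Nat.DivMod using (m%n<n)
open import Data.Integer using (ℤ; +_; -_; _+_; _*_; _-_)
open import Data.Fin using (Fin; toℕ; fromℕ<)
open import Data.Fin.Subset using (Subset; _∈_; _∉_; _⊆_; _∪_; ⁅_⁆; ∣_∣; Nonempty)
open import Data.Vec using (lookup)
open import Data.Product using (Σ; ∃; _×_; _,_)
open import Data.Sum using (_⊎_)
open import Relation.Nullary using (¬_)
open import Relation.Binary.PropositionalEquality using (_≡_)
open import Function.Definitions using (Injective)

record Hypergraph (n : ℕ) : Set where
  field
    isEdge   : Subset n → Bool
    nonempty : ∀ e → isEdge e ≡ true → Nonempty e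
open Hypergraph public

-- Berge cycles of length k = 2 + m (lengths are ≥ 2).

next : ∀ m → Fin (suc (suc m)) → Fin (suc (suc m))
next m i = fromℕ< (m%n<n (suc (toℕ i)) (suc (suc m)))

record BergeCycle {n : ℕ} (H : Hypergraph n) (m : ℕ) : Set where
  field
    vtx      : Fin (suc (suc m)) → Fin n
    edg      : Fin (suc (suc m)) → Subset n
    vtx-inj  : Injective _≡_ _≡_ vtx
    edg-inj  : Injective _≡_ _≡_ edg
    edg-in-H : ∀ i → isEdge H (edg i) ≡ true
    vtx-here : ∀ i → vtx i ∈ edg i
    vtx-next : ∀ i → vtx (next m i) ∈ edg i

NoBerge01mod3 : ∀ {n} → Hypergraph n → Set
NoBerge01mod3 H = ∀ m → BergeCycle H m → suc (suc m) % 3 ≡ 2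

Independent : ∀ {n} → Hypergraph n → Subset n → Set
Independent H σ = ∀ e → isEdge H e ≡ true → ¬ (e ⊆ σ)

Dominates : ∀ {n} → Hypergraph n → Subset n → Fin n → Set
Dominates H W v = v ∈ W ⊎ Σ (Subset _) (λ W' → W' ⊆ W × isEdge H (⁅ v ⁆ ∪ W') ≡ true)

IsDominating : ∀ {n} → Hypergraph n → Subset n → Set
IsDominating H W = ∀ v → Dominates H W v

IsDominationNumber : ∀ {n} → Hypergraph n → ℕ → Set
IsDominationNumber H g =
  Σ (Subset _) (λ W → IsDominating H W × ∣ W ∣ ≡ g)
  × (∀ W → IsDominating H W → g Data.Nat.≤ ∣ W ∣)

-- Reduced (augmented) simplicial chain complex of I(H) over ℤ.
-- Chains of index k are integer functions on faces with k vertices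
-- (i.e. of dimension k-1); index 0 is the empty face (dimension -1),
-- which gives the augmentation and hence reduced homology.

sumFin : ∀ {n} → (Fin n → ℤ) → ℤ
sumFin {zero}  f = + 0
sumFin {suc n} f = f Fin.zero + sumFin (λ i → f (Fin.suc i))
  where import Data.Fin as Fin

sgn : ℕ → ℤ
sgn zero    = + 1
sgn (suc k) = - sgn k

countFin : ∀ {k} → (Fin k → Bool) → ℕ
countFin {zero}  b = zero
countFin {suc k} b = (if b Fin.zero then 1 else 0) Data.Nat.+ countFin (λ i → b (Fin.suc i))
  where import Data.Fin as Fin

below : ∀ {n} → Subset n → Fin n → ℕ
below τ v = countFin (λ u → lookup τ u ∧ (toℕ u <ᵇ toℕ v))

Chain : ℕ → Set
Chain n = Subset n → ℤ

IsChain : ∀ {n} → Hypergraph n → ℕ → Chain n → Set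
IsChain H k c = ∀ σ → ¬ (c σ ≡ + 0) → Independent H σ × ∣ σ ∣ ≡ k

∂ : ∀ {n} → Chain n → Chain n
∂ c τ = sumFin (λ v → if lookup τ v then + 0 else sgn (below τ v) * c (τ ∪ ⁅ v ⁆))

_≐_ : ∀ {n} → Chain n → Chain n → Set
c ≐ d = ∀ σ → c σ ≡ d σ

zeroC : ∀ {n} → Chain n
zeroC σ = + 0

IsCycle : ∀ {n} → Hypergraph n → ℕ → Chain n → Set
IsCycle H k c = IsChain H k c × ∂ c ≐ zeroC

IsBoundary : ∀ {n} → Hypergraph n → ℕ → Chain n → Set
IsBoundary H k c = Σ (Chain _) (λ d → IsChain H (suc k) d × ∂ d ≐ c)

HomologyVanishes : ∀ {n} → Hypergraph n → ℕ → Set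
HomologyVanishes H k = ∀ c → IsCycle H k c → IsBoundary H k c

HomologyIsℤ : ∀ {n} → Hypergraph n → ℕ → Set
HomologyIsℤ H k =
  Σ (Chain _) λ z → IsCycle H k z
    × (∀ c → IsCycle H k c → Σ ℤ λ a → IsBoundary H k (λ σ → c σ - a * z σ))
    × (∀ a → IsBoundary H k (λ σ → a * z σ) → a ≡ + 0)

HomologyContractible : ∀ {n} → Hypergraph n → Set
HomologyContractible H = ∀ k → HomologyVanishes H k

-- I(H) homology equivalent to S^(d-1), i.e. reduced homology ℤ in
-- dimension d-1 (index d) and 0 elsewhere (d = 0: the empty sphere S^{-1})
HomologySphere : ∀ {n} → Hypergraph n → ℕ → Set
HomologySphere H d = HomologyIsℤ H d × (∀ k → ¬ (k ≡ d) → HomologyVanishes H k)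

-- Let B be the bipartite vertex–edge incidence graph of H. All cycles of B have length 1 modulo 3, and a
-- set dominates H exactly when its complement is matched to private edges, so n − γ(H) is the largest size
-- of an induced matching of B. For an induced subgraph P of B with complex X(P), every node x gives a long
-- exact sequence between X(P), X(P ─ x) and X(P ─ N[x]), and X(P) is acyclic if P has an isolated node.
-- By induction X(P) is acyclic or a sphere whose codimension t is the induced matching number ν of P:
--   * A leaf with neighbour y reduces P to P ─ N[y]. If all degrees are at least 2, a depth-first search
--     produces a cycle v, c₁, …, cₘ with 3 ∣ m in which c₃, c₆, …, cₘ have degree 2; removing N[c₁] then
--     leaves an acyclic complex, so P reduces to P ─ c₁. Hence t ≤ ν.
--   * If an induced matching had more than t edges, then every node outside it would touch two of its edges and
--     every matched node would have a neighbour outside it. A walk alternating between matching edges and such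
--     nodes closes up to a cycle of length 0 or 2 modulo 3.

module Submission where

open import Defs
open import Data.Nat using (ℕ)
open import Data.Bool using (Bool; true; false; _∧_; _∨_; not; _xor_; if_then_else_)
open import Data.Product using (Σ; _×_; _,_; proj₁; proj₂)
open import Data.Sum using (_⊎_; inj₁; inj₂; [_,_]′)
open import Data.Empty using (⊥-elim; ⊥)
open import Function using (_∘_; case_of_)
open import Relation.Nullary using (¬_; Dec; yes; no; does)
open import Relation.Nullary.Decidable using (_⊎-dec_; _×-dec_; ¬?; decidable-stable; _→-dec_; map′)
open import Relation.Binary.PropositionalEquality using (_≡_; _≢_; refl; sym; trans; cong; cong₂; subst; module ≡-Reasoning; subst₂)

-- The two kinds of nodes cut the complex differently. For a vertex node the complex of `P` is the
-- total term of the exact sequence; for an edge node it is the subcomplex, because dropping an edge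
-- enlarges the complex. Counting codimension instead of dimension hides the difference: from
-- `P ─ x` to `P` it is kept, from `P ─N x` to `P` it grows by one. The graph argument therefore
-- never asks on which side a node lies.
--
-- If neither piece were acyclic, the exact sequence alone would not settle the homology of `P`. The
-- number of independent node sets modulo 2, an Euler characteristic, is even for the acyclic
-- subgraphs, odd for the spheres, and additive over the two pieces. So at a sphere exactly one
-- piece is acyclic, and only exact sequences with a vanishing term are used.
--
-- The teeth c₃, c₆, ... have degree 2 because a second path from v to a tooth, disjoint from the
-- cycle in between, forms one cycle with each arc, and the two lengths contradict each other modulo
-- 3. The search is arranged so that every surplus edge at a tooth yields such a path.

module Walks where

  open import Data.Nat using (suc; _+_; _≤_; _<_; z≤n; s≤s)
  open import Data.Nat.Properties using (≤-refl; +-comm; +-mono-≤; +-mono-≤-<)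
  open import Data.List using (List; []; _∷_; _++_; length)
  open import Data.List.Properties using (length-++)
  open import Data.List.Membership.Propositional using (_∈_; _∉_)
  open import Data.List.Membership.Propositional.Properties using (∈-++⁻; ∈-++⁺ˡ; ∈-++⁺ʳ)
  open import Data.List.Relation.Unary.Any using (Any; here; there)
  import Data.List.Relation.Unary.Any as Any
  open import Data.List.Relation.Unary.All using (All; []; _∷_)
  import Data.List.Relation.Unary.All as All
  open import Data.List.Relation.Unary.AllPairs using ([]; _∷_)
  open import Data.List.Relation.Unary.Unique.Propositional using (Unique)
  import Data.List.Relation.Unary.Unique.Propositional.Properties as Uniq

  true≢false : ∀ {b} → b ≡ true → b ≢ false
  true≢false refl ()

  -- Walks and lists without repetition.

  infixr 5 _∷_
  -- The list omits the start and contains the end, so its length is the number of edges. A cycle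
  -- closed by one more edge has `1 + length xs` nodes, and length 1 modulo 3 becomes
  -- `3 ∣ length xs`.
  data Walk {A : Set} (_~_ : A → A → Set) : A → List A → A → Set where
    []  : ∀ {x} → Walk _~_ x [] x
    _∷_ : ∀ {x y ys z} → x ~ y → Walk _~_ y ys z → Walk _~_ x (y ∷ ys) z

  module _ {A : Set} where

    unique-∉ : ∀ {x : A} {xs} → Unique (x ∷ xs) → x ∉ xs
    unique-∉ (p ∷ _) x∈ = All.lookup p x∈ refl

    unique-∷ : ∀ {x : A} {xs} → x ∉ xs → Unique xs → Unique (x ∷ xs)
    unique-∷ x∉ u = All.tabulate (λ {y} y∈ x≡y → x∉ (subst (_∈ _) (sym x≡y) y∈)) ∷ u

    unique-tail : ∀ {x : A} {xs} → Unique (x ∷ xs) → Unique xs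
    unique-tail (_ ∷ u) = u

    unique-++ˡ : ∀ (xs : List A) {ys} → Unique (xs ++ ys) → Unique xs
    unique-++ˡ []       u = []
    unique-++ˡ (x ∷ xs) u = unique-∷ (unique-∉ u ∘ ∈-++⁺ˡ) (unique-++ˡ xs (unique-tail u))

    unique-++ʳ : ∀ (xs : List A) {ys} → Unique (xs ++ ys) → Unique ys
    unique-++ʳ []       u = u
    unique-++ʳ (x ∷ xs) u = unique-++ʳ xs (unique-tail u)

    unique-disjoint : ∀ (xs : List A) {ys z} → Unique (xs ++ ys) → z ∈ xs → z ∉ ys
    unique-disjoint (x ∷ xs) u (here refl) z∈ = unique-∉ u (∈-++⁺ʳ xs z∈)
    unique-disjoint (x ∷ xs) u (there z∈xs) z∈ = unique-disjoint xs (unique-tail u) z∈xs z∈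

    unique-++ : ∀ {xs ys : List A} → Unique xs → Unique ys → (∀ {z} → z ∈ xs → z ∉ ys) → Unique (xs ++ ys)
    unique-++ ux uy dis = Uniq.++⁺ ux uy (λ (p , q) → dis p q)

    data Consecutive : List A → A → A → Set where
      forth : ∀ {a b l} → Consecutive (a ∷ b ∷ l) a b
      back  : ∀ {a b l} → Consecutive (a ∷ b ∷ l) b a
      later : ∀ {a l x y} → Consecutive l x y → Consecutive (a ∷ l) x y

    consecutive-sym : ∀ {l x y} → Consecutive l x y → Consecutive l y x
    consecutive-sym forth     = back
    consecutive-sym back      = forth
    consecutive-sym (later c) = later (consecutive-sym c)

    consecutive-∈ : ∀ {l x y} → Consecutive l x y → x ∈ l
    consecutive-∈ forth     = here refl
    consecutive-∈ back      = there (here refl)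
    consecutive-∈ (later c) = there (consecutive-∈ c)

    consecutive-position : ∀ pre {p c post w} → Unique (pre ++ p ∷ c ∷ post) →
      Consecutive (pre ++ p ∷ c ∷ post) c w → w ≡ p ⊎ Σ (List A) λ post′ → post ≡ w ∷ post′
    consecutive-position [] u forth = ⊥-elim (unique-∉ u (here refl))
    consecutive-position [] u back = inj₁ refl
    consecutive-position [] u (later forth) = inj₂ (_ , refl)
    consecutive-position [] u (later back) = ⊥-elim (unique-∉ (unique-tail u) (here refl))
    consecutive-position [] u (later (later c)) = ⊥-elim (unique-∉ (unique-tail u) (consecutive-∈ c))
    consecutive-position (a ∷ []) u forth = ⊥-elim (unique-∉ u (there (here refl)))
    consecutive-position (a ∷ []) u back = ⊥-elim (unique-∉ (unique-tail u) (here refl))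
    consecutive-position (a ∷ b ∷ pre) u forth = ⊥-elim (unique-∉ u (there (∈-++⁺ʳ pre (there (here refl)))))
    consecutive-position (a ∷ b ∷ pre) u back = ⊥-elim (unique-∉ (unique-tail u) (∈-++⁺ʳ pre (there (here refl))))
    consecutive-position (a ∷ pre) u (later c) = consecutive-position pre (unique-tail u) c

    module _ {_~_ : A → A → Set} where

      infixr 5 _++ʷ_
      _++ʷ_ : ∀ {x xs y ys z} → Walk _~_ x xs y → Walk _~_ y ys z → Walk _~_ x (xs ++ ys) z
      []      ++ʷ w = w
      (e ∷ v) ++ʷ w = e ∷ (v ++ʷ w)

      walk-split : ∀ {x y} pre {c post} → Walk _~_ x (pre ++ c ∷ post) y →
        Walk _~_ x (pre ++ c ∷ []) c × Walk _~_ c post y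
      walk-split []        (e ∷ w) = (e ∷ []) , w
      walk-split (p ∷ pre) (e ∷ w) with walk-split pre w
      ... | w₁ , w₂ = (e ∷ w₁) , w₂

      record Prefix (x : A) (xs : List A) (k : A) : Set where
        field
          verts : List A
          walk  : Walk _~_ x verts k
          uniq  : Unique (x ∷ verts)
          sub   : ∀ {z} → z ∈ verts → z ∈ xs

      prefix : ∀ {x xs y k} → Walk _~_ x xs y → Unique (x ∷ xs) → k ∈ x ∷ xs → Prefix x xs k
      prefix w u (here refl) = record { verts = [] ; walk = [] ; uniq = [] ∷ [] ; sub = λ () }
      prefix (e ∷ w) u (there k∈) = record
        { verts = _ ∷ verts
        ; walk  = e ∷ walk
        ; uniq  = unique-∷ (unique-∉ u ∘ grow) uniq
        ; sub   = grow }
        where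
        open Prefix (prefix w (unique-tail u) k∈)
        grow : ∀ {z} → z ∈ _ ∷ verts → z ∈ _
        grow (here refl) = here refl
        grow (there z∈)  = there (sub z∈)

      record Reversal (x : A) (xs : List A) (y : A) : Set where
        field
          verts : List A
          walk  : Walk _~_ y verts x
          len   : length verts ≡ length xs
          uniq  : Unique (x ∷ xs) → Unique (y ∷ verts)
          sub   : ∀ {z} → z ∈ y ∷ verts → z ∈ x ∷ xs

      reverseʷ : (∀ {a b} → a ~ b → b ~ a) → ∀ {x xs y} → Walk _~_ x xs y → Reversal x xs y
      reverseʷ ~-sym [] = record { verts = [] ; walk = [] ; len = refl ; uniq = λ u → u ; sub = λ p → p }
      reverseʷ ~-sym {x} (e ∷ w) = record
        { verts = verts ++ x ∷ []
        ; walk  = walk ++ʷ (~-sym e ∷ [])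
        ; len   = trans (length-++ verts) (trans (+-comm (length verts) 1) (cong suc len))
        ; uniq  = λ u → unique-++ (uniq (unique-tail u)) ([] ∷ [])
                          (λ { z∈ (here refl) → unique-∉ u (sub z∈) })
        ; sub   = λ z∈ → [ (λ p → there (sub p)) , (λ { (here refl) → here refl }) ]′ (∈-++⁻ (_ ∷ verts) z∈) }
        where open Reversal (reverseʷ ~-sym w)

  -- Decidable node sets.

  Sub : Set → Set
  Sub A = A → Bool

  module _ {A : Set} where

    infix 4 _∈ˢ_ _∉ˢ_ _⊆ˢ_ _≗ˢ_
    -- The equation is wrapped in a record so that `x` and `P` can be inferred from a membership
    -- proof.
    record _∈ˢ_ (x : A) (P : Sub A) : Set where
      constructor mem
      field holds : P x ≡ true
    open _∈ˢ_ public

    _∉ˢ_ : A → Sub A → Set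
    x ∉ˢ P = ¬ (x ∈ˢ P)

    _⊆ˢ_ _≗ˢ_ : Sub A → Sub A → Set
    Q ⊆ˢ P = ∀ {x} → x ∈ˢ Q → x ∈ˢ P
    Q ≗ˢ P = ∀ x → Q x ≡ P x

    ∈ˢ? : ∀ x (P : Sub A) → Dec (x ∈ˢ P)
    ∈ˢ? x P with P x in p
    ... | true  = yes (mem p)
    ... | false = no λ q → true≢false (holds q) p

    ∉ˢ⇒false : ∀ {x} {P : Sub A} → x ∉ˢ P → P x ≡ false
    ∉ˢ⇒false {x} {P} q with P x in p
    ... | true  = ⊥-elim (q (mem p))
    ... | false = refl

    ∅ˢ : Sub A
    ∅ˢ _ = false

    ∉∅ˢ : ∀ {x} → x ∉ˢ ∅ˢ
    ∉∅ˢ (mem ())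

    infixr 6 _∪ˢ_
    _∪ˢ_ : Sub A → Sub A → Sub A
    (P ∪ˢ Q) x = P x ∨ Q x

    ∪ˢ⁻ : ∀ {P Q : Sub A} {x} → x ∈ˢ P ∪ˢ Q → x ∈ˢ P ⊎ x ∈ˢ Q
    ∪ˢ⁻ {P} {Q} {x} (mem p) with P x in px
    ... | true  = inj₁ (mem px)
    ... | false = inj₂ (mem p)

    ∪ˢ⁺ˡ : ∀ {P Q : Sub A} → P ⊆ˢ P ∪ˢ Q
    ∪ˢ⁺ˡ (mem p) = mem (cong (_∨ _) p)

    ∪ˢ⁺ʳ : ∀ {P Q : Sub A} → Q ⊆ˢ P ∪ˢ Q
    ∪ˢ⁺ʳ {P} {x = x} (mem q) with P x in px
    ... | true  = mem (cong (_∨ _) px)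
    ... | false = mem (trans (cong (_∨ _) px) q)

    ext : ∀ {P Q : Sub A} → P ⊆ˢ Q → Q ⊆ˢ P → P ≗ˢ Q
    ext {P} {Q} f g x with ∈ˢ? x P | ∈ˢ? x Q
    ... | yes p | _     = trans (holds p) (sym (holds (f p)))
    ... | no ¬p | yes q = ⊥-elim (¬p (g q))
    ... | no ¬p | no ¬q = trans (∉ˢ⇒false ¬p) (sym (∉ˢ⇒false ¬q))

    -- Deleting a node and deleting a closed neighbourhood are both instances, so that commutation
    -- and absorption are proved once for all mixtures of the two.
    remove : Sub A → {D : A → Set} → (∀ y → Dec (D y)) → Sub A
    remove P D? y = P y ∧ not (does (D? y))

    module _ {P : Sub A} {D : A → Set} (D? : ∀ y → Dec (D y)) where

      remove⁺ : ∀ {y} → y ∈ˢ P → ¬ D y → y ∈ˢ remove P D?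
      remove⁺ {y} (mem p) d = mem lemma
        where
        lemma : remove P D? y ≡ true
        lemma with D? y
        ... | yes q = ⊥-elim (d q)
        ... | no _ rewrite p = refl

      remove⁻ : ∀ {y} → y ∈ˢ remove P D? → y ∈ˢ P × ¬ D y
      remove⁻ {y} (mem q) with P y in p | D? y
      remove⁻ {y} (mem q)  | true | no d = mem p , d
      remove⁻ {y} (mem ()) | true | yes _
      remove⁻ {y} (mem ()) | false | _

      remove-∉ : ∀ {y} → D y → y ∉ˢ remove P D?
      remove-∉ d q = proj₂ (remove⁻ q) d

      remove⊆ : remove P D? ⊆ˢ P
      remove⊆ = proj₁ ∘ remove⁻

  module Subsets (A : Set) (_≟_ : (x y : A) → Dec (x ≡ y)) (enum : List A) (complete : ∀ x → x ∈ enum) where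

    search : {Q : A → Set} → (∀ x → Dec (Q x)) → Dec (Σ A Q)
    search Q? with Any.any? Q? enum
    ... | yes p = yes (Any.satisfied p)
    ... | no ¬p = no λ (x , q) → ¬p (Any.map (λ { refl → q }) (complete x))

    infixl 6 _─_
    _─_ : Sub A → A → Sub A
    P ─ x = remove P (_≟ x)

    countOn : List A → Sub A → ℕ
    countOn []       P = 0
    countOn (a ∷ as) P = (if P a then 1 else 0) + countOn as P

    count : Sub A → ℕ
    count = countOn enum

    private
      bit-mono : ∀ {P Q : Sub A} a → (a ∈ˢ Q → a ∈ˢ P) → (if Q a then 1 else 0) ≤ (if P a then 1 else 0)
      bit-mono {P} {Q} a f with Q a in q
      ... | false = z≤n
      ... | true rewrite holds (f (mem q)) = ≤-refl

    countOn-mono : ∀ l {P Q : Sub A} → Q ⊆ˢ P → countOn l Q ≤ countOn l P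
    countOn-mono []      f = z≤n
    countOn-mono (a ∷ l) f = +-mono-≤ (bit-mono a f) (countOn-mono l f)

    countOn-strict : ∀ {l x} {P Q : Sub A} → x ∈ l → Q ⊆ˢ P → x ∈ˢ P → x ∉ˢ Q → countOn l Q < countOn l P
    countOn-strict {a ∷ l} (here refl) f p q rewrite holds p | ∉ˢ⇒false q = s≤s (countOn-mono l f)
    countOn-strict {a ∷ l} (there x∈)  f p q = +-mono-≤-< (bit-mono a f) (countOn-strict x∈ f p q)

    count-strict : ∀ {P Q : Sub A} x → Q ⊆ˢ P → x ∈ˢ P → x ∉ˢ Q → count Q < count P
    count-strict x = countOn-strict (complete x)

  -- Counting independent sets modulo 2.

  module Graph (A : Set) (_≟_ : (x y : A) → Dec (x ≡ y)) (enum : List A) (complete : ∀ x → x ∈ enum)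
    (_~_ : A → A → Set) (_~?_ : ∀ x y → Dec (x ~ y))
    (~-sym : ∀ {x y} → x ~ y → y ~ x) (~-irrefl : ∀ {x} → ¬ (x ~ x)) where

    open Subsets A _≟_ enum complete public

    Nbhd : A → A → Set
    Nbhd x y = y ≡ x ⊎ y ~ x

    nbhd? : ∀ x y → Dec (Nbhd x y)
    nbhd? x y = (y ≟ x) ⊎-dec (y ~? x)

    infixl 6 _─N_
    _─N_ : Sub A → A → Sub A
    P ─N x = remove P (nbhd? x)

    parityOn : List A → Sub A → Bool
    parityOn []       P = true
    parityOn (a ∷ as) P = if P a then parityOn as (P ─ a) xor parityOn as (P ─N a) else parityOn as P

    -- The number of independent sets of the subgraph, modulo 2.
    parity : Sub A → Bool
    parity = parityOn enum

    parityOn-cong : ∀ l {P Q} → P ≗ˢ Q → parityOn l P ≡ parityOn l Q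
    parityOn-cong []      e = refl
    parityOn-cong (a ∷ l) {P} {Q} e with P a | Q a | e a
    ... | true  | .true  | refl = cong₂ _xor_ (parityOn-cong l λ x → cong (_∧ _) (e x)) (parityOn-cong l λ x → cong (_∧ _) (e x))
    ... | false | .false | refl = parityOn-cong l e

    remove-comm : ∀ P {D E : A → Set} (D? : ∀ y → Dec (D y)) (E? : ∀ y → Dec (E y)) →
      remove (remove P D?) E? ≗ˢ remove (remove P E?) D?
    remove-comm P D? E? y with P y | does (D? y) | does (E? y)
    ... | true  | true  | true  = refl
    ... | true  | true  | false = refl
    ... | true  | false | true  = refl
    ... | true  | false | false = refl
    ... | false | _     | _     = refl

    remove-subsumed : ∀ P {D E : A → Set} (D? : ∀ y → Dec (D y)) (E? : ∀ y → Dec (E y)) →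
      (∀ {y} → D y → E y) → remove (remove P D?) E? ≗ˢ remove P E?
    remove-subsumed P D? E? D⇒E = ext
      (λ p → let (q , e) = remove⁻ E? p in remove⁺ E? (proj₁ (remove⁻ D? q)) e)
      (λ p → let (q , e) = remove⁻ E? p in remove⁺ E? (remove⁺ D? q (e ∘ D⇒E)) e)

    private
      xor-middle : ∀ a b c d → (a xor b) xor (c xor d) ≡ (a xor c) xor (b xor d)
      xor-middle true  true  true  d = refl
      xor-middle true  true  false true = refl
      xor-middle true  true  false false = refl
      xor-middle true  false true  true = refl
      xor-middle true  false true  false = refl
      xor-middle true  false false true = refl
      xor-middle true  false false false = refl
      xor-middle false true  true  true = refl
      xor-middle false true  true  false = refl
      xor-middle false true  false true = refl
      xor-middle false true  false false = refl
      xor-middle false false c     d = refl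

      xor-swap : ∀ a b c → (a xor b) xor c ≡ (a xor c) xor b
      xor-swap true  true  true  = refl
      xor-swap true  true  false = refl
      xor-swap true  false true  = refl
      xor-swap true  false false = refl
      xor-swap false true  true  = refl
      xor-swap false true  false = refl
      xor-swap false false true  = refl
      xor-swap false false false = refl

    -- The recursion branches only at heads of the list, so a branching at `x` is moved past each
    -- head `a`. If `a` and `x` are adjacent, no independent set contains both and three terms
    -- remain; otherwise four terms change order.
    parityOn-split : ∀ {l x P} → x ∈ l → x ∈ˢ P → parityOn l P ≡ parityOn l (P ─ x) xor parityOn l (P ─N x)
    parityOn-split {a ∷ l} {x} {P} x∈ p with a ≟ x
    parityOn-split {a ∷ l} {.a} {P} x∈ p | yes refl
      rewrite holds p = refl
    parityOn-split {a ∷ l} {x} {P} (here refl) p | no a≢x = ⊥-elim (a≢x refl)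
    parityOn-split {a ∷ l} {x} {P} (there x∈) p | no a≢x with P a
    ... | false = parityOn-split x∈ p
    ... | true with a ~? x
    ...   | yes a~x = begin
        parityOn l (P ─ a) xor parityOn l (P ─N a)
          ≡⟨ cong (_xor parityOn l (P ─N a)) (parityOn-split x∈ (remove⁺ (_≟ a) p (a≢x ∘ sym))) ⟩
        (parityOn l (P ─ a ─ x) xor parityOn l (P ─ a ─N x)) xor parityOn l (P ─N a)
          ≡⟨ xor-swap (parityOn l (P ─ a ─ x)) _ _ ⟩
        (parityOn l (P ─ a ─ x) xor parityOn l (P ─N a)) xor parityOn l (P ─ a ─N x)
          ≡⟨ cong₂ _xor_ (cong₂ _xor_ (parityOn-cong l (remove-comm P (_≟ a) (_≟ x)))
               (sym (parityOn-cong l (remove-subsumed P (_≟ x) (nbhd? a) λ { refl → inj₂ (~-sym a~x) }))))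
               (parityOn-cong l (remove-subsumed P (_≟ a) (nbhd? x) λ { refl → inj₂ a~x })) ⟩
        (parityOn l (P ─ x ─ a) xor parityOn l (P ─ x ─N a)) xor parityOn l (P ─N x) ∎
        where open ≡-Reasoning
    ...   | no a≁x = begin
        parityOn l (P ─ a) xor parityOn l (P ─N a)
          ≡⟨ cong₂ _xor_ (parityOn-split x∈ (remove⁺ (_≟ a) p (a≢x ∘ sym)))
               (parityOn-split x∈ (remove⁺ (nbhd? a) p [ a≢x ∘ sym , a≁x ∘ ~-sym ]′)) ⟩
        (parityOn l (P ─ a ─ x) xor parityOn l (P ─ a ─N x)) xor (parityOn l (P ─N a ─ x) xor parityOn l (P ─N a ─N x))
          ≡⟨ xor-middle (parityOn l (P ─ a ─ x)) _ _ _ ⟩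
        (parityOn l (P ─ a ─ x) xor parityOn l (P ─N a ─ x)) xor (parityOn l (P ─ a ─N x) xor parityOn l (P ─N a ─N x))
          ≡⟨ cong₂ _xor_
               (cong₂ _xor_ (parityOn-cong l (remove-comm P (_≟ a) (_≟ x))) (parityOn-cong l (remove-comm P (nbhd? a) (_≟ x))))
               (cong₂ _xor_ (parityOn-cong l (remove-comm P (_≟ a) (nbhd? x))) (parityOn-cong l (remove-comm P (nbhd? a) (nbhd? x)))) ⟩
        (parityOn l (P ─ x ─ a) xor parityOn l (P ─ x ─N a)) xor (parityOn l (P ─N x ─ a) xor parityOn l (P ─N x ─N a)) ∎
        where open ≡-Reasoning

    parity-split : ∀ {x P} → x ∈ˢ P → parity P ≡ parity (P ─ x) xor parity (P ─N x)
    parity-split {x} = parityOn-split (complete x)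

-- Minimum degree two: a node whose closed neighbourhood leaves an acyclic rest.

module StructureLemma where

  open import Data.Nat using (suc; _+_; _≤_; _<_; z≤n; s≤s; s≤s⁻¹)
  open import Data.Nat.Properties using (≤-refl; ≤-trans; +-comm; +-suc; m≤n+m)
  open import Data.Nat.Divisibility using (_∣_; ∣m+n∣m⇒∣n; ∣1⇒≡1; ∣m∣n⇒∣m+n; ∣-refl)
  open import Data.List using (List; []; _∷_; _++_; length)
  open import Data.List.Properties using (length-++; ++-assoc)
  open import Data.List.Membership.Propositional using (_∈_; _∉_)
  open import Data.List.Membership.Propositional.Properties using (∈-++⁻; ∈-++⁺ˡ; ∈-++⁺ʳ)
  open import Data.List.Relation.Unary.Any using (here; there)
  open import Data.List.Relation.Unary.All using ([]; _∷_)
  open import Data.List.Relation.Unary.AllPairs using ([]; _∷_)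
  open import Data.List.Relation.Unary.Unique.Propositional using (Unique)
  import Data.Sum as Sum
  open Walks

  module Reduction (A : Set) (_≟_ : (x y : A) → Dec (x ≡ y)) (enum : List A) (complete : ∀ x → x ∈ enum)
    (_~_ : A → A → Set) (_~?_ : ∀ x y → Dec (x ~ y))
    (~-sym : ∀ {x y} → x ~ y → y ~ x) (~-irrefl : ∀ {x} → ¬ (x ~ x))
    (cycle-length : ∀ {x xs y} → Walk _~_ x xs y → Unique (x ∷ xs) → y ~ x → 2 ≤ length xs → 3 ∣ length xs)
    (Con : Sub A → Set)
    (isolated : ∀ {P x} → x ∈ˢ P → (∀ y → y ∈ˢ P → ¬ (x ~ y)) → Con P)
    (con-step : ∀ {P x} → x ∈ˢ P → Con (remove P (_≟ x)) → Con (remove P (λ y → (y ≟ x) ⊎-dec (y ~? x))) → Con P)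
    where

    open Graph A _≟_ enum complete _~_ _~?_ ~-sym ~-irrefl public

    W : A → List A → A → Set
    W = Walk _~_

    ∈-snoc : ∀ (xs : List A) {x z} → z ∈ xs ++ x ∷ [] → z ∈ xs ⊎ z ≡ x
    ∈-snoc xs z∈ with ∈-++⁻ xs z∈
    ... | inj₁ p = inj₁ p
    ... | inj₂ (here refl) = inj₂ refl

    -- The cycle is started at `q₁`: it follows the second walk to `y`, returns along the reversed
    -- first walk to `x`, and closes with the edge to `q₁`. Hence `q₁` is the node left out of the
    -- count.
    two-walks : ∀ {x p y q₁ q} → W x p y → W x (q₁ ∷ q) y → Unique (x ∷ p) → Unique (x ∷ q₁ ∷ q) →
      (∀ {z} → z ∈ p → z ∈ q₁ ∷ q → z ≡ y) → 2 ≤ length q + length p → 3 ∣ length q + length p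
    two-walks {x} {p} {y} {q₁} {q} wp (e ∷ wq) up uq dis len =
      subst (3 ∣_) length-eq (cycle-length (wq ++ʷ R.walk) uniq e (subst (2 ≤_) (sym length-eq) len))
      where
      module R = Reversal (reverseʷ {_~_ = _~_} ~-sym wp)
      length-eq : length (q ++ R.verts) ≡ length q + length p
      length-eq = trans (length-++ q) (cong (length q +_) R.len)
      uniq : Unique (q₁ ∷ q ++ R.verts)
      uniq = unique-++ {xs = q₁ ∷ q} (unique-tail uq) (unique-tail (R.uniq up)) λ z∈q z∈r →
        case R.sub (there z∈r) of λ
          { (here refl) → unique-∉ uq z∈q
          ; (there z∈p) → case dis z∈p z∈q of λ { refl → unique-∉ (R.uniq up) z∈r } }

    nonempty-length : ∀ (l : List A) → l ≢ [] → 1 ≤ length l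
    nonempty-length []      f = ⊥-elim (f refl)
    nonempty-length (_ ∷ _) _ = s≤s z≤n

    -- In the cycle v, c₁, …, cₘ the comb starts at c₃; its teeth c₃, c₆, …, cₘ have degree 2.
    data Comb (P : Sub A) (v : A) : A → List A → Set where
      end  : ∀ {p c} → (∀ w → w ∈ˢ P → c ~ w → w ≡ p ⊎ w ≡ v) → Comb P v p (c ∷ [])
      step : ∀ {p c n n′ l} → (∀ w → w ∈ˢ P → c ~ w → w ≡ p ⊎ w ≡ n) → n′ ~ n → Comb P v n′ l → Comb P v p (c ∷ n ∷ n′ ∷ l)

    teeth : List A → List A
    teeth []               = []
    teeth (c ∷ [])         = c ∷ []
    teeth (c ∷ _ ∷ [])     = c ∷ []
    teeth (c ∷ _ ∷ _ ∷ l)  = c ∷ teeth l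

    teeth⊆ : ∀ l {c} → c ∈ teeth l → c ∈ l
    teeth⊆ (c ∷ [])        (here refl) = here refl
    teeth⊆ (c ∷ _ ∷ [])    (here refl) = here refl
    teeth⊆ (c ∷ _ ∷ _ ∷ l) (here refl) = here refl
    teeth⊆ (c ∷ _ ∷ _ ∷ l) (there t)   = there (there (there (teeth⊆ l t)))

    -- It ensures that removing a closed neighbourhood earlier on the cycle hits no later tooth.
    tooth-neighbours : ∀ {P v p l c w} → Comb P v p l → c ∈ teeth l → w ∈ˢ P → c ~ w → w ∈ p ∷ l ⊎ w ≡ v
    tooth-neighbours (end f) (here refl) pw c~w with f _ pw c~w
    ... | inj₁ refl = inj₁ (here refl)
    ... | inj₂ refl = inj₂ refl
    tooth-neighbours (step f _ b) (here refl) pw c~w with f _ pw c~w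
    ... | inj₁ refl = inj₁ (here refl)
    ... | inj₂ refl = inj₁ (there (there (here refl)))
    tooth-neighbours (step f _ b) (there t) pw c~w = Sum.map (λ z → there (there (there z))) (λ z → z) (tooth-neighbours b t pw c~w)

    -- Invariant: `v` and the node `p` before the first tooth `c` are gone, so only `n` can still be
    -- adjacent to `c`. Deleting `n` isolates `c`; deleting `N[n]` removes `n′` and recreates the
    -- situation at the next tooth. The last tooth has only `p` and `v` as neighbours and is
    -- isolated at once.
    comb-con : ∀ {P v p l} Q → Q ⊆ˢ P → v ∉ˢ Q → p ∉ˢ Q → Comb P v p l → Unique (p ∷ l) → v ∉ l →
      (∀ {c} → c ∈ teeth l → c ∈ˢ Q) → Con Q
    comb-con Q Q⊆P v∉ p∉ (end f) u v∉l alive = isolated (alive (here refl)) λ w w∈ c~w →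
      case f w (Q⊆P w∈) c~w of λ { (inj₁ refl) → p∉ w∈ ; (inj₂ refl) → v∉ w∈ }
    comb-con {v = v} Q Q⊆P v∉ p∉ (step {p} {c} {n} {n′} {l} f n′~n b) u v∉l alive with ∈ˢ? n Q
    ... | no n∉ = isolated (alive (here refl)) λ w w∈ c~w →
      case f w (Q⊆P w∈) c~w of λ { (inj₁ refl) → p∉ w∈ ; (inj₂ refl) → n∉ w∈ }
    ... | yes n∈ = con-step n∈
      (isolated (remove⁺ (_≟ n) (alive (here refl)) (λ { refl → unique-∉ (unique-tail u) (here refl) })) λ w w∈ c~w →
        case f w (Q⊆P (remove⊆ (_≟ n) w∈)) c~w of λ
          { (inj₁ refl) → p∉ (remove⊆ (_≟ n) w∈) ; (inj₂ refl) → proj₂ (remove⁻ (_≟ n) w∈) refl })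
      (comb-con (Q ─N n) (Q⊆P ∘ remove⊆ (nbhd? n)) (v∉ ∘ remove⊆ (nbhd? n)) n′-dead b
        (unique-tail (unique-tail (unique-tail u))) (v∉l ∘ there ∘ there ∘ there) alive′)
      where
      u-n : Unique (n ∷ n′ ∷ l)
      u-n = unique-tail (unique-tail u)
      c~n-or : ∀ {c′} → c′ ∈ teeth l → ¬ Nbhd n c′
      c~n-or t (inj₁ refl) = unique-∉ u-n (there (teeth⊆ l t))
      c~n-or t (inj₂ c′~n) with tooth-neighbours b t (Q⊆P n∈) c′~n
      ... | inj₁ n∈l  = unique-∉ u-n n∈l
      ... | inj₂ refl = v∉l (there (here refl))
      alive′ : ∀ {c′} → c′ ∈ teeth l → c′ ∈ˢ (Q ─N n)
      alive′ t = remove⁺ (nbhd? n) (alive (there t)) (c~n-or t)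
      n′-dead : n′ ∉ˢ Q ─N n
      n′-dead = remove-∉ {P = Q} (nbhd? n) (inj₂ n′~n)

    -- Depth-first search: escapes, spines and forests.

    module MinDegreeTwo (P : Sub A) (another : ∀ {x} p → x ∈ˢ P → Σ A λ w → w ∈ˢ P × x ~ w × w ≢ p) where

      Good : Set
      Good = Σ A λ x → x ∈ˢ P × Con (P ─N x)

      -- A way from the stack down to `w`. The list omits `target`, which is on the stack, and
      -- contains `w`, so `last∈` also makes the walk nonempty.
      record Escape (T : Sub A) (cs K : List A) (w : A) : Set where
        field
          target  : A
          verts   : List A
          target∈ : target ∈ K
          walk    : W target verts w
          uniq    : Unique verts
          inside  : ∀ {e} → e ∈ verts → e ∈ˢ T
          avoids  : ∀ {e} → e ∈ verts → e ∉ cs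
          last∈   : w ∈ verts

      -- The tree path of the search. It has no chords inside `T`, since an escape cannot end on the
      -- path it avoids; every edge leaving it inside `T` ends in a node that is joined to the stack
      -- above `v` without meeting the path again.
      record Spine (T : Sub A) (v : A) (K : List A) (y : A) : Set where
        field
          verts  : List A
          walk   : W v verts y
          uniq   : Unique verts
          inside : ∀ {c} → c ∈ verts → c ∈ˢ T
          branch : ∀ {c w} → c ∈ v ∷ verts → w ∈ˢ T → c ~ w → Consecutive (v ∷ verts) c w ⊎ Escape T verts K w

      -- The part of U reachable from v, where v ∷ K is the stack of a depth-first search:
      -- every branch of this part leads back to the stack strictly above v.
      record Forest (U : Sub A) (v : A) (K : List A) : Set where
        field
          T       : Sub A
          T⊆U     : T ⊆ˢ U
          closed  : ∀ {x w} → x ∈ˢ T → w ∈ˢ P → x ~ w → w ∈ˢ T ⊎ w ∈ v ∷ K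
          full    : ∀ {w} → w ∈ˢ U → v ~ w → w ∈ˢ T
          escape  : ∀ {w} → w ∈ˢ T → v ~ w → Escape T [] K w
          spine   : ∀ {y} → y ∈ˢ T → Spine T v K y

      Stack : A → List A → Set
      Stack v K = Σ A λ z → W v K z × Unique (v ∷ K)

      -- The cycle closed by a back edge.

      module CloseCycle {v u : A} {L : List A} {U : Sub A} (stack : Stack v L) (v~u : v ~ u) (Pu : u ∈ˢ P) (u∉ : u ∉ v ∷ L)
        (U⊆P : U ⊆ˢ P) (U∉ : ∀ {x} → x ∈ˢ U → x ∉ u ∷ v ∷ L) (F : Forest U u (v ∷ L)) {y : A} (Ty : y ∈ˢ Forest.T F) (y~v : y ~ v) where

        open Forest F
        private
          module S = Spine (spine Ty)

        cs : List A
        cs = u ∷ S.verts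

        walk : W v cs y
        walk = v~u ∷ S.walk

        T∉ : ∀ {x} → x ∈ˢ T → x ∉ u ∷ v ∷ L
        T∉ = U∉ ∘ T⊆U

        uniq-cs : Unique cs
        uniq-cs = unique-∷ (λ p → T∉ (S.inside p) (here refl)) S.uniq

        cs∉L : ∀ {c} → c ∈ cs → c ∉ v ∷ L
        cs∉L (here refl) p = u∉ p
        cs∉L (there c∈)  p = T∉ (S.inside c∈) (there p)

        uniq-v∷cs : Unique (v ∷ cs)
        uniq-v∷cs = unique-∷ (λ p → cs∉L p (here refl)) uniq-cs

        verts-nonempty : 1 ≤ length S.verts
        verts-nonempty with S.verts in eq | S.walk
        ... | _ ∷ _ | _  = s≤s z≤n
        ... | []    | [] = ⊥-elim (T∉ Ty (here refl))

        3∣m : 3 ∣ length cs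
        3∣m = cycle-length walk uniq-v∷cs y~v (s≤s verts-nonempty)

        -- A second walk from v to c closes two cycles with the two arcs of v, c₁, …, cₘ between v and c;
        -- their lengths are incompatible modulo 3.
        no-chord : ∀ pre {p c post} → cs ≡ pre ++ p ∷ c ∷ post → 3 ∣ 2 + length pre → ∀ {g} → W v g c → Unique (v ∷ g) →
          (∀ {z} → z ∈ g → z ∈ cs → z ≡ c) → 2 ≤ length g + length post → ⊥
        no-chord pre {p} {c} {post} eq 3∣j {[]} [] uniq-g meet len = cs∉L (subst (_ ∈_) (sym eq) (∈-++⁺ʳ pre (there (here refl)))) (here refl)
        no-chord pre {p} {c} {post} eq 3∣j {g₁ ∷ g} wg uniq-g meet len =
          case ∣1⇒≡1 (∣m+n∣m⇒∣n (subst (3 ∣_) (+-comm 1 (length g)) 3∣g₁) 3∣g) of λ ()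
          where
          front : List A
          front = pre ++ p ∷ []
          eq′ : cs ≡ front ++ c ∷ post
          eq′ = trans eq (sym (++-assoc pre (p ∷ []) (c ∷ post)))
          len-front : length (front ++ c ∷ []) ≡ 2 + length pre
          len-front = trans (length-++ front) (trans (cong (_+ 1) (length-++ pre)) (trans (+-comm (length pre + 1) 1) (cong suc (+-comm (length pre) 1))))
          front-cs : cs ≡ (front ++ c ∷ []) ++ post
          front-cs = trans eq′ (sym (++-assoc front (c ∷ []) post))
          walks : W v (front ++ c ∷ []) c × W c post y
          walks = walk-split front (subst (λ l → W v l y) eq′ walk)
          3∣post : 3 ∣ length post
          3∣post = ∣m+n∣m⇒∣n (subst (3 ∣_) (trans (cong length front-cs) (trans (length-++ (front ++ c ∷ [])) (cong (_+ length post) len-front))) 3∣m) 3∣j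
          c∉post : c ∉ post
          c∉post = unique-∉ (unique-++ʳ front (subst Unique eq′ uniq-cs))
          post⊆ : ∀ {z} → z ∈ post → z ∈ cs
          post⊆ z∈ = subst (_ ∈_) (sym eq′) (∈-++⁺ʳ front (there z∈))
          front⊆ : ∀ {z} → z ∈ front ++ c ∷ [] → z ∈ cs
          front⊆ z∈ = subst (_ ∈_) (sym front-cs) (∈-++⁺ˡ z∈)
          uniq-post : Unique post
          uniq-post = unique-tail (unique-++ʳ front (subst Unique eq′ uniq-cs))
          -- With the arc behind `c`, whose length is divisible by 3, the second walk must have a
          -- number of edges divisible by 3. With the arc before `c` the closing edge already
          -- belongs to the walk, which then must have remainder 1.
          3∣g₁ : 3 ∣ 1 + length g
          3∣g₁ = ∣m+n∣m⇒∣n (subst (3 ∣_) (trans (length-++ (g₁ ∷ g)) (+-comm (suc (length g)) (length post)))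
            (cycle-length (wg ++ʷ proj₂ walks)
              (unique-++ {xs = v ∷ g₁ ∷ g} uniq-g uniq-post λ
                { (here refl) z∈ → cs∉L (post⊆ z∈) (here refl)
                ; (there z∈g) z∈ → c∉post (subst (_∈ post) (meet z∈g (post⊆ z∈)) z∈) })
              y~v (subst (2 ≤_) (sym (length-++ (g₁ ∷ g))) len))) 3∣post
          3∣g : 3 ∣ length g
          3∣g = ∣m+n∣m⇒∣n (subst (3 ∣_) (trans (cong (length g +_) len-front) (+-comm (length g) _))
            (two-walks (proj₁ walks) wg (unique-++ˡ (v ∷ front ++ c ∷ []) (subst (λ l → Unique (v ∷ l)) front-cs uniq-v∷cs)) uniq-g
              (λ z∈f z∈g → meet z∈g (front⊆ z∈f))
              (subst (λ k → 2 ≤ length g + k) (sym len-front) (≤-trans (s≤s (s≤s z≤n)) (m≤n+m _ (length g)))))) 3∣j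

        After : A → List A → Set
        After w []      = w ≡ v
        After w (n ∷ _) = w ≡ n

        -- A further neighbour of `c` is on the stack or ends an escape. Climbing the stack from
        -- `v`, and then taking the escape if there is one, gives a second path to `c` that meets
        -- the cycle only in its ends, which `no-chord` forbids. Through `After`, `v` counts as the
        -- successor of the last node.
        tooth : ∀ pre {p c post} → cs ≡ pre ++ p ∷ c ∷ post → 3 ∣ 2 + length pre → ∀ w → w ∈ˢ P → c ~ w → w ≡ p ⊎ After w post
        tooth pre {p} {c} {post} eq 3∣j w Pw c~w with w ≟ p
        ... | yes w≡p = inj₁ w≡p
        ... | no w≢p = cases
          where
          c∈verts : c ∈ S.verts
          c∈verts = at pre eq
            where
            at : ∀ {l} pre → u ∷ l ≡ pre ++ p ∷ c ∷ post → c ∈ l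
            at []        refl = here refl
            at (_ ∷ pre) refl = ∈-++⁺ʳ pre (there (here refl))
          c∈ : c ∈ cs
          c∈ = there c∈verts
          Tc : c ∈ˢ T
          Tc = S.inside c∈verts

          from-consecutive : Consecutive cs c w → w ≡ p ⊎ After w post
          from-consecutive con with consecutive-position pre (subst Unique eq uniq-cs) (subst (λ l → Consecutive l c w) eq con)
          ... | inj₁ w≡p = inj₁ w≡p
          ... | inj₂ (_ , refl) = inj₂ refl

          via-stack : ∀ {k} → k ∈ v ∷ L → k ~ c → (k ≡ v → post ≢ []) → ⊥
          via-stack {k} k∈ k~c short = no-chord pre eq 3∣j (Pre.walk ++ʷ (k~c ∷ []))
            (unique-++ {xs = v ∷ Pre.verts} Pre.uniq ([] ∷ []) (λ { z∈ (here refl) → cs∉L c∈ (pre⊆ z∈) }))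
            (λ z∈ z∈cs → [ (λ q → ⊥-elim (cs∉L z∈cs (there (Pre.sub q)))) , (λ q → q) ]′ (∈-snoc Pre.verts z∈))
            (long Pre.walk)
            where
            module Pre = Prefix (prefix (proj₁ (proj₂ stack)) (proj₂ (proj₂ stack)) k∈)
            pre⊆ : ∀ {z} → z ∈ v ∷ Pre.verts → z ∈ v ∷ L
            pre⊆ (here q)  = here q
            pre⊆ (there q) = there (Pre.sub q)
            long : ∀ {l} → W v l k → 2 ≤ length (l ++ c ∷ []) + length post
            long [] = s≤s (nonempty-length post (short refl))
            long {_ ∷ l} (_ ∷ _) rewrite length-++ l {c ∷ []} | +-comm (length l) 1 = s≤s (s≤s z≤n)

          via-escape : Escape T S.verts (v ∷ L) w → ⊥
          via-escape E = no-chord pre eq 3∣j (Pre.walk ++ʷ (E.walk ++ʷ (~-sym c~w ∷ [])))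
            (unique-++ {xs = v ∷ Pre.verts} Pre.uniq
              (unique-++ E.uniq ([] ∷ []) (λ { z∈ (here refl) → E.avoids z∈ c∈verts }))
              (λ z∈ q → [ (λ r → T∉ (E.inside r) (there (pre⊆ z∈))) , (λ { refl → cs∉L c∈ (pre⊆ z∈) }) ]′ (∈-snoc E.verts q)))
            (λ z∈ z∈cs → case ∈-++⁻ Pre.verts z∈ of λ
              { (inj₁ q) → ⊥-elim (cs∉L z∈cs (there (Pre.sub q)))
              ; (inj₂ q) → case ∈-snoc E.verts q of λ { (inj₂ r) → r ; (inj₁ r) → ⊥-elim (clash r z∈cs) } })
            long
            where
            module E = Escape E
            module Pre = Prefix (prefix (proj₁ (proj₂ stack)) (proj₂ (proj₂ stack)) E.target∈)
            pre⊆ : ∀ {z} → z ∈ v ∷ Pre.verts → z ∈ v ∷ L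
            pre⊆ (here q)  = here q
            pre⊆ (there q) = there (Pre.sub q)
            clash : ∀ {z} → z ∈ E.verts → z ∉ cs
            clash r (here refl) = T∉ (E.inside r) (here refl)
            clash r (there q)   = E.avoids r q
            long : 2 ≤ length (Pre.verts ++ E.verts ++ c ∷ []) + length post
            long with E.verts | E.last∈
            ... | e ∷ es | _ rewrite length-++ Pre.verts {e ∷ es ++ c ∷ []} | length-++ es {c ∷ []} | +-comm (length es) 1 | +-suc (length Pre.verts) (suc (length es)) | +-suc (length Pre.verts) (length es) = s≤s (s≤s z≤n)

          -- The edge to `v` closes the cycle when `c` is its last node; anywhere else it is itself
          -- a forbidden chord.
          last? : w ≡ v → w ≡ p ⊎ After w post
          last? w≡v = inj₂ (decide post λ ne → via-stack (here w≡v) (~-sym c~w) λ _ → ne)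
            where
            decide : ∀ q → ¬ (q ≢ []) → After w q
            decide []      _ = w≡v
            decide (_ ∷ _) f = ⊥-elim (f λ ())

          cases : w ≡ p ⊎ After w post
          cases with closed Tc Pw c~w
          ... | inj₂ (there (here w≡v)) = last? w≡v
          ... | inj₂ (there (there w∈L)) = ⊥-elim (via-stack (there w∈L) (~-sym c~w) λ { refl → ⊥-elim (unique-∉ (proj₂ (proj₂ stack)) w∈L) })
          ... | inj₁ Tw with S.branch c∈ Tw c~w
          ...   | inj₁ con = from-consecutive con
          ...   | inj₂ E   = ⊥-elim (via-escape E)
          -- Here `w` is `u`, which is on the stack from the viewpoint of `T`, so the edge is read
          -- from the end `u` of the spine. An escape ending in `c` is absurd, because `c` is on the
          -- spine it avoids.
          cases | inj₂ (here refl) with S.branch (here refl) Tc (~-sym c~w)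
          ...   | inj₁ con = from-consecutive (consecutive-sym con)
          ...   | inj₂ E   = ⊥-elim (Escape.avoids E (Escape.last∈ E) c∈verts)

        -- As `c₁` is the head of `cs`, the node after `p` is `c_j` with `j = 2 + length pre`, hence
        -- a tooth. Since 3 divides `length cs`, `rest` has length 1 modulo 3, which excludes rests
        -- of length 0 and 2.
        comb : ∀ pre p rest → cs ≡ pre ++ p ∷ rest → 3 ∣ 2 + length pre → Comb P v p rest
        comb pre p [] eq 3∣j =
          case ∣1⇒≡1 (∣m+n∣m⇒∣n (subst (3 ∣_) (+-comm 1 (suc (length pre))) 3∣j) (subst (3 ∣_) (trans (cong length eq) (trans (length-++ pre) (+-comm (length pre) 1))) 3∣m)) of λ ()
        comb pre p (c ∷ []) eq 3∣j = end (tooth pre eq 3∣j)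
        comb pre p (c ∷ n ∷ []) eq 3∣j =
          case ∣1⇒≡1 (∣m+n∣m⇒∣n (subst (3 ∣_) (trans (cong length eq) (trans (length-++ pre) (+-comm3 (length pre)))) 3∣m) 3∣j) of λ ()
          where
          +-comm3 : ∀ k → k + 3 ≡ 2 + k + 1
          +-comm3 k = trans (+-comm k 3) (+-comm 1 (2 + k))
        comb pre p (c ∷ n ∷ n′ ∷ l) eq 3∣j = step (tooth pre eq 3∣j)
          (~-sym (edge (subst (λ k → W v k y) (trans eq (sym (++-assoc pre (p ∷ c ∷ []) _))) walk)))
          (comb (pre ++ p ∷ c ∷ n ∷ []) n′ l (trans eq (sym (++-assoc pre (p ∷ c ∷ n ∷ []) (n′ ∷ l))))
            (subst (λ k → 3 ∣ 2 + k) (sym (trans (length-++ pre) (+-comm (length pre) 3))) (∣m∣n⇒∣m+n {m = 3} ∣-refl 3∣j)))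
          where
          edge : W v ((pre ++ p ∷ c ∷ []) ++ n ∷ n′ ∷ l) y → n ~ n′
          edge w with proj₂ (walk-split (pre ++ p ∷ c ∷ []) w)
          ... | e ∷ _ = e

        -- Removing the closed neighbourhood of `u = c₁` deletes `v` and `c₂`, which starts the
        -- invariant of `comb-con` at c₃, and spares all teeth.
        good : Good
        good with S.verts in eq | S.walk
        ... | [] | [] = ⊥-elim (T∉ Ty (here refl))
        ... | c₂ ∷ rest | u~c₂ ∷ w = u , Pu , comb-con (P ─N u) (remove⊆ (nbhd? u)) (remove-∉ (nbhd? u) (inj₂ v~u))
            (remove-∉ (nbhd? u) (inj₂ (~-sym u~c₂))) teeth-comb
            (unique-tail (subst (λ l → Unique (u ∷ l)) eq uniq-cs))
            (λ p → unique-∉ uniq-v∷cs (there (subst (v ∈_) (sym eq) (there p))))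
            alive
          where
          teeth-comb : Comb P v c₂ rest
          teeth-comb = comb (u ∷ []) c₂ rest (cong (u ∷_) eq) ∣-refl
          rest⊆ : ∀ {c} → c ∈ rest → c ∈ S.verts
          rest⊆ p = subst (_ ∈_) (sym eq) (there p)
          alive : ∀ {c} → c ∈ teeth rest → c ∈ˢ P ─N u
          alive t = remove⁺ (nbhd? u) (U⊆P (T⊆U (S.inside (rest⊆ c∈)))) λ
            { (inj₁ refl) → unique-∉ uniq-cs (rest⊆ c∈)
            ; (inj₂ c~u) → case tooth-neighbours teeth-comb t Pu c~u of λ
                { (inj₁ u∈) → unique-∉ uniq-cs (subst (u ∈_) (sym eq) u∈)
                ; (inj₂ refl) → ~-irrefl v~u } }
            where c∈ = teeth⊆ rest t

      weaken : ∀ {T T′ cs cs′ K K′ w} → T ⊆ˢ T′ → (∀ {e} → e ∈ˢ T → e ∈ cs′ → e ∈ cs) →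
        (E : Escape T cs K w) → Escape.target E ∈ K′ → Escape T′ cs′ K′ w
      weaken T⊆ cs⊆ E k∈ = record
        { target = target ; verts = verts ; target∈ = k∈ ; walk = walk ; uniq = uniq
        ; inside = T⊆ ∘ inside ; avoids = λ e∈ e∈cs → avoids e∈ (cs⊆ (inside e∈) e∈cs) ; last∈ = last∈ }
        where open Escape E

      -- Joining the subtree of a child with the rest of the forest.

      module Join {U : Sub A} {v u : A} {L : List A} (U⊆P : U ⊆ˢ P) (U∉ : ∀ {x} → x ∈ˢ U → x ∉ v ∷ L)
        (U-closed : ∀ {x w} → x ∈ˢ U → w ∈ˢ P → x ~ w → w ∈ˢ U ⊎ w ∈ v ∷ L) (Uu : u ∈ˢ U) (v~u : v ~ u)
        (F₁ : Forest (U ─ u) u (v ∷ L)) (clean : ∀ {y} → y ∈ˢ Forest.T F₁ → ¬ (y ~ v)) where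

        private
          module F₁ = Forest F₁

        Tᵤ : Sub A
        Tᵤ = (λ x → does (x ≟ u)) ∪ˢ F₁.T

        u∈Tᵤ : u ∈ˢ Tᵤ
        u∈Tᵤ = ∪ˢ⁺ˡ {Q = F₁.T} (mem (is-yes (u ≟ u)))
          where
          is-yes : (d : Dec (u ≡ u)) → does d ≡ true
          is-yes (yes _) = refl
          is-yes (no f)  = ⊥-elim (f refl)

        Tᵤ⁻ : ∀ {x} → x ∈ˢ Tᵤ → x ≡ u ⊎ x ∈ˢ F₁.T
        Tᵤ⁻ {x} p with ∪ˢ⁻ {P = λ x → does (x ≟ u)} {Q = F₁.T} p
        ... | inj₂ q = inj₂ q
        ... | inj₁ (mem q) with x ≟ u
        ...   | yes e = inj₁ e
        Tᵤ⁻ {x} p | inj₁ (mem ()) | no _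

        T₁⊆Tᵤ : F₁.T ⊆ˢ Tᵤ
        T₁⊆Tᵤ = ∪ˢ⁺ʳ {P = λ x → does (x ≟ u)}

        T₁⊆U : F₁.T ⊆ˢ U
        T₁⊆U = remove⊆ (_≟ u) ∘ F₁.T⊆U

        Tᵤ⊆U : Tᵤ ⊆ˢ U
        Tᵤ⊆U p = [ (λ { refl → Uu }) , T₁⊆U ]′ (Tᵤ⁻ p)

        u∉T₁ : u ∉ˢ F₁.T
        u∉T₁ p = proj₂ (remove⁻ (_≟ u) (F₁.T⊆U p)) refl

        Tᵤ-closed : ∀ {x w} → x ∈ˢ Tᵤ → w ∈ˢ P → x ~ w → w ∈ˢ Tᵤ ⊎ w ∈ v ∷ L
        Tᵤ-closed {x} {w} x∈ Pw x~w with Tᵤ⁻ x∈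
        ... | inj₂ x∈T₁ with F₁.closed x∈T₁ Pw x~w
        ...   | inj₁ w∈T₁         = inj₁ (T₁⊆Tᵤ w∈T₁)
        ...   | inj₂ (here refl)  = inj₁ u∈Tᵤ
        ...   | inj₂ (there w∈)   = inj₂ w∈
        Tᵤ-closed {x} {w} x∈ Pw x~w | inj₁ refl with U-closed Uu Pw x~w
        ...   | inj₂ w∈ = inj₂ w∈
        ...   | inj₁ w∈U = inj₁ (T₁⊆Tᵤ (F₁.full (remove⁺ (_≟ u) w∈U (λ { refl → ~-irrefl x~w })) x~w))

        -- No vertex of T₁ is adjacent to v, so walks that escaped to v ∷ L escape to L.
        raise : ∀ {cs w} → Escape F₁.T cs (v ∷ L) w → Escape Tᵤ (u ∷ cs) L w
        raise {cs} {w} E = weaken T₁⊆Tᵤ avoid E (above (Escape.target∈ E) (Escape.walk E) (Escape.inside E) (Escape.last∈ E))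
          where
          avoid : ∀ {e} → e ∈ˢ F₁.T → e ∈ u ∷ cs → e ∈ cs
          avoid e∈T (here refl) = ⊥-elim (u∉T₁ e∈T)
          avoid e∈T (there q)   = q
          above : ∀ {k es} → k ∈ v ∷ L → W k es w → (∀ {e} → e ∈ es → e ∈ˢ F₁.T) → w ∈ es → k ∈ L
          above (here refl) (v~e ∷ _) inside _ = ⊥-elim (clean (inside (here refl)) (~-sym v~e))
          above (here refl) [] inside ()
          above (there k∈) _ _ _ = k∈

        -- Minimum degree two enters here: `u` has a neighbour besides `v`. If that neighbour is on
        -- the stack, the edge is the escape; otherwise it lies below `u` and its own escape is
        -- prolonged to `u`.
        escape-u : ∀ {cs} → (∀ {e} → e ∈ˢ Tᵤ → e ∉ cs) → Escape Tᵤ cs L u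
        escape-u {cs} avoid with another v (U⊆P Uu)
        ... | w , Pw , u~w , w≢v with U-closed Uu Pw u~w
        ...   | inj₂ (here refl) = ⊥-elim (w≢v refl)
        ...   | inj₂ (there w∈L) = record
          { target = w ; verts = u ∷ [] ; target∈ = w∈L ; walk = ~-sym u~w ∷ [] ; uniq = [] ∷ []
          ; inside = λ { (here refl) → u∈Tᵤ } ; avoids = λ { (here refl) → avoid u∈Tᵤ } ; last∈ = here refl }
        ...   | inj₁ w∈U = record
          { target = E.target ; verts = E.verts ++ u ∷ [] ; target∈ = E.target∈
          ; walk = E.walk ++ʷ (~-sym u~w ∷ [])
          ; uniq = unique-++ E.uniq ([] ∷ []) (λ { e∈ (here refl) → E.avoids e∈ (here refl) })
          ; inside = inside
          ; avoids = λ e∈ → avoid (inside e∈)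
          ; last∈ = ∈-++⁺ʳ E.verts (here refl) }
          where
          w≢u : w ≢ u
          w≢u refl = ~-irrefl u~w
          module E = Escape (raise (F₁.escape (F₁.full (remove⁺ (_≟ u) w∈U w≢u) u~w) u~w))
          inside : ∀ {e} → e ∈ E.verts ++ u ∷ [] → e ∈ˢ Tᵤ
          inside e∈ = [ E.inside , (λ { refl → u∈Tᵤ }) ]′ (∈-snoc E.verts e∈)

        U₂ : Sub A
        U₂ = remove U (λ x → ∈ˢ? x Tᵤ)

        U₂⊆U : U₂ ⊆ˢ U
        U₂⊆U = remove⊆ (λ x → ∈ˢ? x Tᵤ)

        U₂-closed : ∀ {x w} → x ∈ˢ U₂ → w ∈ˢ P → x ~ w → w ∈ˢ U₂ ⊎ w ∈ v ∷ L
        U₂-closed {x} {w} x∈ Pw x~w with remove⁻ (λ x → ∈ˢ? x Tᵤ) x∈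
        ... | x∈U , x∉Tᵤ with U-closed x∈U Pw x~w
        ...   | inj₂ w∈ = inj₂ w∈
        ...   | inj₁ w∈U with ∈ˢ? w Tᵤ
        ...     | no w∉ = inj₁ (remove⁺ (λ x → ∈ˢ? x Tᵤ) w∈U w∉)
        ...     | yes w∈ with Tᵤ-closed w∈ (U⊆P x∈U) (~-sym x~w)
        ...       | inj₁ x∈Tᵤ = ⊥-elim (x∉Tᵤ x∈Tᵤ)
        ...       | inj₂ x∈L  = ⊥-elim (U∉ x∈U x∈L)

        module _ (F₂ : Forest U₂ v L) where
          private
            module F₂ = Forest F₂

          T : Sub A
          T = Tᵤ ∪ˢ F₂.T

          Tᵤ⊆T : Tᵤ ⊆ˢ T
          Tᵤ⊆T = ∪ˢ⁺ˡ {Q = F₂.T}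

          T₂⊆T : F₂.T ⊆ˢ T
          T₂⊆T = ∪ˢ⁺ʳ {P = Tᵤ}

          T⁻ : ∀ {x} → x ∈ˢ T → x ∈ˢ Tᵤ ⊎ x ∈ˢ F₂.T
          T⁻ = ∪ˢ⁻ {P = Tᵤ}

          T₂∉Tᵤ : ∀ {x} → x ∈ˢ F₂.T → x ∉ˢ Tᵤ
          T₂∉Tᵤ p = proj₂ (remove⁻ (λ x → ∈ˢ? x Tᵤ) (F₂.T⊆U p))

          T₂∉ : ∀ {x} → x ∈ˢ F₂.T → x ∉ v ∷ L
          T₂∉ p = U∉ (U₂⊆U (F₂.T⊆U p))

          no-edge : ∀ {x w} → x ∈ˢ Tᵤ → w ∈ˢ F₂.T → ¬ (x ~ w)
          no-edge x∈ w∈ x~w with Tᵤ-closed x∈ (U⊆P (U₂⊆U (F₂.T⊆U w∈))) x~w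
          ... | inj₁ w∈Tᵤ = T₂∉Tᵤ w∈ w∈Tᵤ
          ... | inj₂ w∈L  = T₂∉ w∈ w∈L

          lower : ∀ {cs w} → Escape Tᵤ cs L w → Escape T cs L w
          lower E = weaken Tᵤ⊆T (λ _ p → p) E (Escape.target∈ E)

          other : ∀ {cs w} → w ∈ˢ F₂.T → v ~ w → (∀ {e} → e ∈ˢ F₂.T → e ∉ cs) → Escape T cs L w
          other w∈ v~w avoid = weaken T₂⊆T (λ e∈ e∈cs → ⊥-elim (avoid e∈ e∈cs)) (F₂.escape w∈ v~w) (Escape.target∈ (F₂.escape w∈ v~w))

          branch-v : ∀ {cs w} → (∀ {e} → e ∈ cs → e ∈ˢ Tᵤ) → w ∈ˢ T → v ~ w → w ≡ u ⊎ Escape T cs L w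
          branch-v cs⊆ w∈ v~w with T⁻ w∈
          ... | inj₂ w∈T₂ = inj₂ (other w∈T₂ v~w (λ e∈ e∈cs → T₂∉Tᵤ e∈ (cs⊆ e∈cs)))
          ... | inj₁ w∈Tᵤ with Tᵤ⁻ w∈Tᵤ
          ...   | inj₁ w≡u  = inj₁ w≡u
          ...   | inj₂ w∈T₁ = ⊥-elim (clean w∈T₁ (~-sym v~w))

          spine-u : Spine T v L u
          spine-u = record
            { verts = u ∷ [] ; walk = v~u ∷ [] ; uniq = [] ∷ []
            ; inside = λ { (here refl) → Tᵤ⊆T u∈Tᵤ }
            ; branch = branch }
            where
            branch : ∀ {c w} → c ∈ v ∷ u ∷ [] → w ∈ˢ T → c ~ w → Consecutive (v ∷ u ∷ []) c w ⊎ Escape T (u ∷ []) L w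
            branch (here refl) w∈ v~w with branch-v (λ { (here refl) → u∈Tᵤ }) w∈ v~w
            ... | inj₁ refl = inj₁ forth
            ... | inj₂ E    = inj₂ E
            branch (there (here refl)) w∈ u~w with T⁻ w∈
            ... | inj₂ w∈T₂ = ⊥-elim (no-edge u∈Tᵤ w∈T₂ u~w)
            ... | inj₁ w∈Tᵤ with Tᵤ⁻ w∈Tᵤ
            ...   | inj₁ refl = ⊥-elim (~-irrefl u~w)
            ...   | inj₂ w∈T₁ = inj₂ (lower (raise (F₁.escape w∈T₁ u~w)))

          spine-below : ∀ {y} → y ∈ˢ F₁.T → Spine T v L y
          spine-below y∈ = record
            { verts = u ∷ S.verts ; walk = v~u ∷ S.walk
            ; uniq = unique-∷ (λ p → u∉T₁ (S.inside p)) S.uniq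
            ; inside = Tᵤ⊆T ∘ inside
            ; branch = branch }
            where
            module S = Spine (F₁.spine y∈)
            inside : ∀ {e} → e ∈ u ∷ S.verts → e ∈ˢ Tᵤ
            inside (here refl) = u∈Tᵤ
            inside (there p)   = T₁⊆Tᵤ (S.inside p)
            branch : ∀ {c w} → c ∈ v ∷ u ∷ S.verts → w ∈ˢ T → c ~ w → Consecutive (v ∷ u ∷ S.verts) c w ⊎ Escape T (u ∷ S.verts) L w
            branch (here refl) w∈ v~w with branch-v inside w∈ v~w
            ... | inj₁ refl = inj₁ forth
            ... | inj₂ E    = inj₂ E
            branch (there c∈) w∈ c~w with T⁻ w∈
            ... | inj₂ w∈T₂ = ⊥-elim (no-edge (inside c∈) w∈T₂ c~w)
            ... | inj₁ w∈Tᵤ with Tᵤ⁻ w∈Tᵤ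
            ...   | inj₂ w∈T₁ = Sum.map later (lower ∘ raise) (S.branch c∈ w∈T₁ c~w)
            branch (there (here refl)) w∈ c~w | inj₁ w∈Tᵤ | inj₁ refl = ⊥-elim (~-irrefl c~w)
            -- An edge back to `u` is visible only from `u`, the root of the smaller forest. As
            -- before, an escape ending on its own spine is absurd.
            branch (there (there c∈))  w∈ c~w | inj₁ w∈Tᵤ | inj₁ refl with S.branch (here refl) (S.inside c∈) (~-sym c~w)
            ... | inj₁ con = inj₁ (later (consecutive-sym con))
            ... | inj₂ E   = ⊥-elim (Escape.avoids E (Escape.last∈ E) c∈)

          spine-beside : ∀ {y} → y ∈ˢ F₂.T → Spine T v L y
          spine-beside y∈ = record
            { verts = S.verts ; walk = S.walk ; uniq = S.uniq ; inside = T₂⊆T ∘ S.inside ; branch = branch }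
            where
            module S = Spine (F₂.spine y∈)
            branch : ∀ {c w} → c ∈ v ∷ S.verts → w ∈ˢ T → c ~ w → Consecutive (v ∷ S.verts) c w ⊎ Escape T S.verts L w
            branch c∈ w∈ c~w with T⁻ w∈
            ... | inj₂ w∈T₂ = Sum.map (λ p → p) (λ E → weaken T₂⊆T (λ _ p → p) E (Escape.target∈ E)) (S.branch c∈ w∈T₂ c~w)
            branch (there c∈) w∈ c~w | inj₁ w∈Tᵤ = ⊥-elim (no-edge w∈Tᵤ (S.inside c∈) (~-sym c~w))
            branch (here refl) w∈ v~w | inj₁ w∈Tᵤ with Tᵤ⁻ w∈Tᵤ
            -- The spine lies beside the subtree of `u`, so the edge from `v` to `u` leaves it, and
            -- `u` escapes inside its own subtree.
            ... | inj₁ refl = inj₂ (lower (escape-u (λ e∈ e∈S → T₂∉Tᵤ (S.inside e∈S) e∈)))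
            ... | inj₂ w∈T₁ = ⊥-elim (clean w∈T₁ (~-sym v~w))

          join : Forest U v L
          join = record
            { T = T
            ; T⊆U = λ p → [ Tᵤ⊆U , (λ q → U₂⊆U (F₂.T⊆U q)) ]′ (T⁻ p)
            ; closed = λ x∈ Pw x~w → [ (λ p → Sum.map Tᵤ⊆T (λ q → q) (Tᵤ-closed p Pw x~w))
                                     , (λ p → Sum.map T₂⊆T (λ q → q) (F₂.closed p Pw x~w)) ]′ (T⁻ x∈)
            ; full = full
            ; escape = λ w∈ v~w → [ (λ { refl → lower (escape-u (λ _ ())) }) , (λ E → E) ]′ (branch-v (λ ()) w∈ v~w)
            ; spine = spine }
            where
            full : ∀ {w} → w ∈ˢ U → v ~ w → w ∈ˢ T
            full {w} w∈ v~w with ∈ˢ? w Tᵤ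
            ... | yes p = Tᵤ⊆T p
            ... | no ¬p = T₂⊆T (F₂.full (remove⁺ (λ x → ∈ˢ? x Tᵤ) w∈ ¬p) v~w)
            spine : ∀ {y} → y ∈ˢ T → Spine T v L y
            spine y∈ with T⁻ y∈
            ... | inj₂ y∈T₂ = spine-beside y∈T₂
            ... | inj₁ y∈Tᵤ with Tᵤ⁻ y∈Tᵤ
            ...   | inj₁ refl = spine-u
            ...   | inj₂ y∈T₁ = spine-below y∈T₁

      -- After the part below a child `u` has been searched, a back edge from it to `v` ends the
      -- search with a good vertex. Without one, all its branches lead strictly above `v`, and it is
      -- joined to the forest found among the remaining nodes. `m` bounds the number of unvisited
      -- nodes.
      explore : ∀ m {v L} U → count U < m → U ⊆ˢ P → Stack v L → (∀ {x} → x ∈ˢ U → x ∉ v ∷ L) →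
        (∀ {x w} → x ∈ˢ U → w ∈ˢ P → x ~ w → w ∈ˢ U ⊎ w ∈ v ∷ L) → Good ⊎ Forest U v L
      explore (suc m) {v} {L} U U<m U⊆P stack U∉ U-closed with search (λ x → ∈ˢ? x U ×-dec (v ~? x))
      ... | no none = inj₂ record
        { T = ∅ˢ ; T⊆U = ⊥-elim ∘ ∉∅ˢ ; closed = ⊥-elim ∘ ∉∅ˢ ; full = λ Uw v~w → ⊥-elim (none (_ , Uw , v~w))
        ; escape = ⊥-elim ∘ ∉∅ˢ ; spine = ⊥-elim ∘ ∉∅ˢ }
      ... | yes (u , Uu , v~u) = descend (explore m (U ─ u) (shrink u (remove⊆ (_≟ u)) Uu (remove-∉ (_≟ u) refl)) U₁⊆P
              (proj₁ stack , ~-sym v~u ∷ proj₁ (proj₂ stack) , unique-∷ (U∉ Uu) (proj₂ (proj₂ stack))) U₁∉ U₁-closed)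
        where
        shrink : ∀ {Q} x → Q ⊆ˢ U → x ∈ˢ U → x ∉ˢ Q → count Q < m
        shrink x Q⊆U Ux x∉Q = ≤-trans (count-strict x Q⊆U Ux x∉Q) (s≤s⁻¹ U<m)
        U₁⊆P : U ─ u ⊆ˢ P
        U₁⊆P = U⊆P ∘ remove⊆ (_≟ u)
        U₁∉ : ∀ {x} → x ∈ˢ U ─ u → x ∉ u ∷ v ∷ L
        U₁∉ x∈ (here refl) = remove-∉ (_≟ u) refl x∈
        U₁∉ x∈ (there p)   = U∉ (remove⊆ (_≟ u) x∈) p
        U₁-closed : ∀ {x w} → x ∈ˢ U ─ u → w ∈ˢ P → x ~ w → w ∈ˢ U ─ u ⊎ w ∈ u ∷ v ∷ L
        U₁-closed {x} {w} x∈ Pw x~w with U-closed (remove⊆ (_≟ u) x∈) Pw x~w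
        ... | inj₂ p = inj₂ (there p)
        ... | inj₁ p with w ≟ u
        ...   | yes w≡u = inj₂ (here w≡u)
        ...   | no w≢u  = inj₁ (remove⁺ (_≟ u) p w≢u)
        descend : Good ⊎ Forest (U ─ u) u (v ∷ L) → Good ⊎ Forest U v L
        descend (inj₁ g) = inj₁ g
        descend (inj₂ F₁) with search (λ y → ∈ˢ? y (Forest.T F₁) ×-dec (y ~? v))
        ... | yes (y , Ty , y~v) = inj₁ (CloseCycle.good stack v~u (U⊆P Uu) (U∉ Uu) U₁⊆P U₁∉ F₁ Ty y~v)
        ... | no clean = Sum.map (λ g → g) J.join
              (explore m J.U₂ (shrink u J.U₂⊆U Uu (remove-∉ (λ x → ∈ˢ? x J.Tᵤ) J.u∈Tᵤ)) (U⊆P ∘ J.U₂⊆U) stack (U∉ ∘ J.U₂⊆U) J.U₂-closed)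
          where module J = Join U⊆P U∉ U-closed Uu v~u F₁ (λ Ty y~v → clean (_ , Ty , y~v))

      -- At the root the stack above `v` is empty and an escape has no target. But `v` has a
      -- neighbour, which would need an escape, so the search cannot have ended with a forest.
      good-vertex : ∀ {v} → v ∈ˢ P → Good
      good-vertex {v} Pv with explore (suc (count (P ─ v))) {v} {[]} (P ─ v) ≤-refl (remove⊆ (_≟ v)) (v , [] , [] ∷ [])
        (λ { x∈ (here refl) → remove-∉ (_≟ v) refl x∈ }) start-closed
        where
        start-closed : ∀ {x w} → x ∈ˢ P ─ v → w ∈ˢ P → x ~ w → w ∈ˢ P ─ v ⊎ w ∈ v ∷ []
        start-closed {x} {w} _ Pw _ with w ≟ v
        ... | yes w≡v = inj₂ (here w≡v)
        ... | no w≢v  = inj₁ (remove⁺ (_≟ v) Pw w≢v)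
      ... | inj₁ g = g
      ... | inj₂ F with another v Pv
      ...   | w , Pw , v~w , w≢v with Escape.target∈ (Forest.escape F (Forest.full F (remove⁺ (_≟ v) Pw w≢v) v~w) v~w)
      ...     | ()

-- Induced matchings and the classification of subgraphs.

module Matchings where

  open import Data.Bool.Properties using (xor-same)
  open import Data.Nat using (suc; _+_; _≤_; _<_; _≤?_; z≤n; s≤s; s≤s⁻¹)
  open import Data.Nat.Properties using (≤-refl; ≤-trans; +-comm; +-assoc; +-suc; +-mono-≤; ≰⇒>)
  open import Data.Nat.Divisibility using (_∣_; ∣m+n∣m⇒∣n; ∣1⇒≡1; ∣m∣n⇒∣m+n; ∣-refl; ∣⇒≤)
  open import Data.List using (List; []; _∷_; _++_; length; filter)
  open import Data.List.Membership.Propositional using (_∈_; _∉_; find)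
  open import Data.List.Membership.Propositional.Properties using (∈-filter⁻)
  open import Data.List.Relation.Unary.Any using (Any; here; there; any?)
  open import Data.List.Relation.Unary.All using (All; []; _∷_)
  import Data.List.Relation.Unary.All as All
  import Data.List.Relation.Unary.Any as Any
  open import Data.List.Relation.Unary.AllPairs using (AllPairs; []; _∷_)
  import Data.List.Relation.Unary.AllPairs.Properties as AllPairsₚ
  open import Data.List.Relation.Unary.Unique.Propositional using (Unique)
  import Data.Sum as Sum
  open Walks
  open StructureLemma

  length-filter-complement : ∀ {A : Set} {D : A → Set} (D? : ∀ y → Dec (D y)) xs →
    length xs ≡ length (filter D? xs) + length (filter (¬? ∘ D?) xs)
  length-filter-complement D? [] = refl
  length-filter-complement D? (x ∷ xs) with D? x
  ... | yes _ = cong suc (length-filter-complement D? xs)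
  ... | no _  = trans (cong suc (length-filter-complement D? xs)) (sym (+-suc _ _))

  module Classification (A : Set) (_≟_ : (x y : A) → Dec (x ≡ y)) (enum : List A) (complete : ∀ x → x ∈ enum)
    (_~_ : A → A → Set) (_~?_ : ∀ x y → Dec (x ~ y))
    (~-sym : ∀ {x y} → x ~ y → y ~ x) (~-irrefl : ∀ {x} → ¬ (x ~ x))
    (cycle-length : ∀ {x xs y} → Walk _~_ x xs y → Unique (x ∷ xs) → y ~ x → 2 ≤ length xs → 3 ∣ length xs)
    (Con : Sub A → Set) (Sph : Sub A → ℕ → Set)
    (isolated : ∀ {P x} → x ∈ˢ P → (∀ y → y ∈ˢ P → ¬ (x ~ y)) → Con P)
    (con-step : ∀ {P x} → x ∈ˢ P → Con (remove P (_≟ x)) → Con (remove P (λ y → (y ≟ x) ⊎-dec (y ~? x))) → Con P)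
    (sph-delete : ∀ {P x t} → x ∈ˢ P → Sph (remove P (_≟ x)) t → Con (remove P (λ y → (y ≟ x) ⊎-dec (y ~? x))) → Sph P t)
    (sph-link : ∀ {P x t} → x ∈ˢ P → Con (remove P (_≟ x)) → Sph (remove P (λ y → (y ≟ x) ⊎-dec (y ~? x))) t → Sph P (suc t))
    (sph-empty : ∀ {P} → (∀ x → x ∉ˢ P) → Sph P 0)
    (sph-unique : ∀ {P s t} → Sph P s → Sph P t → s ≡ t)
    (con-sph : ∀ {P t} → Con P → ¬ Sph P t)
    where

    open Reduction A _≟_ enum complete _~_ _~?_ ~-sym ~-irrefl cycle-length Con isolated con-step

    infix 4 _∈ᵉ_
    _∈ᵉ_ : A → A × A → Set
    z ∈ᵉ (a , b) = z ≡ a ⊎ z ≡ b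

    -- For matching edges disjointness follows: a shared node would be adjacent to its partner in
    -- the other edge.
    Separate : A × A → A × A → Set
    Separate e e′ = ∀ {a b} → a ∈ᵉ e → b ∈ᵉ e′ → ¬ (a ~ b)

    separate-sym : ∀ {e e′} → Separate e e′ → Separate e′ e
    separate-sym s a∈ b∈ a~b = s b∈ a∈ (~-sym a~b)

    record InducedMatching (P : Sub A) (M : List (A × A)) : Set where
      field
        edges    : ∀ {a b} → (a , b) ∈ M → a ∈ˢ P × b ∈ˢ P × a ~ b
        separate : AllPairs Separate M

    equal-or-separate : ∀ {e e′ M} → AllPairs Separate M → e ∈ M → e′ ∈ M → e ≡ e′ ⊎ Separate e e′
    equal-or-separate _        (here refl) (here refl) = inj₁ refl
    equal-or-separate (s ∷ _)  (here refl) (there q)   = inj₂ (All.lookup s q)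
    equal-or-separate {e} {e′} (s ∷ _) (there p) (here refl) = inj₂ (separate-sym {e′} {e} (All.lookup s p))
    equal-or-separate (_ ∷ ss) (there p)   (there q)   = equal-or-separate ss p q

    Touches : A → A × A → Set
    Touches x (a , b) = Nbhd x a ⊎ Nbhd x b

    touches? : ∀ x e → Dec (Touches x e)
    touches? x (a , b) = nbhd? x a ⊎-dec nbhd? x b

    touched untouched : A → List (A × A) → List (A × A)
    touched   x = filter (touches? x)
    untouched x = filter (¬? ∘ touches? x)

    length-touched : ∀ x M → length M ≡ length (touched x M) + length (untouched x M)
    length-touched x M = length-filter-complement (touches? x) M

    untouched-matching : ∀ {P M} x → InducedMatching P M → InducedMatching (P ─N x) (untouched x M)
    untouched-matching x I = record
      { edges = λ e∈ → let (e∈M , free) = ∈-filter⁻ (¬? ∘ touches? x) e∈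
                           (Pa , Pb , a~b) = edges e∈M
                       in remove⁺ (nbhd? x) Pa (free ∘ inj₁) , remove⁺ (nbhd? x) Pb (free ∘ inj₂) , a~b
      ; separate = AllPairsₚ.filter⁺ (¬? ∘ touches? x) separate }
      where open InducedMatching I

    two-touched : ∀ {P M} x → InducedMatching P M → 2 ≤ length (touched x M) →
      Σ (A × A) λ e₁ → Σ (A × A) λ e₂ → e₁ ∈ M × e₂ ∈ M × Separate e₁ e₂ × Touches x e₁ × Touches x e₂
    two-touched {M = M} x I len
      with touched x M | len | (λ {e} → ∈-filter⁻ (touches? x) {v = e} {xs = M}) | AllPairsₚ.filter⁺ (touches? x) (InducedMatching.separate I)
    ... | e₁ ∷ []     | s≤s () | _ | _
    ... | e₁ ∷ e₂ ∷ _ | _ | origin | (s ∷ _) ∷ _ =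
      e₁ , e₂ , proj₁ (origin (here refl)) , proj₁ (origin (there (here refl))) , s , proj₂ (origin (here refl)) , proj₂ (origin (there (here refl)))

    module Matching {P : Sub A} {M : List (A × A)} (I : InducedMatching P M) where

      open InducedMatching I

      Partner : A → A → Set
      Partner y y′ = (y , y′) ∈ M ⊎ (y′ , y) ∈ M

      Covered : A → Set
      Covered z = Any (z ∈ᵉ_) M

      covered? : ∀ z → Dec (Covered z)
      covered? z = any? (λ e → (z ≟ proj₁ e) ⊎-dec (z ≟ proj₂ e)) M

      partner-covered : ∀ {y y′} → Partner y y′ → Covered y
      partner-covered (inj₁ e∈) = Any.map (λ { refl → inj₁ refl }) e∈
      partner-covered (inj₂ e∈) = Any.map (λ { refl → inj₂ refl }) e∈

      endpoint-partner : ∀ {z e} → e ∈ M → z ∈ᵉ e → Σ A λ z′ → z′ ∈ᵉ e × Partner z z′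
      endpoint-partner {e = a , b} e∈ (inj₁ refl) = b , inj₂ refl , inj₁ e∈
      endpoint-partner {e = a , b} e∈ (inj₂ refl) = a , inj₁ refl , inj₂ e∈

      partner-sym : ∀ {y y′} → Partner y y′ → Partner y′ y
      partner-sym = Sum.swap

      partner-~ : ∀ {y y′} → Partner y y′ → y ~ y′
      partner-~ (inj₁ e∈) = proj₂ (proj₂ (edges e∈))
      partner-~ (inj₂ e∈) = ~-sym (proj₂ (proj₂ (edges e∈)))

      partner-∈ : ∀ {y y′} → Partner y y′ → y ∈ˢ P
      partner-∈ (inj₁ e∈) = proj₁ (edges e∈)
      partner-∈ (inj₂ e∈) = proj₁ (proj₂ (edges e∈))

      edge-of : ∀ {y y′} → Partner y y′ → Σ (A × A) λ e → e ∈ M × y ∈ᵉ e × (∀ {z} → z ∈ᵉ e → z ≡ y ⊎ z ≡ y′)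
      edge-of (inj₁ e∈) = _ , e∈ , inj₁ refl , λ p → p
      edge-of (inj₂ e∈) = _ , e∈ , inj₂ refl , Sum.swap

      adjacent-covered : ∀ {y y′ w w′} → Partner y y′ → Partner w w′ → y ~ w → w ≡ y′
      adjacent-covered p q y~w with edge-of p | edge-of q
      ... | e , e∈ , y∈e , ends | f , f∈ , w∈f , _ with equal-or-separate separate e∈ f∈
      ...   | inj₂ s    = ⊥-elim (s y∈e w∈f y~w)
      ...   | inj₁ refl with ends w∈f
      ...     | inj₁ refl = ⊥-elim (~-irrefl y~w)
      ...     | inj₂ w≡y′ = w≡y′

      partner-unique : ∀ {y a b} → Partner y a → Partner y b → b ≡ a
      partner-unique p q = adjacent-covered p (partner-sym q) (partner-~ q)

      -- By inducedness an edge touched by `y` contains both `y` and its partner, and two separate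
      -- edges cannot both contain these adjacent nodes.
      touched-partner : ∀ {y y′} → Partner y y′ → length (touched y M) ≤ 1
      touched-partner {y} {y′} p with 2 ≤? length (touched y M)
      ... | no ¬2 = s≤s⁻¹ (≰⇒> ¬2)
      ... | yes 2≤ with two-touched y I 2≤
      ...   | e₁ , e₂ , e₁∈ , e₂∈ , s , t₁ , t₂ = ⊥-elim (s (proj₁ (both e₁∈ t₁)) (proj₂ (both e₂∈ t₂)) (partner-~ p))
        where
        both-of : ∀ {e z} → e ∈ M → z ∈ᵉ e → Nbhd y z → y ∈ᵉ e × y′ ∈ᵉ e
        both-of e∈ z∈ near with endpoint-partner e∈ z∈
        both-of e∈ z∈ (inj₁ refl) | z′ , z′∈ , q with partner-unique p q
        ... | refl = z∈ , z′∈
        both-of e∈ z∈ (inj₂ z~y) | z′ , z′∈ , q with adjacent-covered p q (~-sym z~y)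
        ... | refl with partner-unique (partner-sym p) q
        ...   | refl = z′∈ , z∈
        both : ∀ {e} → e ∈ M → Touches y e → y ∈ᵉ e × y′ ∈ᵉ e
        both e∈ (inj₁ near) = both-of e∈ (inj₁ refl) near
        both e∈ (inj₂ near) = both-of e∈ (inj₂ refl) near

      -- Walks alternating between matching edges and uncovered nodes.

      module Zig (crowded : ∀ {x} → x ∈ˢ P → ¬ Covered x → 2 ≤ length (touched x M))
        (exit : ∀ {y y′} → Partner y y′ → Σ A λ w → w ∈ˢ P × y ~ w × w ≢ y′) where

        -- Walks y, y′, x, u, u′, … through matching edges yy′, uu′, … and uncovered vertices x, …, listed backwards.
        data Zigzag : A → List A → Set where
          start  : ∀ {y y′} → Partner y y′ → Zigzag y′ (y ∷ [])
          extend : ∀ {y′ x u u′ L} → Zigzag y′ L → y′ ~ x → ¬ Covered x → x ~ u → Partner u u′ → Zigzag u′ (u ∷ x ∷ y′ ∷ L)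

        head-partner : ∀ {y′ L} → Zigzag y′ L → Σ A (Partner y′)
        head-partner (start p)          = _ , partner-sym p
        head-partner (extend _ _ _ _ p) = _ , partner-sym p

        -- `length pre` is the distance of `z` from the head. Going back from the head, the nodes
        -- repeat the pattern covered, covered, uncovered, so uncovered nodes have distance 2 modulo
        -- 3 and covered ones 0 or 1.
        record Position (y : A) (L : List A) (z : A) : Set where
          field
            pre suf : List A
            split   : L ≡ pre ++ suf
            walk    : W y pre z
            residue : (¬ Covered z × 3 ∣ 1 + length pre) ⊎ (Covered z × (3 ∣ length pre ⊎ 3 ∣ 2 + length pre))

        position : ∀ {y′ L z} → Zigzag y′ L → z ∈ L → Position y′ L z
        position (start p) (here refl) = record
          { pre = _ ∷ [] ; suf = [] ; split = refl ; walk = ~-sym (partner-~ p) ∷ []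
          ; residue = inj₂ (partner-covered p , inj₂ ∣-refl) }
        position (extend Z y~x x∉ x~u p) (here refl) = record
          { pre = _ ∷ [] ; suf = _ ; split = refl ; walk = ~-sym (partner-~ p) ∷ []
          ; residue = inj₂ (partner-covered p , inj₂ ∣-refl) }
        position (extend Z y~x x∉ x~u p) (there (here refl)) = record
          { pre = _ ∷ _ ∷ [] ; suf = _ ; split = refl ; walk = ~-sym (partner-~ p) ∷ ~-sym x~u ∷ []
          ; residue = inj₁ (x∉ , ∣-refl) }
        position (extend Z y~x x∉ x~u p) (there (there (here refl))) = record
          { pre = _ ∷ _ ∷ _ ∷ [] ; suf = _ ; split = refl ; walk = ~-sym (partner-~ p) ∷ ~-sym x~u ∷ ~-sym y~x ∷ []
          ; residue = inj₂ (partner-covered (proj₂ (head-partner Z)) , inj₁ ∣-refl) }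
        position (extend Z y~x x∉ x~u p) (there (there (there z∈))) = record
          { pre = _ ∷ _ ∷ _ ∷ pre ; suf = suf ; split = cong (λ l → _ ∷ _ ∷ _ ∷ l) split
          ; walk = ~-sym (partner-~ p) ∷ ~-sym x~u ∷ ~-sym y~x ∷ walk
          ; residue = Sum.map (λ (c , d) → c , +3 1 d) (λ (c , d) → c , Sum.map (+3 0) (+3 2) d) residue }
          where
          open Position (position Z z∈)
          +3 : ∀ k {l} → 3 ∣ k + l → 3 ∣ k + (3 + l)
          +3 k {l} d = subst (3 ∣_) (trans (sym (+-assoc 3 k l)) (trans (cong (_+ l) (+-comm 3 k)) (+-assoc k 3 l))) (∣m∣n⇒∣m+n {m = 3} ∣-refl d)

        partner-closed : ∀ {y′ L z w} → Zigzag y′ L → z ∈ y′ ∷ L → Partner z w → w ∈ y′ ∷ L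
        partner-closed (start p) (here refl) q with partner-unique (partner-sym p) q
        ... | refl = there (here refl)
        partner-closed (start p) (there (here refl)) q with partner-unique p q
        ... | refl = here refl
        partner-closed (extend Z _ x∉ _ p) (here refl) q with partner-unique (partner-sym p) q
        ... | refl = there (here refl)
        partner-closed (extend Z _ x∉ _ p) (there (here refl)) q with partner-unique p q
        ... | refl = here refl
        partner-closed (extend Z _ x∉ _ p) (there (there (here refl))) q = ⊥-elim (x∉ (partner-covered q))
        partner-closed (extend Z _ x∉ _ p) (there (there (there z∈))) q = there (there (there (partner-closed Z z∈ q)))

        _∈?_ : ∀ z (L : List A) → Dec (z ∈ L)
        z ∈? L = any? (z ≟_) L

        -- The head has an uncovered neighbour `x`, and `x` touches another matching edge at some
        -- `u`, so the zigzag goes on unless `x` or `u` occurred before. If `x` did, at distance 2,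
        -- the cycle has length 0 modulo 3; if `u` did, at distance 0 or 1, the cycle through `x`
        -- has length 2 or 0. Since `P` is finite, the zigzag cannot go on forever.
        no-zigzag : ∀ m {y′ L} → Zigzag y′ L → Unique (y′ ∷ L) → count (remove P (λ z → z ∈? (y′ ∷ L))) < m → ⊥
        no-zigzag (suc m) {y′} {L} Z uniq len with exit (proj₂ (head-partner Z))
        ... | x , Px , y′~x , x≢partner with covered? x
        ...   | yes c = x≢partner (adjacent-covered (proj₂ (head-partner Z)) (proj₂ (any-partner c)) y′~x)
          where
          any-partner : ∀ {z} → Covered z → Σ A (Partner z)
          any-partner c with find c
          ... | e , e∈ , z∈ = let (z′ , _ , p) = endpoint-partner e∈ z∈ in z′ , p
        ...   | no x∉ with x ∈? L
        ...     | yes x∈L with position Z x∈L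
        ...       | pos with Position.residue pos
        ...         | inj₂ (c , _) = x∉ c
        ...         | inj₁ (_ , d) = case ∣1⇒≡1 (∣m+n∣m⇒∣n (subst (3 ∣_) (+-comm 1 _) d)
                      (cycle-length walk (unique-++ˡ (y′ ∷ pre) (subst (λ l → Unique (y′ ∷ l)) split uniq)) (~-sym y′~x) (s≤s⁻¹ (∣⇒≤ d)))) of λ ()
          where open Position pos
        no-zigzag (suc m) {y′} {L} Z uniq len | x , Px , y′~x , x≢partner | no x∉ | no x∉L
          with two-touched x I (crowded Px x∉)
        ... | e₁ , e₂ , e₁∈ , e₂∈ , s , t₁ , t₂ = continue choose
          where
          Next : Set
          Next = Σ A λ u → Σ A λ u′ → Partner u u′ × x ~ u × u ≢ y′
          end-of : ∀ {e} → e ∈ M → Touches x e → Σ A λ u → u ∈ᵉ e × x ~ u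
          end-of {a , b} e∈ (inj₁ (inj₁ refl)) = ⊥-elim (x∉ (partner-covered (inj₁ e∈)))
          end-of {a , b} e∈ (inj₁ (inj₂ a~x))  = a , inj₁ refl , ~-sym a~x
          end-of {a , b} e∈ (inj₂ (inj₁ refl)) = ⊥-elim (x∉ (partner-covered (inj₂ e∈)))
          end-of {a , b} e∈ (inj₂ (inj₂ b~x))  = b , inj₂ refl , ~-sym b~x
          -- At most one of the two separate edges contains `y′`, so the other one leads onward.
          choose : Next
          choose with end-of e₁∈ t₁ | end-of e₂∈ t₂
          ... | u₁ , u₁∈ , x~u₁ | u₂ , u₂∈ , x~u₂ with u₁ ≟ y′ | endpoint-partner e₁∈ u₁∈ | endpoint-partner e₂∈ u₂∈
          ...   | no ≢y′   | u₁′ , _ , p | _ = u₁ , u₁′ , p , x~u₁ , ≢y′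
          ...   | yes refl | _ | u₂′ , u₂′∈ , p = u₂ , u₂′ , p , x~u₂ , λ { refl → s u₁∈ u₂′∈ (partner-~ p) }
          x∉y′L : x ∉ y′ ∷ L
          x∉y′L (here refl) = x∉ (partner-covered (proj₂ (head-partner Z)))
          x∉y′L (there p)   = x∉L p
          continue : Next → ⊥
          continue (u , u′ , p , x~u , u≢y′) with u ∈? L
          ... | yes u∈L with position Z u∈L
          ...   | pos with Position.residue pos
          ...     | inj₁ (u∉ , _) = u∉ (partner-covered p)
          ...     | inj₂ (_ , d) = [ (λ 3∣l → absurd (subst (3 ∣_) (+-comm 1 _) 3∣1+l) 3∣l) , (λ 3∣2+l → absurd (subst (3 ∣_) (+-comm 1 (suc (length pre))) 3∣2+l) 3∣1+l) ]′ d
            where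
            open Position pos
            absurd : ∀ {k} → 3 ∣ k + 1 → 3 ∣ k → ⊥
            absurd a b = case ∣1⇒≡1 (∣m+n∣m⇒∣n a b) of λ ()
            pre-nonempty : ∀ {l} → W y′ l u → 1 ≤ length l
            pre-nonempty []      = ⊥-elim (u≢y′ refl)
            pre-nonempty (_ ∷ _) = s≤s z≤n
            3∣1+l : 3 ∣ 1 + length pre
            3∣1+l = cycle-length (~-sym y′~x ∷ walk)
              (unique-++ˡ (x ∷ y′ ∷ pre) (unique-∷ (subst (λ l → x ∉ y′ ∷ l) split x∉y′L) (subst (λ l → Unique (y′ ∷ l)) split uniq)))
              (~-sym x~u) (s≤s (pre-nonempty walk))
          continue (u , u′ , p , x~u , u≢y′) | no u∉L =
            no-zigzag m (extend Z y′~x x∉ x~u p)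
              (unique-∷ u′∉ (unique-∷ u∉ (unique-∷ x∉y′L uniq)))
              (≤-trans (count-strict u shrink (remove⁺ (λ z → z ∈? (y′ ∷ L)) (partner-∈ p) (u∉ ∘ there)) (remove-∉ (λ z → z ∈? (u′ ∷ u ∷ x ∷ y′ ∷ L)) (there (here refl)))) (s≤s⁻¹ len))
            where
            u∉ : u ∉ x ∷ y′ ∷ L
            u∉ (here refl)         = ~-irrefl x~u
            u∉ (there (here refl)) = u≢y′ refl
            u∉ (there (there q))   = u∉L q
            u′∉ : u′ ∉ u ∷ x ∷ y′ ∷ L
            u′∉ (here refl)         = ~-irrefl (partner-~ p)
            u′∉ (there (here refl)) = x∉ (partner-covered (partner-sym p))
            u′∉ (there (there q))   = u∉ (there (partner-closed Z q (partner-sym p)))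
            shrink : remove P (λ z → z ∈? (u′ ∷ u ∷ x ∷ y′ ∷ L)) ⊆ˢ remove P (λ z → z ∈? (y′ ∷ L))
            shrink z∈ = let (Pz , z∉) = remove⁻ (λ z → z ∈? (u′ ∷ u ∷ x ∷ y′ ∷ L)) z∈
                        in remove⁺ (λ z → z ∈? (y′ ∷ L)) Pz (z∉ ∘ there ∘ there ∘ there)

        no-edges : ∀ {e} → e ∉ M
        no-edges e∈ = no-zigzag _ (start (inj₁ e∈))
          (unique-∷ (λ { (here refl) → ~-irrefl (partner-~ (inj₁ e∈)) }) ([] ∷ [])) ≤-refl

    -- Acyclic or spherical: the induction over subgraphs.

    Result : Sub A → Set
    Result P = (Con P × parity P ≡ false)
      ⊎ Σ ℕ λ t → Sph P t × parity P ≡ true × (Σ (List (A × A)) λ M → InducedMatching P M × length M ≡ t)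
                  × (∀ {M} → InducedMatching P M → length M ≤ t)

    -- `Result` without the maximality of `t`. The upper bound starts from the knowledge that `P` is
    -- a sphere of codimension `t`, so it is added only after this part.
    Type : Sub A → Set
    Type P = (Con P × parity P ≡ false)
      ⊎ Σ ℕ λ t → Sph P t × parity P ≡ true × (Σ (List (A × A)) λ M → InducedMatching P M × length M ≡ t)

    -- The closed neighbourhood of an isolated node is the node itself, so the two pieces coincide
    -- and their counts cancel modulo 2.
    parity-isolated : ∀ {P x} → x ∈ˢ P → (∀ y → y ∈ˢ P → ¬ (x ~ y)) → parity P ≡ false
    parity-isolated {P} {x} Px alone = trans (parity-split Px)
      (trans (cong (parity (P ─ x) xor_) (parityOn-cong enum (ext
        (λ p → let (Py , far) = remove⁻ (nbhd? x) p in remove⁺ (_≟ x) Py (far ∘ inj₁))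
        (λ p → let (Py , y≢x) = remove⁻ (_≟ x) p in remove⁺ (nbhd? x) Py [ y≢x , alone _ Py ∘ ~-sym ]′))))
      (xor-same (parity (P ─ x))))

    module Induct {P : Sub A} (smaller : ∀ {x} → x ∈ˢ P → Result (P ─ x) × Result (P ─N x)) where

      -- Parity makes exactly one of P ─ x and P ─N x acyclic, and the other one determines the type of P.
      bound-at : ∀ {t M x} → Sph P t → parity P ≡ true → InducedMatching P M → x ∈ˢ P → length (touched x M) ≤ 1 →
        InducedMatching (P ─ x) M ⊎ parity (P ─ x) ≡ false → length M ≤ t
      bound-at {t} {M} {x} sph odd I Px few away with smaller Px
      ... | inj₁ (_ , p) , inj₁ (_ , q) = case trans (sym odd) (trans (parity-split Px) (cong₂ _xor_ p q)) of λ ()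
      ... | inj₂ (_ , _ , p , _) , inj₂ (_ , _ , q , _) = case trans (sym odd) (trans (parity-split Px) (cong₂ _xor_ p q)) of λ ()
      ... | inj₂ (t₁ , S₁ , p , _ , max) , inj₁ (C , _) =
        [ (λ I′ → subst (length M ≤_) (sph-unique (sph-delete Px S₁ C) sph) (max I′)) , (λ even → case trans (sym p) even of λ ()) ]′ away
      ... | inj₁ (C , _) , inj₂ (t₂ , S₂ , _ , _ , max) =
        subst₂ _≤_ (sym (length-touched x M)) (sph-unique (sph-link Px C S₂) sph) (+-mono-≤ few (max (untouched-matching x I)))

      -- `bound-at` settles the case of an uncovered node touching at most one edge of `M` and the
      -- case of a matched node whose only neighbour is its partner. If neither occurs, `Zig` shows
      -- that `M` is empty.
      bound : ∀ {t M} → Sph P t → parity P ≡ true → InducedMatching P M → length M ≤ t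
      bound {t} {M} sph odd I with search (λ x → (∈ˢ? x P ×-dec ¬? (Matching.covered? I x)) ×-dec (length (touched x M) ≤? 1))
      ... | yes (x , (Px , x∉) , few) = bound-at sph odd I Px few (inj₁ record
        { edges = λ e∈ → let (Pa , Pb , a~b) = InducedMatching.edges I e∈ in
            remove⁺ (_≟ x) Pa (λ { refl → x∉ (partner-covered (inj₁ e∈)) }) , remove⁺ (_≟ x) Pb (λ { refl → x∉ (partner-covered (inj₂ e∈)) }) , a~b
        ; separate = InducedMatching.separate I })
        where open Matching I
      ... | no crowded = by-ends (any? (λ e → ¬? (exit? (proj₁ e) (proj₂ e)) ⊎-dec ¬? (exit? (proj₂ e) (proj₁ e))) M)
        where
        open Matching I
        Exit : A → A → Set
        Exit y y′ = Σ A λ w → w ∈ˢ P × y ~ w × w ≢ y′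
        exit? : ∀ y y′ → Dec (Exit y y′)
        exit? y y′ = search (λ w → ∈ˢ? w P ×-dec ((y ~? w) ×-dec ¬? (w ≟ y′)))
        at-leaf : ∀ {y y′} → Partner y y′ → ¬ Exit y y′ → length M ≤ t
        -- The cut is made at the partner `y′`: without it the leaf `y` is isolated, so `P ─ y′` has
        -- even parity and is not the spherical piece.
        at-leaf {y} {y′} p leaf = bound-at sph odd I (partner-∈ (partner-sym p)) (touched-partner (partner-sym p))
          (inj₂ (parity-isolated (remove⁺ (_≟ y′) (partner-∈ p) (λ { refl → ~-irrefl (partner-~ p) }))
            (λ w w∈ y~w → leaf (w , remove⊆ (_≟ y′) w∈ , y~w , λ { refl → remove-∉ (_≟ y′) refl w∈ }))))
        by-ends : Dec (Any (λ e → ¬ Exit (proj₁ e) (proj₂ e) ⊎ ¬ Exit (proj₂ e) (proj₁ e)) M) → length M ≤ t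
        by-ends (yes found) with find found
        ... | _ , e∈ , inj₁ leaf = at-leaf (inj₁ e∈) leaf
        ... | _ , e∈ , inj₂ leaf = at-leaf (inj₂ e∈) leaf
        by-ends (no none) = empty M no-edge
          where
          exits : ∀ {y y′} → Partner y y′ → Exit y y′
          exits {y} {y′} p = decidable-stable (exit? y y′) λ leaf →
            [ (λ e∈ → none (Any.map (λ { refl → inj₁ leaf }) e∈)) , (λ e∈ → none (Any.map (λ { refl → inj₂ leaf }) e∈)) ]′ p
          no-edge : ∀ {e} → e ∉ M
          no-edge = Zig.no-edges (λ {x} Px x∉ → ≰⇒> λ few → crowded (x , (Px , x∉) , few)) exits
          empty : ∀ M → (∀ {e} → e ∉ M) → length M ≤ t
          empty []      _ = z≤n
          empty (_ ∷ _) f = ⊥-elim (f (here refl))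

      extend-matching : ∀ {x y M} → x ∈ˢ P → y ∈ˢ P → x ~ y → (∀ {w} → w ∈ˢ P → x ~ w → w ≡ y) →
        InducedMatching (P ─N y) M → InducedMatching P ((x , y) ∷ M)
      extend-matching {x} {y} Px Py x~y leaf I = record
        { edges = λ { (here refl) → Px , Py , x~y
                    ; (there e∈) → let (Pa , Pb , a~b) = edges e∈ in remove⊆ (nbhd? y) Pa , remove⊆ (nbhd? y) Pb , a~b }
        ; separate = All.tabulate (λ e∈ {_} {_} → apart e∈) ∷ separate }
        where
        open InducedMatching I
        far : ∀ {e z} → e ∈ _ → z ∈ᵉ e → z ∈ˢ P ─N y
        far e∈ (inj₁ refl) = proj₁ (edges e∈)
        far e∈ (inj₂ refl) = proj₁ (proj₂ (edges e∈))
        apart : ∀ {e} → e ∈ _ → Separate (x , y) e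
        apart e∈ (inj₁ refl) z∈ x~z with leaf (remove⊆ (nbhd? y) (far e∈ z∈)) x~z
        ... | refl = remove-∉ (nbhd? y) (inj₁ refl) (far e∈ z∈)
        apart e∈ (inj₂ refl) z∈ y~z = remove-∉ (nbhd? y) (inj₂ (~-sym y~z)) (far e∈ z∈)

      -- Deleting `y` isolates the leaf `x`, so that piece is acyclic and `P ─N y` decides. The
      -- codimension grows by one, and so does the matching, by the edge from `x` to `y`.
      type-leaf : ∀ {x y} → x ∈ˢ P → y ∈ˢ P → x ~ y → (∀ {w} → w ∈ˢ P → x ~ w → w ≡ y) → Type P
      type-leaf {x} {y} Px Py x~y leaf = extend (proj₂ (smaller Py))
        where
        Px′ : x ∈ˢ P ─ y
        Px′ = remove⁺ (_≟ y) Px (λ { refl → ~-irrefl x~y })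
        alone : ∀ w → w ∈ˢ P ─ y → ¬ (x ~ w)
        alone w w∈ x~w = remove-∉ (_≟ y) (leaf (remove⊆ (_≟ y) w∈) x~w) w∈
        parity-P : ∀ {b} → parity (P ─N y) ≡ b → parity P ≡ b
        parity-P eq = trans (parity-split Py) (cong₂ _xor_ (parity-isolated Px′ alone) eq)
        extend : Result (P ─N y) → Type P
        extend (inj₁ (C , even)) = inj₁ (con-step Py (isolated Px′ alone) C , parity-P even)
        extend (inj₂ (t , S , odd , (M , I , len) , _)) = inj₂ (suc t , sph-link Py (isolated Px′ alone) S , parity-P odd ,
          ((x , y) ∷ M , extend-matching Px Py x~y leaf I , cong suc len))

      type-good : ∀ {x} → x ∈ˢ P → Con (P ─N x) → Type P
      type-good {x} Px C with smaller Px
      ... | _ , inj₂ (_ , S , _) = ⊥-elim (con-sph C S)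
      ... | inj₁ (C₁ , even) , inj₁ (_ , even′) = inj₁ (con-step Px C₁ C , trans (parity-split Px) (cong₂ _xor_ even even′))
      ... | inj₂ (t , S , odd , (M , I , len) , _) , inj₁ (_ , even′) =
        inj₂ (t , sph-delete Px S C , trans (parity-split Px) (cong₂ _xor_ odd even′) , (M , I′ , len))
        where
        open InducedMatching I
        I′ : InducedMatching P M
        I′ = record { edges = λ e∈ → let (Pa , Pb , a~b) = edges e∈ in remove⊆ (_≟ x) Pa , remove⊆ (_≟ x) Pb , a~b ; separate = separate }

      type : Type P
      type with search (λ x → ∈ˢ? x P)
      ... | no none = inj₂ (0 , sph-empty (λ x p → none (x , p)) , parity-empty enum , ([] , record { edges = λ () ; separate = [] } , refl))
        where
        parity-empty : ∀ l → parityOn l P ≡ true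
        parity-empty [] = refl
        parity-empty (a ∷ l) rewrite ∉ˢ⇒false {x = a} {P = P} (λ p → none (a , p)) = parity-empty l
      -- Degree at most one is expressed as: all neighbours of `x` equal some `p`. For an isolated
      -- `x` any `p` will do.
      ... | yes (v , Pv) with search (λ x → ∈ˢ? x P ×-dec search (λ p → ¬? (search (λ w → ∈ˢ? w P ×-dec ((x ~? w) ×-dec ¬? (w ≟ p))))))
      ...   | no none = let (x , Px , C) = MinDegreeTwo.good-vertex P another Pv in type-good Px C
        where
        another : ∀ {x} p → x ∈ˢ P → Σ A λ w → w ∈ˢ P × x ~ w × w ≢ p
        another {x} p Px = decidable-stable (search (λ w → ∈ˢ? w P ×-dec ((x ~? w) ×-dec ¬? (w ≟ p)))) λ f → none (x , Px , p , f)
      ...   | yes (x , Px , p , few) = by-neighbour (∈ˢ? p P ×-dec (x ~? p))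
        where
        only : ∀ {w} → w ∈ˢ P → x ~ w → w ≡ p
        only {w} Pw x~w = decidable-stable (w ≟ p) λ w≢p → few (w , Pw , x~w , w≢p)
        by-neighbour : Dec (p ∈ˢ P × x ~ p) → Type P
        by-neighbour (yes (Pp , x~p)) = type-leaf Px Pp x~p only
        by-neighbour (no far) = inj₁ (isolated Px alone , parity-isolated Px alone)
          where
          alone : ∀ w → w ∈ˢ P → ¬ (x ~ w)
          alone w Pw x~w with only Pw x~w
          ... | refl = far (Pw , x~w)

      result : Result P
      result with type
      ... | inj₁ c = inj₁ c
      ... | inj₂ (t , S , odd , M) = inj₂ (t , S , odd , M , bound S odd)

    classify-below : ∀ m P → count P < m → Result P
    classify-below (suc m) P P<m = Induct.result λ {x} Px →
        classify-below m (P ─ x) (≤-trans (count-strict x (remove⊆ (_≟ x)) Px (remove-∉ (_≟ x) refl)) (s≤s⁻¹ P<m))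
      , classify-below m (P ─N x) (≤-trans (count-strict x (remove⊆ (nbhd? x)) Px (remove-∉ (nbhd? x) (inj₁ refl))) (s≤s⁻¹ P<m))

    classify : ∀ P → Result P
    classify P = classify-below _ P ≤-refl

-- Signs, linearity of `∂`, and `∂∂ = 0`.

module ChainAlgebra where

  open import Data.Bool.Properties using (∨-identityʳ; ∨-zeroʳ)
  open import Data.Nat as ℕ using (zero; suc; _<ᵇ_)
  import Data.Nat.Properties as ℕₚ
  open import Data.Integer using (ℤ; +_; -_; _+_; _*_; _-_; +0; -[1+_])
  import Data.Integer.Properties as ℤₚ
  open import Data.Integer.Tactic.RingSolver using (solve-∀)
  open import Data.Fin as Fin using (Fin; toℕ)
  import Data.Fin.Properties as Finₚ
  open import Data.Fin.Subset using (Subset; _∪_; ⁅_⁆; ∣_∣)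
  import Data.Fin.Subset.Properties as Subsetₚ
  open import Data.Vec using (lookup; []; _∷_)
  import Data.Vec.Properties as Vecₚ

  sum-cong : ∀ {n} {f g : Fin n → ℤ} → (∀ i → f i ≡ g i) → sumFin f ≡ sumFin g
  sum-cong {zero}  e = refl
  sum-cong {suc n} e = cong₂ _+_ (e Fin.zero) (sum-cong (e ∘ Fin.suc))

  sum-zero : ∀ {n} {f : Fin n → ℤ} → (∀ i → f i ≡ +0) → sumFin f ≡ +0
  sum-zero {zero}  e = refl
  sum-zero {suc n} e = cong₂ _+_ (e Fin.zero) (sum-zero (e ∘ Fin.suc))

  private
    interchange : ∀ a b c d → (a + b) + (c + d) ≡ (a + c) + (b + d)
    interchange = solve-∀

  sum-+ : ∀ {n} (f g : Fin n → ℤ) → sumFin (λ i → f i + g i) ≡ sumFin f + sumFin g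
  sum-+ {zero}  f g = refl
  sum-+ {suc n} f g = trans (cong (_+_ (f Fin.zero + g Fin.zero)) (sum-+ (f ∘ Fin.suc) (g ∘ Fin.suc))) (interchange (f Fin.zero) _ _ _)

  sum-* : ∀ {n} a (f : Fin n → ℤ) → sumFin (λ i → a * f i) ≡ a * sumFin f
  sum-* {zero}  a f = sym (ℤₚ.*-zeroʳ a)
  sum-* {suc n} a f = trans (cong (_+_ (a * f Fin.zero)) (sum-* a (f ∘ Fin.suc))) (sym (ℤₚ.*-distribˡ-+ a _ _))

  sum-neg : ∀ {n} (f : Fin n → ℤ) → sumFin (λ i → - f i) ≡ - sumFin f
  sum-neg {zero}  f = refl
  sum-neg {suc n} f = trans (cong (_+_ (- f Fin.zero)) (sum-neg (f ∘ Fin.suc))) (sym (ℤₚ.neg-distrib-+ (f Fin.zero) _))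

  sum-swap : ∀ {m n} (f : Fin m → Fin n → ℤ) → sumFin (λ i → sumFin (f i)) ≡ sumFin (λ j → sumFin (λ i → f i j))
  sum-swap {zero}  f = sym (sum-zero {f = λ j → sumFin (λ i → f i j)} (λ _ → refl))
  sum-swap {suc m} f = trans (cong (_+_ (sumFin (f Fin.zero))) (sum-swap (f ∘ Fin.suc))) (sym (sum-+ (f Fin.zero) _))

  sum-single : ∀ {n} (f : Fin n → ℤ) v → (∀ i → i ≢ v → f i ≡ +0) → sumFin f ≡ f v
  sum-single f Fin.zero    e = trans (cong (_+_ (f Fin.zero)) (sum-zero (λ i → e (Fin.suc i) λ ()))) (ℤₚ.+-identityʳ _)
  sum-single f (Fin.suc v) e = trans (cong₂ _+_ (e Fin.zero λ ()) (sum-single (f ∘ Fin.suc) v λ i i≢v → e (Fin.suc i) (i≢v ∘ Finₚ.suc-injective))) (ℤₚ.+-identityˡ _)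

  sum-nonzero : ∀ {n} (f : Fin n → ℤ) → sumFin f ≢ +0 → Σ (Fin n) λ i → f i ≢ +0
  sum-nonzero {zero}  f s = ⊥-elim (s refl)
  sum-nonzero {suc n} f s with f Fin.zero ℤₚ.≟ +0
  ... | no f0 = Fin.zero , f0
  ... | yes f0 = let (i , fi) = sum-nonzero (f ∘ Fin.suc) (λ q → s (cong₂ _+_ f0 q)) in Fin.suc i , fi

  self-negative : ∀ {x : ℤ} → x ≡ - x → x ≡ +0
  self-negative {+ zero} _ = refl
  self-negative {+ suc _} ()
  self-negative { -[1+ _ ]} ()

  sgn-square : ∀ k → sgn k * sgn k ≡ + 1
  sgn-square zero    = refl
  sgn-square (suc k) = trans (neg-neg (sgn k)) (sgn-square k)
    where
    neg-neg : ∀ x → (- x) * (- x) ≡ x * x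
    neg-neg = solve-∀

  sgn-cancel : ∀ k {x} → sgn k * x ≡ +0 → x ≡ +0
  sgn-cancel k {x} e = begin
    x                     ≡⟨ sym (ℤₚ.*-identityˡ x) ⟩
    + 1 * x               ≡⟨ cong (_* x) (sym (sgn-square k)) ⟩
    sgn k * sgn k * x     ≡⟨ ℤₚ.*-assoc (sgn k) _ _ ⟩
    sgn k * (sgn k * x)   ≡⟨ cong (sgn k *_) e ⟩
    sgn k * +0            ≡⟨ ℤₚ.*-zeroʳ (sgn k) ⟩
    +0 ∎
    where open ≡-Reasoning

  countFin-cong : ∀ {k} {f g : Fin k → Bool} → (∀ i → f i ≡ g i) → countFin f ≡ countFin g
  countFin-cong {zero}  e = refl
  countFin-cong {suc k} e = cong₂ (λ b m → (if b then 1 else 0) ℕ.+ m) (e Fin.zero) (countFin-cong (e ∘ Fin.suc))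

  countFin-insert : ∀ {k} (f g : Fin k → Bool) v → (∀ i → i ≢ v → g i ≡ f i) → f v ≡ false →
    countFin g ≡ (if g v then 1 else 0) ℕ.+ countFin f
  countFin-insert f g Fin.zero e fv rewrite fv = cong ((if g Fin.zero then 1 else 0) ℕ.+_) (countFin-cong (λ i → e (Fin.suc i) λ ()))
  countFin-insert f g (Fin.suc v) e fv
    rewrite e Fin.zero (λ ())
          | countFin-insert (f ∘ Fin.suc) (g ∘ Fin.suc) v (λ i i≢v → e (Fin.suc i) (i≢v ∘ Finₚ.suc-injective)) fv =
    swap (if f Fin.zero then 1 else 0) (if g (Fin.suc v) then 1 else 0) _
    where
    swap : ∀ a b c → a ℕ.+ (b ℕ.+ c) ≡ b ℕ.+ (a ℕ.+ c)
    swap a b c = trans (sym (ℕₚ.+-assoc a b c)) (trans (cong (ℕ._+ c) (ℕₚ.+-comm a b)) (ℕₚ.+-assoc b a c))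

  module _ {n : ℕ} where

    infix 4 _∈ᵛ_ _∉ᵛ_
    _∈ᵛ_ _∉ᵛ_ : Fin n → Subset n → Set
    v ∈ᵛ σ = lookup σ v ≡ true
    v ∉ᵛ σ = lookup σ v ≡ false

    ∈ᵛ-or : ∀ v σ → v ∈ᵛ σ ⊎ v ∉ᵛ σ
    ∈ᵛ-or v σ with lookup σ v
    ... | true  = inj₁ refl
    ... | false = inj₂ refl

    ∈ᵛ-∉ᵛ : ∀ {v σ} → v ∈ᵛ σ → v ∉ᵛ σ → ⊥
    ∈ᵛ-∉ᵛ p q with trans (sym p) q
    ... | ()

    ∉ᵛ-intro : ∀ {v σ} → ¬ (v ∈ᵛ σ) → v ∉ᵛ σ
    ∉ᵛ-intro {v} {σ} f = [ ⊥-elim ∘ f , (λ q → q) ]′ (∈ᵛ-or v σ)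

  lookup-ext : ∀ {n} {σ τ : Subset n} → (∀ v → lookup σ v ≡ lookup τ v) → σ ≡ τ
  lookup-ext {σ = σ} {τ} e = trans (sym (Vecₚ.tabulate∘lookup σ)) (trans (Vecₚ.tabulate-cong e) (Vecₚ.tabulate∘lookup τ))

  lookup-⁅⁆ : ∀ {n} (v : Fin n) → lookup ⁅ v ⁆ v ≡ true
  lookup-⁅⁆ v = Vecₚ.[]=⇒lookup (Subsetₚ.x∈⁅x⁆ v)

  lookup-⁅⁆′ : ∀ {n} {u v : Fin n} → u ≢ v → lookup ⁅ v ⁆ u ≡ false
  lookup-⁅⁆′ {u = u} {v} u≢v = ∉ᵛ-intro {σ = ⁅ v ⁆} λ p → u≢v (Subsetₚ.x∈⁅y⁆⇒x≡y v (Vecₚ.lookup⇒[]= u ⁅ v ⁆ p))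

  lookup-∪ : ∀ {n} (σ τ : Subset n) v → lookup (σ ∪ τ) v ≡ lookup σ v ∨ lookup τ v
  lookup-∪ σ τ v = Vecₚ.lookup-zipWith _∨_ v σ τ

  module _ {n : ℕ} where

    insert-same : ∀ (τ : Subset n) v → v ∈ᵛ τ ∪ ⁅ v ⁆
    insert-same τ v = trans (lookup-∪ τ ⁅ v ⁆ v) (trans (cong (lookup τ v ∨_) (lookup-⁅⁆ v)) (∨-zeroʳ _))

    insert-other : ∀ (τ : Subset n) {u v} → u ≢ v → lookup (τ ∪ ⁅ v ⁆) u ≡ lookup τ u
    insert-other τ {u} {v} u≢v = trans (lookup-∪ τ ⁅ v ⁆ u) (trans (cong (lookup τ u ∨_) (lookup-⁅⁆′ u≢v)) (∨-identityʳ _))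

    insert-mono : ∀ (τ : Subset n) {u v} → u ∈ᵛ τ → u ∈ᵛ τ ∪ ⁅ v ⁆
    insert-mono τ {u} {v} p = trans (lookup-∪ τ ⁅ v ⁆ u) (cong (_∨ lookup ⁅ v ⁆ u) p)

    insert-elim : ∀ (τ : Subset n) {u v} → u ∈ᵛ τ ∪ ⁅ v ⁆ → u ≡ v ⊎ u ∈ᵛ τ
    insert-elim τ {u} {v} p with u Finₚ.≟ v
    ... | yes e = inj₁ e
    ... | no ne = inj₂ (trans (sym (insert-other τ ne)) p)

    insert-comm : ∀ (τ : Subset n) v w → (τ ∪ ⁅ v ⁆) ∪ ⁅ w ⁆ ≡ (τ ∪ ⁅ w ⁆) ∪ ⁅ v ⁆
    insert-comm τ v w = trans (Subsetₚ.∪-assoc τ ⁅ v ⁆ ⁅ w ⁆) (trans (cong (τ ∪_) (Subsetₚ.∪-comm ⁅ v ⁆ ⁅ w ⁆)) (sym (Subsetₚ.∪-assoc τ ⁅ w ⁆ ⁅ v ⁆)))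

  ∣∣-countFin : ∀ {n} (σ : Subset n) → ∣ σ ∣ ≡ countFin (lookup σ)
  ∣∣-countFin []          = refl
  ∣∣-countFin (true ∷ σ)  = cong suc (∣∣-countFin σ)
  ∣∣-countFin (false ∷ σ) = ∣∣-countFin σ

  ∣insert∣ : ∀ {n} (τ : Subset n) {v} → v ∉ᵛ τ → ∣ τ ∪ ⁅ v ⁆ ∣ ≡ suc ∣ τ ∣
  ∣insert∣ τ {v} v∉ = begin
    ∣ τ ∪ ⁅ v ⁆ ∣                    ≡⟨ ∣∣-countFin (τ ∪ ⁅ v ⁆) ⟩
    countFin (lookup (τ ∪ ⁅ v ⁆))    ≡⟨ countFin-insert (lookup τ) (lookup (τ ∪ ⁅ v ⁆)) v (λ i i≢v → insert-other τ i≢v) v∉ ⟩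
    (if lookup (τ ∪ ⁅ v ⁆) v then 1 else 0) ℕ.+ countFin (lookup τ)
                                     ≡⟨ cong₂ (λ b k → (if b then 1 else 0) ℕ.+ k) (insert-same τ v) (sym (∣∣-countFin τ)) ⟩
    suc ∣ τ ∣ ∎
    where open ≡-Reasoning

  module _ {n : ℕ} (τ : Subset n) {v : Fin n} (v∉ : v ∉ᵛ τ) where

    below-insert : ∀ w → below (τ ∪ ⁅ v ⁆) w ≡ (if toℕ v <ᵇ toℕ w then 1 else 0) ℕ.+ below τ w
    below-insert w = trans
      (countFin-insert (λ u → lookup τ u ∧ (toℕ u <ᵇ toℕ w)) _ v
        (λ u u≢v → cong (_∧ (toℕ u <ᵇ toℕ w)) (insert-other τ u≢v)) (cong (_∧ (toℕ v <ᵇ toℕ w)) v∉))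
      (cong (λ b → (if b ∧ (toℕ v <ᵇ toℕ w) then 1 else 0) ℕ.+ below τ w) (insert-same τ v))

  <ᵇ-irrefl : ∀ m → (m <ᵇ m) ≡ false
  <ᵇ-irrefl zero    = refl
  <ᵇ-irrefl (suc m) = <ᵇ-irrefl m

  <ᵇ-trichotomy : ∀ m k → m ≢ k → (m <ᵇ k) ≡ true × (k <ᵇ m) ≡ false ⊎ (m <ᵇ k) ≡ false × (k <ᵇ m) ≡ true
  <ᵇ-trichotomy zero    zero    ne = ⊥-elim (ne refl)
  <ᵇ-trichotomy zero    (suc k) ne = inj₁ (refl , refl)
  <ᵇ-trichotomy (suc m) zero    ne = inj₂ (refl , refl)
  <ᵇ-trichotomy (suc m) (suc k) ne = <ᵇ-trichotomy m k (ne ∘ cong suc)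

  -- Inserting the smaller of `v` and `w` raises the count below the larger by one, while inserting
  -- the larger changes nothing for the smaller. So exactly one of the two products picks up a sign.
  sgn-exchange : ∀ {n} (τ : Subset n) {v w} → v ≢ w → v ∉ᵛ τ → w ∉ᵛ τ →
    sgn (below τ v) * sgn (below (τ ∪ ⁅ v ⁆) w) ≡ - (sgn (below τ w) * sgn (below (τ ∪ ⁅ w ⁆) v))
  sgn-exchange τ {v} {w} v≢w v∉ w∉
    rewrite below-insert τ v∉ w | below-insert τ w∉ v with <ᵇ-trichotomy (toℕ v) (toℕ w) (v≢w ∘ Finₚ.toℕ-injective)
  ... | inj₁ (p , q) rewrite p | q = rearrange (sgn (below τ v)) (sgn (below τ w))
    where
    rearrange : ∀ a b → a * (- b) ≡ - (b * a)
    rearrange = solve-∀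
  ... | inj₂ (p , q) rewrite p | q = rearrange (sgn (below τ v)) (sgn (below τ w))
    where
    rearrange : ∀ a b → a * b ≡ - (b * (- a))
    rearrange = solve-∀

  module _ {n : ℕ} where

    ∂-term : Chain n → Subset n → Fin n → ℤ
    ∂-term c τ v = if lookup τ v then +0 else sgn (below τ v) * c (τ ∪ ⁅ v ⁆)

    ∂-term-∈ : ∀ (c : Chain n) {τ v} → v ∈ᵛ τ → ∂-term c τ v ≡ +0
    ∂-term-∈ c p rewrite p = refl

    ∂-term-∉ : ∀ (c : Chain n) {τ v} → v ∉ᵛ τ → ∂-term c τ v ≡ sgn (below τ v) * c (τ ∪ ⁅ v ⁆)
    ∂-term-∉ c p rewrite p = refl

    ∂-local : ∀ (c d : Chain n) τ → (∀ v → v ∉ᵛ τ → c (τ ∪ ⁅ v ⁆) ≡ d (τ ∪ ⁅ v ⁆)) → ∂ c τ ≡ ∂ d τ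
    ∂-local c d τ e = sum-cong {f = ∂-term c τ} {g = ∂-term d τ} term
      where
      term : ∀ v → ∂-term c τ v ≡ ∂-term d τ v
      term v with ∈ᵛ-or v τ
      ... | inj₁ p = trans (∂-term-∈ c p) (sym (∂-term-∈ d p))
      ... | inj₂ q = trans (∂-term-∉ c q) (trans (cong (sgn (below τ v) *_) (e v q)) (sym (∂-term-∉ d q)))

    ∂-zero : ∀ (c : Chain n) τ → (∀ v → v ∉ᵛ τ → c (τ ∪ ⁅ v ⁆) ≡ +0) → ∂ c τ ≡ +0
    ∂-zero c τ e = sum-zero {f = ∂-term c τ} term
      where
      term : ∀ v → ∂-term c τ v ≡ +0
      term v with ∈ᵛ-or v τ
      ... | inj₁ p = ∂-term-∈ c p
      ... | inj₂ q = trans (∂-term-∉ c q) (trans (cong (sgn (below τ v) *_) (e v q)) (ℤₚ.*-zeroʳ (sgn (below τ v))))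

    ∂-support : ∀ (c : Chain n) τ → ∂ c τ ≢ +0 → Σ (Fin n) λ v → v ∉ᵛ τ × c (τ ∪ ⁅ v ⁆) ≢ +0
    ∂-support c τ ne with sum-nonzero (∂-term c τ) ne
    ... | v , tv with ∈ᵛ-or v τ
    ...   | inj₁ p = ⊥-elim (tv (∂-term-∈ c p))
    ...   | inj₂ q = v , q , λ z → tv (trans (∂-term-∉ c q) (trans (cong (sgn (below τ v) *_) z) (ℤₚ.*-zeroʳ (sgn (below τ v)))))

    infixl 6 _+ᶜ_ _-ᶜ_
    infixr 7 _*ᶜ_
    _+ᶜ_ _-ᶜ_ : Chain n → Chain n → Chain n
    (c +ᶜ d) σ = c σ + d σ
    (c -ᶜ d) σ = c σ - d σ

    _*ᶜ_ : ℤ → Chain n → Chain n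
    (a *ᶜ c) σ = a * c σ

    ∂-+ : ∀ (c d : Chain n) τ → ∂ (c +ᶜ d) τ ≡ ∂ c τ + ∂ d τ
    ∂-+ c d τ = trans (sum-cong {f = ∂-term (c +ᶜ d) τ} term) (sum-+ (∂-term c τ) (∂-term d τ))
      where
      term : ∀ v → ∂-term (c +ᶜ d) τ v ≡ ∂-term c τ v + ∂-term d τ v
      term v with lookup τ v
      ... | true  = refl
      ... | false = ℤₚ.*-distribˡ-+ (sgn (below τ v)) _ _

    ∂-* : ∀ a (c : Chain n) τ → ∂ (a *ᶜ c) τ ≡ a * ∂ c τ
    ∂-* a c τ = trans (sum-cong {f = ∂-term (a *ᶜ c) τ} term) (sum-* a (∂-term c τ))
      where
      rearrange : ∀ s a x → s * (a * x) ≡ a * (s * x)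
      rearrange = solve-∀
      term : ∀ v → ∂-term (a *ᶜ c) τ v ≡ a * ∂-term c τ v
      term v with lookup τ v
      ... | true  = sym (ℤₚ.*-zeroʳ a)
      ... | false = rearrange (sgn (below τ v)) a _

    ∂-minus : ∀ (c d : Chain n) τ → ∂ (c -ᶜ d) τ ≡ ∂ c τ - ∂ d τ
    ∂-minus c d τ = begin
      ∂ (c -ᶜ d) τ                  ≡⟨ ∂-local (c -ᶜ d) (c +ᶜ (- (+ 1)) *ᶜ d) τ (λ v _ → as-sum (c (τ ∪ ⁅ v ⁆)) (d (τ ∪ ⁅ v ⁆))) ⟩
      ∂ (c +ᶜ (- (+ 1)) *ᶜ d) τ     ≡⟨ ∂-+ c ((- (+ 1)) *ᶜ d) τ ⟩
      ∂ c τ + ∂ ((- (+ 1)) *ᶜ d) τ  ≡⟨ cong (_+_ (∂ c τ)) (∂-* (- (+ 1)) d τ) ⟩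
      ∂ c τ + (- (+ 1)) * ∂ d τ     ≡⟨ sym (as-sum (∂ c τ) (∂ d τ)) ⟩
      ∂ c τ - ∂ d τ ∎
      where
      open ≡-Reasoning
      as-sum : ∀ x y → x - y ≡ x + (- (+ 1)) * y
      as-sum = solve-∀

    -- The double sum runs over ordered pairs of inserted vertices. Exchanging the two negates each
    -- term, so the sum equals its own negative, and an integer with this property is zero.
    ∂∂ : ∀ (c : Chain n) τ → ∂ (∂ c) τ ≡ +0
    ∂∂ c τ = self-negative (begin
      ∂ (∂ c) τ                                ≡⟨ double ⟩
      sumFin (λ v → sumFin (G v))              ≡⟨ sum-swap G ⟩
      sumFin (λ w → sumFin (λ v → G v w))      ≡⟨ sum-cong (λ w → trans (sum-cong (λ v → antisymmetric v w)) (sum-neg (G w))) ⟩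
      sumFin (λ w → - sumFin (G w))            ≡⟨ sum-neg (λ w → sumFin (G w)) ⟩
      - sumFin (λ w → sumFin (G w))            ≡⟨ cong -_ (sym double) ⟩
      - ∂ (∂ c) τ ∎)
      where
      open ≡-Reasoning
      G : Fin n → Fin n → ℤ
      G v w = if lookup τ v then +0 else sgn (below τ v) * ∂-term c (τ ∪ ⁅ v ⁆) w
      G-∈ˡ : ∀ {v w} → v ∈ᵛ τ → G v w ≡ +0
      G-∈ˡ p rewrite p = refl
      G-∉ˡ : ∀ {v w} → v ∉ᵛ τ → G v w ≡ sgn (below τ v) * ∂-term c (τ ∪ ⁅ v ⁆) w
      G-∉ˡ p rewrite p = refl
      double : ∂ (∂ c) τ ≡ sumFin (λ v → sumFin (G v))
      double = sum-cong {f = ∂-term (∂ c) τ} term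
        where
        term : ∀ v → ∂-term (∂ c) τ v ≡ sumFin (G v)
        term v with ∈ᵛ-or v τ
        ... | inj₁ p = trans (∂-term-∈ (∂ c) p) (sym (sum-zero {f = G v} (λ w → G-∈ˡ {v} {w} p)))
        ... | inj₂ q = trans (∂-term-∉ (∂ c) q) (trans (sym (sum-* (sgn (below τ v)) (∂-term c (τ ∪ ⁅ v ⁆))))
                         (sum-cong {g = G v} (λ w → sym (G-∉ˡ {v} {w} q))))
      G-∈ʳ : ∀ {v w} → w ∈ᵛ τ ∪ ⁅ v ⁆ → G v w ≡ +0
      G-∈ʳ {v} {w} p with ∈ᵛ-or v τ
      ... | inj₁ q = G-∈ˡ {v} {w} q
      ... | inj₂ q = trans (G-∉ˡ {v} {w} q) (trans (cong (sgn (below τ v) *_) (∂-term-∈ c p)) (ℤₚ.*-zeroʳ (sgn (below τ v))))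
      G-∉ : ∀ {v w} → v ≢ w → v ∉ᵛ τ → w ∉ᵛ τ → G v w ≡ (sgn (below τ v) * sgn (below (τ ∪ ⁅ v ⁆) w)) * c ((τ ∪ ⁅ v ⁆) ∪ ⁅ w ⁆)
      G-∉ {v} {w} v≢w v∉ w∉ = trans (G-∉ˡ {v} {w} v∉) (trans
        (cong (sgn (below τ v) *_) (∂-term-∉ c (trans (insert-other τ (v≢w ∘ sym)) w∉)))
        (sym (ℤₚ.*-assoc (sgn (below τ v)) _ _)))
      antisymmetric : ∀ v w → G v w ≡ - G w v
      antisymmetric v w with v Finₚ.≟ w
      ... | yes refl = trans (G-∈ʳ (insert-same τ v)) (sym (cong -_ (G-∈ʳ (insert-same τ v))))
      ... | no v≢w with ∈ᵛ-or v τ | ∈ᵛ-or w τ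
      ...   | inj₁ v∈ | _ = trans (G-∈ˡ {v} {w} v∈) (sym (cong -_ (G-∈ʳ {w} {v} (insert-mono τ v∈))))
      ...   | inj₂ v∉ | inj₁ w∈ = trans (G-∈ʳ {v} {w} (insert-mono τ w∈)) (sym (cong -_ (G-∈ˡ {w} {v} w∈)))
      ...   | inj₂ v∉ | inj₂ w∉ = begin
          G v w
            ≡⟨ G-∉ v≢w v∉ w∉ ⟩
          (sgn (below τ v) * sgn (below (τ ∪ ⁅ v ⁆) w)) * c ((τ ∪ ⁅ v ⁆) ∪ ⁅ w ⁆)
            ≡⟨ cong₂ (λ s ρ → s * c ρ) (sgn-exchange τ v≢w v∉ w∉) (insert-comm τ v w) ⟩
          - (sgn (below τ w) * sgn (below (τ ∪ ⁅ w ⁆) v)) * c ((τ ∪ ⁅ w ⁆) ∪ ⁅ v ⁆)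
            ≡⟨ sym (ℤₚ.neg-distribˡ-* (sgn (below τ w) * sgn (below (τ ∪ ⁅ w ⁆) v)) _) ⟩
          - ((sgn (below τ w) * sgn (below (τ ∪ ⁅ w ⁆) v)) * c ((τ ∪ ⁅ w ⁆) ∪ ⁅ v ⁆))
            ≡⟨ cong -_ (sym (G-∉ (v≢w ∘ sym) w∉ v∉)) ⟩
          - G w v ∎

-- Relative homology of families of faces.

module RelativeHomology where

  open import Data.Nat as ℕ using (zero; suc)
  import Data.Nat.Properties as ℕₚ
  open import Data.Integer using (ℤ; +_; -_; _+_; _*_; _-_; +0)
  import Data.Integer.Properties as ℤₚ
  open import Data.Integer.Tactic.RingSolver using (solve-∀)
  open import Data.Fin using (Fin; toℕ)
  import Data.Fin.Properties as Finₚ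
  open import Data.Fin.Subset using (Subset; _∪_; ⁅_⁆; ∣_∣)
  open import Data.Vec using (lookup; _[_]≔_)
  import Data.Vec.Properties as Vecₚ
  open ChainAlgebra

  -- A convex family of subsets carries the relative simplicial chain complex of a pair.
  record Family (n : ℕ) : Set₁ where
    field
      Face   : Subset n → Set
      face?  : ∀ σ → Dec (Face σ)
      convex : ∀ {τ v w} → Face τ → Face ((τ ∪ ⁅ v ⁆) ∪ ⁅ w ⁆) → Face (τ ∪ ⁅ v ⁆)

  module _ {n : ℕ} where

    record Supported (F : Family n) (k : ℕ) (c : Chain n) : Set where
      field support : ∀ σ → c σ ≢ +0 → Family.Face F σ × ∣ σ ∣ ≡ k
    open Supported public

    -- `∂` may have values at subsets outside the family. Reading it only at faces gives the
    -- boundary map of the relative complex.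
    RelativeCycle : Family n → ℕ → Chain n → Set
    RelativeCycle F k c = Supported F k c × (∀ {τ} → Family.Face F τ → ∂ c τ ≡ +0)

    RelativeBoundary : Family n → ℕ → Chain n → Set
    RelativeBoundary F k c = Σ (Chain n) λ d → Supported F (suc k) d × (∀ {τ} → Family.Face F τ → ∂ d τ ≡ c τ)

    Vanishes : Family n → ℕ → Set
    Vanishes F k = ∀ c → RelativeCycle F k c → RelativeBoundary F k c

    IsInfiniteCyclic : Family n → ℕ → Set
    IsInfiniteCyclic F k = Σ (Chain n) λ z → RelativeCycle F k z
      × (∀ c → RelativeCycle F k c → Σ ℤ λ a → RelativeBoundary F k (c -ᶜ a *ᶜ z))
      × (∀ a → RelativeBoundary F k (a *ᶜ z) → a ≡ +0)

    Acyclic : Family n → Set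
    Acyclic F = ∀ k → Vanishes F k

    SphereAt : Family n → ℕ → Set
    SphereAt F k = IsInfiniteCyclic F k × (∀ j → j ≢ k → Vanishes F j)

    module _ (F : Family n) where

      open Family F

      restrict : Chain n → Chain n
      restrict c σ = if does (face? σ) then c σ else +0

      restrict-∈ : ∀ c {σ} → Face σ → restrict c σ ≡ c σ
      restrict-∈ c {σ} f with face? σ
      ... | yes _ = refl
      ... | no ¬f = ⊥-elim (¬f f)

      restrict-∉ : ∀ c {σ} → ¬ Face σ → restrict c σ ≡ +0
      restrict-∉ c {σ} ¬f with face? σ
      ... | yes f = ⊥-elim (¬f f)
      ... | no _  = refl

      restrict-nonzero : ∀ c {σ} → restrict c σ ≢ +0 → Face σ × c σ ≢ +0
      restrict-nonzero c {σ} ne with face? σ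
      ... | yes f = f , ne
      ... | no _  = ⊥-elim (ne refl)

    module _ {F : Family n} where

      open Family F

      supported-∉ : ∀ {k c} → Supported F k c → ∀ {σ} → ¬ Face σ → c σ ≡ +0
      supported-∉ {c = c} s {σ} ¬f = decidable-stable (c σ ℤₚ.≟ +0) λ ne → ¬f (proj₁ (support s σ ne))

      supported-minus : ∀ {k c d} → Supported F k c → Supported F k d → Supported F k (c -ᶜ d)
      supported-minus {c = c} {d} s t .support σ ne with c σ ℤₚ.≟ +0 | d σ ℤₚ.≟ +0
      ... | no cσ  | _      = support s σ cσ
      ... | yes _  | no dσ  = support t σ dσ
      ... | yes cσ | yes dσ = ⊥-elim (ne (cong₂ _-_ cσ dσ))

      supported-plus : ∀ {k c d} → Supported F k c → Supported F k d → Supported F k (c +ᶜ d)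
      supported-plus {c = c} {d} s t .support σ ne with c σ ℤₚ.≟ +0 | d σ ℤₚ.≟ +0
      ... | no cσ  | _      = support s σ cσ
      ... | yes _  | no dσ  = support t σ dσ
      ... | yes cσ | yes dσ = ⊥-elim (ne (cong₂ _+_ cσ dσ))

      supported-scale : ∀ {k c} a → Supported F k c → Supported F k (a *ᶜ c)
      supported-scale a s .support σ ne = support s σ λ cσ → ne (trans (cong (a *_) cσ) (ℤₚ.*-zeroʳ a))

      cycle-minus : ∀ {k c d} → RelativeCycle F k c → RelativeCycle F k d → RelativeCycle F k (c -ᶜ d)
      cycle-minus {c = c} {d} (s , p) (t , q) = supported-minus s t , λ {τ} f → trans (∂-minus c d τ) (cong₂ _-_ (p f) (q f))

      cycle-scale : ∀ {k c} a → RelativeCycle F k c → RelativeCycle F k (a *ᶜ c)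
      cycle-scale {c = c} a (s , p) = supported-scale a s , λ {τ} f → trans (∂-* a c τ) (trans (cong (a *_) (p f)) (ℤₚ.*-zeroʳ a))

      boundary-cong : ∀ {k c d} → (∀ σ → c σ ≡ d σ) → RelativeBoundary F k c → RelativeBoundary F k d
      boundary-cong e (x , s , p) = x , s , λ {τ} f → trans (p f) (e τ)

      ∂-supported : ∀ {k x} → Supported F (suc k) x → Supported F k (restrict F (∂ x))
      ∂-supported {k} {x} s .support σ ne with restrict-nonzero F (∂ x) ne
      ... | f , ∂xσ with ∂-support x σ ∂xσ
      ...   | v , v∉ , xv = f , ℕₚ.suc-injective (trans (sym (∣insert∣ σ v∉)) (proj₂ (support s _ xv)))

      ∂-degree-zero : ∀ {x} → Supported F 0 x → ∀ τ → ∂ x τ ≡ +0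
      ∂-degree-zero {x} s τ = ∂-zero x τ λ v v∉ → decidable-stable (x _ ℤₚ.≟ +0) λ ne →
        case-suc (trans (sym (∣insert∣ τ v∉)) (proj₂ (support s _ ne)))
        where
        case-suc : ∀ {m} → suc m ≢ 0
        case-suc ()

      -- Nothing is lost by truncating: if `τ ∪ ⁅ v ⁆` is not a face, convexity forbids every face
      -- one vertex above it, so `∂ x` vanishes there anyway.
      ∂-restrict-∂ : ∀ {k x} → Supported F k x → ∀ {τ} → Face τ → ∂ (restrict F (∂ x)) τ ≡ +0
      ∂-restrict-∂ {x = x} s {τ} f = trans (∂-local (restrict F (∂ x)) (∂ x) τ agree) (∂∂ x τ)
        where
        agree : ∀ v → v ∉ᵛ τ → restrict F (∂ x) (τ ∪ ⁅ v ⁆) ≡ ∂ x (τ ∪ ⁅ v ⁆)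
        agree v _ with face? (τ ∪ ⁅ v ⁆)
        ... | yes _ = refl
        ... | no ¬f = sym (∂-zero x (τ ∪ ⁅ v ⁆) λ w _ → supported-∉ s (λ g → ¬f (convex f g)))

    zero-supported : ∀ {F k} → Supported F k zeroC
    zero-supported .support σ ne = ⊥-elim (ne refl)

    generator-not-boundary : ∀ {F k z} → (∀ a → RelativeBoundary F k (a *ᶜ z) → a ≡ +0) → ¬ RelativeBoundary F k z
    generator-not-boundary {z = z} free bd with free (+ 1) (boundary-cong {c = z} (λ σ → sym (ℤₚ.*-identityˡ (z σ))) bd)
    ... | ()

    -- A linear relation between cycles inducing an isomorphism on homology.
    record Correspondence (F : Family n) (k : ℕ) (G : Family n) (l : ℕ) : Set₁ where
      field
        _≈_       : Chain n → Chain n → Set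
        to        : ∀ {c} → RelativeCycle F k c → Σ (Chain n) λ d → c ≈ d × RelativeCycle G l d
        from      : ∀ {d} → RelativeCycle G l d → Σ (Chain n) λ c → c ≈ d × RelativeCycle F k c
        minus     : ∀ {c d c′ d′} → c ≈ d → c′ ≈ d′ → (c -ᶜ c′) ≈ (d -ᶜ d′)
        scale     : ∀ {c d} a → c ≈ d → (a *ᶜ c) ≈ (a *ᶜ d)
        boundary⇒ : ∀ {c d} → c ≈ d → RelativeBoundary F k c → RelativeBoundary G l d
        boundary⇐ : ∀ {c d} → c ≈ d → RelativeBoundary G l d → RelativeBoundary F k c

    flip : ∀ {F k G l} → Correspondence F k G l → Correspondence G l F k
    flip C = record { _≈_ = λ d c → c ≈ d ; to = from ; from = to ; minus = minus ; scale = scale ; boundary⇒ = boundary⇐ ; boundary⇐ = boundary⇒ }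
      where open Correspondence C

    module _ {F k G l} (C : Correspondence F k G l) where

      open Correspondence C

      transfer-vanishes : Vanishes F k → Vanishes G l
      transfer-vanishes van d cyc = let (c , c≈d , cyc′) = from cyc in boundary⇒ c≈d (van c cyc′)

      transfer-cyclic : IsInfiniteCyclic F k → IsInfiniteCyclic G l
      transfer-cyclic (z , zc , gen , free) with to zc
      ... | y , z≈y , yc = y , yc
        , (λ d cyc → let (c , c≈d , cyc′) = from cyc
                         (a , bd) = gen c cyc′
                     in a , boundary⇒ (minus c≈d (scale a z≈y)) bd)
        , λ a bd → free a (boundary⇐ (scale a z≈y) bd)

    -- `lower` makes `S` a subcomplex of `D`; the complement `Q` consists of the faces of the
    -- quotient complex.
    record Split (D S Q : Family n) : Set where
      private
        module D = Family D
        module S = Family S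
        module Q = Family Q
      field
        S⊆D   : ∀ {σ} → S.Face σ → D.Face σ
        Q⊆D   : ∀ {σ} → Q.Face σ → D.Face σ
        cover : ∀ {σ} → D.Face σ → S.Face σ ⊎ Q.Face σ
        apart : ∀ {σ} → S.Face σ → Q.Face σ → ⊥
        lower : ∀ {τ v} → S.Face (τ ∪ ⁅ v ⁆) → D.Face τ → S.Face τ

    -- The three isomorphisms of the long exact sequence when one term vanishes.

    module LongExact {D S Q : Family n} (split : Split D S Q) where

      open Split split
      private
        module D = Family D
        module S = Family S
        module Q = Family Q

      S⇒D : ∀ {k c} → Supported S k c → Supported D k c
      S⇒D s .support σ ne = S⊆D (proj₁ (support s σ ne)) , proj₂ (support s σ ne)

      Q⇒D : ∀ {k c} → Supported Q k c → Supported D k c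
      Q⇒D s .support σ ne = Q⊆D (proj₁ (support s σ ne)) , proj₂ (support s σ ne)

      D⇒S : ∀ {k c} → Supported D k c → (∀ {σ} → Q.Face σ → c σ ≡ +0) → Supported S k c
      D⇒S s z .support σ ne with support s σ ne
      ... | f , len with cover f
      ...   | inj₁ g = g , len
      ...   | inj₂ q = ⊥-elim (ne (z q))

      restrict-supported : ∀ {k c} → Supported D k c → Supported Q k (restrict Q c)
      restrict-supported {c = c} s .support σ ne with restrict-nonzero Q c ne
      ... | q , cσ = q , proj₂ (support s σ cσ)

      sub-∂ : ∀ {k c} → Supported S k c → ∀ {τ} → Q.Face τ → ∂ c τ ≡ +0
      sub-∂ {c = c} s {τ} q = ∂-zero c τ λ v _ → supported-∉ s λ g → apart (lower g (Q⊆D q)) q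

      sub-Q : ∀ {k c} → Supported S k c → ∀ {σ} → Q.Face σ → c σ ≡ +0
      sub-Q s q = supported-∉ s λ g → apart g q

      ∂-restrict-Q : ∀ {k c} → Supported D k c → ∀ {τ} → Q.Face τ → ∂ (restrict Q c) τ ≡ ∂ c τ
      ∂-restrict-Q {c = c} s {τ} q = ∂-local (restrict Q c) c τ agree
        where
        agree : ∀ v → v ∉ᵛ τ → restrict Q c (τ ∪ ⁅ v ⁆) ≡ c (τ ∪ ⁅ v ⁆)
        agree v _ with Q.face? (τ ∪ ⁅ v ⁆)
        ... | yes _ = refl
        ... | no ¬q = sym (supported-∉ s λ d → [ (λ g → apart (lower g (Q⊆D q)) q) , ¬q ]′ (cover d))

      restrict-cycle : ∀ {k c} → Supported D k c → (∀ {τ} → Q.Face τ → ∂ c τ ≡ +0) → RelativeCycle Q k (restrict Q c)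
      restrict-cycle s p = restrict-supported s , λ q → trans (∂-restrict-Q s q) (p q)

      lift-cycle : ∀ {k c} → RelativeCycle S k c → RelativeCycle D k c
      lift-cycle (s , p) = S⇒D s , λ d → [ p , sub-∂ s ]′ (cover d)

      -- Subtracting the boundary of `filler` cancels `x` on `Q`: what remains lies in the
      -- subcomplex and has the same boundary. All three isomorphisms use this move.
      record Pushed (k : ℕ) (x : Chain n) : Set where
        field
          filler    : Chain n
          filler-D  : Supported D (suc k) filler
          remainder : Supported S k (x -ᶜ restrict D (∂ filler))
          same-∂    : ∀ {τ} → D.Face τ → ∂ (x -ᶜ restrict D (∂ filler)) τ ≡ ∂ x τ

      private
        minus-zero : ∀ a → a - +0 ≡ a
        minus-zero = solve-∀
        minus-self : ∀ a → a - a ≡ +0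
        minus-self = solve-∀

      push-by : ∀ {k x f} → Supported D k x → Supported D (suc k) f → (∀ {τ} → Q.Face τ → ∂ f τ ≡ x τ) → Pushed k x
      push-by {k} {x} {f} s sf eq = record
        { filler = f ; filler-D = sf
        ; remainder = D⇒S (supported-minus s (∂-supported sf))
            λ {σ} q → trans (cong (_-_ (x σ)) (trans (restrict-∈ D (∂ f) (Q⊆D q)) (eq q))) (minus-self (x σ))
        ; same-∂ = λ {τ} d → trans (∂-minus x (restrict D (∂ f)) τ) (trans (cong (_-_ (∂ x τ)) (∂-restrict-∂ {F = D} sf d)) (minus-zero (∂ x τ))) }

      push : ∀ {k x} → Vanishes Q k → Supported D k x → (∀ {τ} → Q.Face τ → ∂ x τ ≡ +0) → Pushed k x
      push {k} {x} van s p with van (restrict Q x) (restrict-cycle s p)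
      ... | f , sf , bd = push-by s (Q⇒D sf) λ q → trans (bd q) (restrict-∈ Q x q)

      -- Chains are related if they differ by a boundary in `D`. A cycle of `D` restricts to a cycle
      -- of `Q`, which bounds, and pushing along its filling moves the cycle into `S`.
      inclusion : Acyclic Q → ∀ k → Correspondence S k D k
      inclusion van k = record
        { _≈_ = λ a c → Supported S k a × Σ (Chain n) λ d → Supported D (suc k) d × (∀ {τ} → D.Face τ → ∂ d τ ≡ c τ - a τ)
        ; to = λ {c} cyc → c , (proj₁ cyc , zeroC , zero-supported , λ {τ} _ → trans (∂-zero zeroC τ (λ _ _ → refl)) (sym (minus-self (c τ)))) , lift-cycle cyc
        ; from = from
        ; minus = λ { {c} {d} {c′} {d′} (s , x , sx , p) (s′ , x′ , sx′ , p′) → supported-minus s s′ , x -ᶜ x′ , supported-minus sx sx′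
                    , λ {τ} f → trans (∂-minus x x′ τ) (trans (cong₂ _-_ (p f) (p′ f)) (regroup (d τ) (c τ) (d′ τ) (c′ τ))) }
        ; scale = λ { {c} {d} a (s , x , sx , p) → supported-scale a s , a *ᶜ x , supported-scale a sx
                    , λ {τ} f → trans (∂-* a x τ) (trans (cong (a *_) (p f)) (distrib a (d τ) (c τ))) }
        ; boundary⇒ = λ { {c} {d} (s , x , sx , p) (e , se , q) → e +ᶜ x , supported-plus (S⇒D se) sx
                    , λ {τ} f → trans (∂-+ e x τ) (trans (cong₂ _+_ (on-D s se q f) (p f)) (cancel (c τ) (d τ))) }
        ; boundary⇐ = boundary⇐ }
        where
        regroup : ∀ a b c d → (a - b) - (c - d) ≡ (a - c) - (b - d)
        regroup = solve-∀
        distrib : ∀ a b c → a * (b - c) ≡ a * b - a * c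
        distrib = solve-∀
        cancel : ∀ a b → a + (b - a) ≡ b
        cancel = solve-∀
        cancel′ : ∀ a b → b - (b - a) ≡ a
        cancel′ = solve-∀
        on-D : ∀ {c e} → Supported S k c → Supported S (suc k) e → (∀ {τ} → S.Face τ → ∂ e τ ≡ c τ) → ∀ {τ} → D.Face τ → ∂ e τ ≡ c τ
        on-D s se q f = [ q , (λ g → trans (sub-∂ se g) (sym (sub-Q s g))) ]′ (cover f)
        _≈_ : Chain n → Chain n → Set
        a ≈ c = Supported S k a × Σ (Chain n) λ d → Supported D (suc k) d × (∀ {τ} → D.Face τ → ∂ d τ ≡ c τ - a τ)
        from : ∀ {d} → RelativeCycle D k d → Σ (Chain n) λ c → c ≈ d × RelativeCycle S k c
        from {d} (s , p) = _ , (remainder , filler , filler-D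
          , λ {τ} f → trans (sym (restrict-∈ D (∂ filler) f)) (sym (cancel′ _ (d τ)))) , remainder , λ g → trans (same-∂ (S⊆D g)) (p (S⊆D g))
          where open Pushed (push (van k) s (p ∘ Q⊆D))
        boundary⇐ : ∀ {c d} → c ≈ d → RelativeBoundary D k d → RelativeBoundary S k c
        boundary⇐ {c} {d} (s , x , sx , p) (e , se , q) = _ , remainder , λ g → trans (same-∂ (S⊆D g)) (∂e-x (S⊆D g))
          where
          ∂e-x : ∀ {τ} → D.Face τ → ∂ (e -ᶜ x) τ ≡ c τ
          ∂e-x {τ} f = trans (∂-minus e x τ) (trans (cong₂ _-_ (q f) (p f)) (cancel′ (c τ) (d τ)))
          open Pushed (push (van (suc k)) (supported-minus se sx) (λ g → trans (∂e-x (Q⊆D g)) (sub-Q s g)))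

      -- Chains are related by restriction to `Q`. The boundary in `D` of a cycle of `Q` is a cycle
      -- of `S`, hence the boundary of some `e` there, and subtracting `e` lifts the cycle to `D`.
      projection : Acyclic S → ∀ k → Correspondence D k Q k
      projection van k = record
        { _≈_ = _≈_
        ; to = λ {c} cyc → restrict Q c , (cyc , λ q → sym (restrict-∈ Q c q)) , restrict-cycle (proj₁ cyc) (proj₂ cyc ∘ Q⊆D)
        ; from = from k
        ; minus = λ (c , p) (c′ , p′) → cycle-minus c c′ , λ q → cong₂ _-_ (p q) (p′ q)
        ; scale = λ a (c , p) → cycle-scale a c , λ q → cong (a *_) (p q)
        ; boundary⇒ = λ { ((s , _) , p) (e , se , bd) → restrict Q e , restrict-supported se
                      , λ q → trans (∂-restrict-Q se q) (trans (bd (Q⊆D q)) (p q)) }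
        ; boundary⇐ = boundary⇐ }
        where
        cancel : ∀ a b → a + (b - a) ≡ b
        cancel = solve-∀
        _≈_ : Chain n → Chain n → Set
        c ≈ q = RelativeCycle D k c × (∀ {σ} → Q.Face σ → c σ ≡ q σ)
        from : ∀ k {d} → RelativeCycle Q k d → Σ (Chain n) λ c → (RelativeCycle D k c × (∀ {σ} → Q.Face σ → c σ ≡ d σ)) × RelativeCycle D k c
        -- In index 0 there is no lower index in which to correct: a chain there has zero boundary
        -- and is its own lift.
        from zero {d} (s , p) = d , (cyc , λ _ → refl) , cyc
          where
          cyc : RelativeCycle D zero d
          cyc = Q⇒D s , λ {τ} _ → ∂-degree-zero s τ
        from (suc k) {d} (s , p) with van k (restrict D (∂ d))
            ( D⇒S (∂-supported (Q⇒D s)) (λ q → trans (restrict-∈ D (∂ d) (Q⊆D q)) (p q))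
            , λ g → ∂-restrict-∂ {F = D} (Q⇒D s) (S⊆D g))
        ... | e , se , bd = d -ᶜ e , (cyc , on-Q) , cyc
          where
          ∂e≡∂d : ∀ {τ} → D.Face τ → ∂ e τ ≡ ∂ d τ
          ∂e≡∂d f = [ (λ g → trans (bd g) (restrict-∈ D (∂ d) f)) , (λ q → trans (sub-∂ se q) (sym (p q))) ]′ (cover f)
          cyc : RelativeCycle D (suc k) (d -ᶜ e)
          cyc = supported-minus (Q⇒D s) (S⇒D se) , λ {τ} f → trans (∂-minus d e τ) (trans (cong (_-_ (∂ d τ)) (∂e≡∂d f)) (minus-self (∂ d τ)))
          on-Q : ∀ {σ} → Q.Face σ → (d -ᶜ e) σ ≡ d σ
          on-Q {σ} q = trans (cong (_-_ (d σ)) (sub-Q se q)) (minus-zero (d σ))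
        boundary⇐ : ∀ {c q} → c ≈ q → RelativeBoundary Q k q → RelativeBoundary D k c
        boundary⇐ {c} {q} ((s , p) , c≡q) (e , se , bd) with van k _ (remainder , λ g → trans (same-∂ (S⊆D g)) (p (S⊆D g)))
          where open Pushed (push-by s (Q⇒D se) (λ f → trans (bd f) (sym (c≡q f))))
        ... | f , sf , bd′ = e +ᶜ f , supported-plus (Q⇒D se) (S⇒D sf) , total
          where
          total : ∀ {τ} → D.Face τ → ∂ (e +ᶜ f) τ ≡ c τ
          total {τ} d with cover d
          ... | inj₁ g = trans (∂-+ e f τ) (trans (cong (_+_ (∂ e τ)) (trans (bd′ g) (cong (_-_ (c τ)) (restrict-∈ D (∂ e) d)))) (cancel (∂ e τ) (c τ)))
          ... | inj₂ g = trans (∂-+ e f τ) (trans (cong₂ _+_ (trans (bd g) (sym (c≡q g))) (sub-∂ sf g)) (ℤₚ.+-identityʳ (c τ)))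

      -- The snake as a relation: one chain `x` of `D` restricts to `q` on `Q` and has boundary `a`
      -- in `S`.
      connecting : Acyclic D → ∀ k → Correspondence Q (suc k) S k
      connecting van k = record
        { _≈_ = _≈_
        ; to = λ {c} (s , p) → restrict D (∂ c)
              , (c , Q⇒D s , (λ _ → refl) , (λ f → sym (restrict-∈ D (∂ c) f)) , D⇒S (∂-supported (Q⇒D s)) (λ q → trans (restrict-∈ D (∂ c) (Q⊆D q)) (p q)))
              , D⇒S (∂-supported (Q⇒D s)) (λ q → trans (restrict-∈ D (∂ c) (Q⊆D q)) (p q)) , λ g → ∂-restrict-∂ {F = D} (Q⇒D s) (S⊆D g)
        ; from = from
        ; minus = λ { (x , sx , p , q , s) (x′ , sx′ , p′ , q′ , s′) → x -ᶜ x′ , supported-minus sx sx′ , (λ f → cong₂ _-_ (p f) (p′ f))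
                    , (λ {τ} f → trans (∂-minus x x′ τ) (cong₂ _-_ (q f) (q′ f))) , supported-minus s s′ }
        ; scale = λ { a (x , sx , p , q , s) → a *ᶜ x , supported-scale a sx , (λ f → cong (a *_) (p f))
                    , (λ {τ} f → trans (∂-* a x τ) (cong (a *_) (q f))) , supported-scale a s }
        ; boundary⇒ = boundary⇒
        ; boundary⇐ = boundary⇐ }
        where
        _≈_ : Chain n → Chain n → Set
        q ≈ a = Σ (Chain n) λ x → Supported D (suc k) x × (∀ {σ} → Q.Face σ → x σ ≡ q σ) × (∀ {τ} → D.Face τ → ∂ x τ ≡ a τ) × Supported S k a
        from : ∀ {d} → RelativeCycle S k d → Σ (Chain n) λ c → c ≈ d × RelativeCycle Q (suc k) c
        from {d} cyc@(s , _) with van k d (lift-cycle cyc)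
        ... | x , sx , bd = restrict Q x , (x , sx , (λ q → sym (restrict-∈ Q x q)) , bd , s)
                          , restrict-cycle sx (λ q → trans (bd (Q⊆D q)) (sub-Q s q))
        boundary⇒ : ∀ {q a} → q ≈ a → RelativeBoundary Q (suc k) q → RelativeBoundary S k a
        boundary⇒ (x , sx , x≡q , ∂x , s) (e , se , bd) = _ , remainder , λ g → trans (same-∂ (S⊆D g)) (∂x (S⊆D g))
          where open Pushed (push-by sx (Q⇒D se) (λ f → trans (bd f) (sym (x≡q f))))
        boundary⇐ : ∀ {q a} → q ≈ a → RelativeBoundary S k a → RelativeBoundary Q (suc k) q
        boundary⇐ {q} {a} (x , sx , x≡q , ∂x , s) (e , se , bd) with van (suc k) (x -ᶜ e) (supported-minus sx (S⇒D se) , closed)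
          where
          closed : ∀ {τ} → D.Face τ → ∂ (x -ᶜ e) τ ≡ +0
          closed {τ} f = trans (∂-minus x e τ) (trans (cong₂ _-_ (∂x f) ([ bd , (λ g → trans (sub-∂ se g) (sym (sub-Q s g))) ]′ (cover f))) (minus-self (a τ)))
        ... | f , sf , bd′ = restrict Q f , restrict-supported sf
            , λ {τ} g → trans (∂-restrict-Q sf g) (trans (bd′ (Q⊆D g)) (trans (cong₂ _-_ (x≡q g) (sub-Q se g)) (minus-zero (q τ))))

      acyclic-total : Acyclic S → Acyclic Q → Acyclic D
      acyclic-total vS vQ k = transfer-vanishes (flip (projection vS k)) (vQ k)

      acyclic-sub : Acyclic D → Acyclic Q → Acyclic S
      acyclic-sub vD vQ k = transfer-vanishes (flip (inclusion vQ k)) (vD k)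

      sphere-total-quotient : ∀ {k} → Acyclic S → SphereAt Q k → SphereAt D k
      sphere-total-quotient {k} vS (z , van) = transfer-cyclic (flip (projection vS k)) z , λ j j≢k → transfer-vanishes (flip (projection vS j)) (van j j≢k)

      sphere-total-sub : ∀ {k} → Acyclic Q → SphereAt S k → SphereAt D k
      sphere-total-sub {k} vQ (z , van) = transfer-cyclic (inclusion vQ k) z , λ j j≢k → transfer-vanishes (inclusion vQ j) (van j j≢k)

      sphere-sub-total : ∀ {k} → Acyclic Q → SphereAt D k → SphereAt S k
      sphere-sub-total {k} vQ (z , van) = transfer-cyclic (flip (inclusion vQ k)) z , λ j j≢k → transfer-vanishes (flip (inclusion vQ j)) (van j j≢k)

      sphere-sub-quotient : ∀ {k} → Acyclic D → SphereAt Q k → Σ ℕ λ l → k ≡ suc l × SphereAt S l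
      sphere-sub-quotient {suc l} vD (z , van) = l , refl , transfer-cyclic (connecting vD l) z
        , λ j j≢l → transfer-vanishes (connecting vD j) (van (suc j) (j≢l ∘ ℕₚ.suc-injective))
      -- The index must drop by one, so 0 is to be excluded: the generator would be a cycle of the
      -- acyclic `D`, and its filling would restrict to a filling in `Q`.
      sphere-sub-quotient {zero} vD ((z , (s , p) , _ , free) , _) with vD 0 z (Q⇒D s , λ {τ} _ → ∂-degree-zero s τ)
      ... | e , se , bd = ⊥-elim (generator-not-boundary free (restrict Q e , restrict-supported se , λ q → trans (∂-restrict-Q se q) (bd (Q⊆D q))))

    sphere-index-unique : ∀ {F : Family n} {k l} → SphereAt F k → SphereAt F l → k ≡ l
    sphere-index-unique {F} {k} {l} ((z , cyc , _ , free) , _) (_ , van) =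
      decidable-stable (k ℕ.≟ l) λ k≢l → generator-not-boundary free (van k k≢l z cyc)

    acyclic-not-sphere : ∀ {F : Family n} {k} → Acyclic F → ¬ SphereAt F k
    acyclic-not-sphere {F} {k} van ((z , cyc , _ , free) , _) = generator-not-boundary free (van k z cyc)

    -- Cones are acyclic.

    module Cone {F : Family n} (v : Fin n) (add : ∀ {σ} → Family.Face F σ → Family.Face F (σ ∪ ⁅ v ⁆))
      (drop : ∀ {τ} → v ∉ᵛ τ → Family.Face F (τ ∪ ⁅ v ⁆) → Family.Face F τ) where

      open Family F

      private
        remove-v : Subset n → Subset n
        remove-v σ = σ [ v ]≔ false

        remove-∉ᵛ : ∀ σ → v ∉ᵛ remove-v σ
        remove-∉ᵛ σ = Vecₚ.lookup∘updateAt v σ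

        remove-insert : ∀ τ → v ∉ᵛ τ → remove-v (τ ∪ ⁅ v ⁆) ≡ τ
        remove-insert τ v∉ = lookup-ext agree
          where
          agree : ∀ u → lookup (remove-v (τ ∪ ⁅ v ⁆)) u ≡ lookup τ u
          agree u with u Finₚ.≟ v
          ... | yes refl = trans (remove-∉ᵛ (τ ∪ ⁅ v ⁆)) (sym v∉)
          ... | no u≢v = trans (Vecₚ.lookup∘updateAt′ u v u≢v (τ ∪ ⁅ v ⁆)) (insert-other τ u≢v)

        insert-remove : ∀ σ → v ∈ᵛ σ → remove-v σ ∪ ⁅ v ⁆ ≡ σ
        insert-remove σ v∈ = lookup-ext agree
          where
          agree : ∀ u → lookup (remove-v σ ∪ ⁅ v ⁆) u ≡ lookup σ u
          agree u with u Finₚ.≟ v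
          ... | yes refl = trans (insert-same (remove-v σ) v) (sym v∈)
          ... | no u≢v = trans (insert-other (remove-v σ) u≢v) (Vecₚ.lookup∘updateAt′ u v u≢v σ)

        -- The factor is the sign that `∂` gives to `σ` when evaluated at `remove-v σ`. The two
        -- equal signs multiply to 1, so `∂ (cone c)` returns `c` on faces without `v`.
        cone : Chain n → Chain n
        cone c σ = if lookup σ v then sgn (below σ v) * c (remove-v σ) else +0

        cone-∈ : ∀ c {σ} → v ∈ᵛ σ → cone c σ ≡ sgn (below σ v) * c (remove-v σ)
        cone-∈ c p rewrite p = refl

        cone-∉ : ∀ c {σ} → v ∉ᵛ σ → cone c σ ≡ +0
        cone-∉ c p rewrite p = refl

        below-self : ∀ τ → v ∉ᵛ τ → below (τ ∪ ⁅ v ⁆) v ≡ below τ v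
        below-self τ v∉ rewrite below-insert τ v∉ v | <ᵇ-irrefl (toℕ v) = refl

        ∂-only-v : ∀ (x : Chain n) τ → v ∉ᵛ τ → (∀ u → u ≢ v → u ∉ᵛ τ → x (τ ∪ ⁅ u ⁆) ≡ +0) →
          ∂ x τ ≡ sgn (below τ v) * x (τ ∪ ⁅ v ⁆)
        ∂-only-v x τ v∉ z = trans (sum-single (∂-term x τ) v others) (∂-term-∉ x v∉)
          where
          others : ∀ u → u ≢ v → ∂-term x τ u ≡ +0
          others u u≢v with ∈ᵛ-or u τ
          ... | inj₁ p = ∂-term-∈ x p
          ... | inj₂ q = trans (∂-term-∉ x q) (trans (cong (sgn (below τ u) *_) (z u u≢v q)) (ℤₚ.*-zeroʳ (sgn (below τ u))))

      acyclic : Acyclic F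
      acyclic k c (s , p) = cone c , supp , bd
        where
        supp : Supported F (suc k) (cone c)
        supp .support σ ne with ∈ᵛ-or v σ
        ... | inj₂ v∉ = ⊥-elim (ne (cone-∉ c v∉))
        ... | inj₁ v∈ with support s (remove-v σ) (λ z → ne (trans (cone-∈ c v∈) (trans (cong (sgn (below σ v) *_) z) (ℤₚ.*-zeroʳ (sgn (below σ v))))))
        ...   | f , len = subst Face (insert-remove σ v∈) (add f)
                        , trans (cong ∣_∣ (sym (insert-remove σ v∈))) (trans (∣insert∣ (remove-v σ) (remove-∉ᵛ σ)) (cong suc len))
        off-v : ∀ {τ} → v ∉ᵛ τ → ∂ (cone c) τ ≡ c τ
        off-v {τ} v∉ = begin
          ∂ (cone c) τ
            ≡⟨ ∂-only-v (cone c) τ v∉ (λ u u≢v _ → cone-∉ c (trans (insert-other τ (u≢v ∘ sym)) v∉)) ⟩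
          sgn (below τ v) * cone c (τ ∪ ⁅ v ⁆)
            ≡⟨ cong (sgn (below τ v) *_) (trans (cone-∈ c (insert-same τ v)) (cong₂ (λ b ρ → sgn b * c ρ) (below-self τ v∉) (remove-insert τ v∉))) ⟩
          sgn (below τ v) * (sgn (below τ v) * c τ)
            ≡⟨ sym (ℤₚ.*-assoc (sgn (below τ v)) _ _) ⟩
          sgn (below τ v) * sgn (below τ v) * c τ
            ≡⟨ cong (_* c τ) (sgn-square (below τ v)) ⟩
          + 1 * c τ
            ≡⟨ ℤₚ.*-identityˡ (c τ) ⟩
          c τ ∎
          where open ≡-Reasoning
        -- The difference of c and the boundary of its cone is a cycle supported on faces containing v, hence zero.
        x : Chain n
        x = c -ᶜ restrict F (∂ (cone c))
        x-off : ∀ {σ} → v ∉ᵛ σ → x σ ≡ +0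
        x-off {σ} v∉ with face? σ
        ... | yes f = trans (cong (_-_ (c σ)) (off-v v∉)) (minus-self (c σ))
          where
          minus-self : ∀ a → a - a ≡ +0
          minus-self = solve-∀
        ... | no ¬f = trans (minus-zero (c σ)) (supported-∉ s ¬f)
          where
          minus-zero : ∀ a → a - +0 ≡ a
          minus-zero = solve-∀
        bd : ∀ {τ} → Face τ → ∂ (cone c) τ ≡ c τ
        bd {τ} f with ∈ᵛ-or v τ
        ... | inj₂ v∉ = off-v v∉
        ... | inj₁ v∈ = sym (ℤₚ.i-j≡0⇒i≡j (c τ) (∂ (cone c) τ) (trans (cong (_-_ (c τ)) (sym (restrict-∈ F (∂ (cone c)) f))) xτ))
          where
          ρ : Subset n
          ρ = remove-v τ
          f′ : Face ρ
          f′ = drop (remove-∉ᵛ τ) (subst Face (sym (insert-remove τ v∈)) f)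
          ∂x : ∂ x ρ ≡ +0
          ∂x = trans (∂-minus c (restrict F (∂ (cone c))) ρ) (cong₂ _-_ (p f′) (∂-restrict-∂ {F = F} supp f′))
          xτ : x τ ≡ +0
          xτ = trans (cong x (sym (insert-remove τ v∈))) (sgn-cancel (below ρ v)
            (trans (sym (∂-only-v x ρ (remove-∉ᵛ τ) (λ u u≢v _ → x-off (trans (insert-other ρ (u≢v ∘ sym)) (remove-∉ᵛ τ))))) ∂x))

-- The complex of an induced subgraph of the incidence graph.

module IncidenceComplex where

  open import Data.Bool.Properties using (∨-zeroʳ)
  import Data.Bool.Properties as Boolₚ
  open import Data.Nat as ℕ using (suc)
  import Data.Nat.Properties as ℕₚ
  open import Data.Integer using (ℤ; +_; _*_; _-_; +0)
  import Data.Integer.Properties as ℤₚ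
  open import Data.Fin using (Fin)
  import Data.Fin.Properties as Finₚ
  open import Data.Fin.Subset using (Subset; _∪_; ⁅_⁆; ∣_∣) renaming (⊥ to ∅)
  import Data.Fin.Subset.Properties as Subsetₚ
  open import Data.Vec using (lookup; tabulate)
  import Data.Vec.Properties as Vecₚ
  import Data.Sum as Sum
  import Data.Sum.Properties as Sumₚ
  open Walks
  open ChainAlgebra
  open RelativeHomology

  module Incidence (n : ℕ) (E : Set) (_≟ᴱ_ : (e f : E) → Dec (e ≡ f)) (allᴱ? : ∀ {Q : E → Set} → (∀ e → Dec (Q e)) → Dec (∀ e → Q e))
    (Inc : Fin n → E → Set) (inc? : ∀ v e → Dec (Inc v e)) where

    Node : Set
    Node = Fin n ⊎ E

    infix 4 _~_
    data _~_ : Node → Node → Set where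
      ve : ∀ {v e} → Inc v e → inj₁ v ~ inj₂ e
      ev : ∀ {v e} → Inc v e → inj₂ e ~ inj₁ v

    ~-sym : ∀ {x y} → x ~ y → y ~ x
    ~-sym (ve i) = ev i
    ~-sym (ev i) = ve i

    ~-irrefl : ∀ {x} → ¬ (x ~ x)
    ~-irrefl ()

    _~?_ : ∀ x y → Dec (x ~ y)
    inj₁ v ~? inj₁ w = no λ ()
    inj₁ v ~? inj₂ e = map′ ve (λ { (ve i) → i }) (inc? v e)
    inj₂ e ~? inj₁ v = map′ ev (λ { (ev i) → i }) (inc? v e)
    inj₂ e ~? inj₂ f = no λ ()

    _≟_ : (x y : Node) → Dec (x ≡ y)
    _≟_ = Sumₚ.≡-dec Finₚ._≟_ _≟ᴱ_

    nbhd? : ∀ x y → Dec (y ≡ x ⊎ y ~ x)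
    nbhd? x y = (y ≟ x) ⊎-dec (y ~? x)

    -- R collects the vertices whose link has been taken; keeping them in the faces avoids changes of sign in ∂.
    record IsFace (R : Subset n) (P : Sub Node) (σ : Subset n) : Set where
      field
        base   : ∀ v → v ∈ᵛ R → v ∈ᵛ σ
        inside : ∀ v → v ∈ᵛ σ → v ∈ᵛ R ⊎ inj₁ v ∈ˢ P
        missed : ∀ e → inj₂ e ∈ˢ P → Σ (Fin n) λ v → inj₁ v ∈ˢ P × Inc v e × v ∉ᵛ σ
    open IsFace

    isFace? : ∀ R P σ → Dec (IsFace R P σ)
    isFace? R P σ = map′ (λ (a , b , c) → record { base = a ; inside = b ; missed = c }) (λ f → base f , inside f , missed f)
      (Finₚ.all? (λ v → (lookup R v Boolₚ.≟ true) →-dec (lookup σ v Boolₚ.≟ true))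
       ×-dec (Finₚ.all? (λ v → (lookup σ v Boolₚ.≟ true) →-dec ((lookup R v Boolₚ.≟ true) ⊎-dec ∈ˢ? (inj₁ v) P))
       ×-dec allᴱ? (λ e → ∈ˢ? (inj₂ e) P →-dec Finₚ.any? (λ v → ∈ˢ? (inj₁ v) P ×-dec (inc? v e ×-dec (lookup σ v Boolₚ.≟ false))))))

    insert-∉ᵛ : ∀ (τ : Subset n) {u w} → u ∉ᵛ τ ∪ ⁅ w ⁆ → u ∉ᵛ τ
    insert-∉ᵛ τ {u} u∉ = ∉ᵛ-intro {σ = τ} λ u∈ → ∈ᵛ-∉ᵛ {σ = τ ∪ ⁅ _ ⁆} (insert-mono τ u∈) u∉

    complex : Subset n → Sub Node → Family n
    complex R P = record
      { Face   = IsFace R P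
      ; face?  = isFace? R P
      ; convex = λ {τ} {v} {w} f g → record
        { base   = λ u u∈ → insert-mono τ (base f u u∈)
        ; inside = λ u u∈ → inside g u (insert-mono (τ ∪ ⁅ v ⁆) u∈)
        ; missed = λ e e∈ → let (u , Pu , i , u∉) = missed g e e∈ in u , Pu , i , insert-∉ᵛ (τ ∪ ⁅ v ⁆) u∉ } }

    Apart : Subset n → Sub Node → Set
    Apart R P = ∀ v → v ∈ᵛ R → inj₁ v ∉ˢ P

    module VertexSplit (R : Subset n) (P : Sub Node) (apart : Apart R P) {v : Fin n} (Pv : inj₁ v ∈ˢ P) where

      Link Deletion : Sub Node
      Link     = remove P (_≟ inj₁ v)
      Deletion = remove P (nbhd? (inj₁ v))

      -- A face without `v` misses all edges through `v` automatically, so these leave together with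
      -- `v`. In a face with `v`, each such edge must be missed at another vertex, so only `v`
      -- leaves and is recorded in `R`.
      split : Split (complex R P) (complex R Deletion) (complex (R ∪ ⁅ v ⁆) Link)
      split = record { S⊆D = sub ; Q⊆D = quo ; cover = cover ; apart = clash ; lower = lower }
        where
        to-Deletion : ∀ {σ} → IsFace R P σ → v ∉ᵛ σ → IsFace R Deletion σ
        to-Deletion {σ} f v∉ = record
          { base = base f
          ; inside = λ w w∈ → Sum.map (λ p → p) (λ Pw → remove⁺ (nbhd? (inj₁ v)) Pw (λ { (inj₁ refl) → ∈ᵛ-∉ᵛ {σ = σ} w∈ v∉ ; (inj₂ ()) })) (inside f w w∈)
          ; missed = λ e e∈ → case missed f e (remove⊆ (nbhd? (inj₁ v)) e∈) of λ { (w , Pw , i , w∉) →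
              w , remove⁺ (nbhd? (inj₁ v)) Pw (λ { (inj₁ refl) → remove-∉ (nbhd? (inj₁ v)) (inj₂ (ev i)) e∈ ; (inj₂ ()) }) , i , w∉ } }
        sub : ∀ {σ} → IsFace R Deletion σ → IsFace R P σ
        v∉sub : ∀ {σ} → IsFace R Deletion σ → v ∉ᵛ σ
        v∉sub {σ} f = ∉ᵛ-intro {σ = σ} λ v∈ → case inside f v v∈ of λ
          { (inj₁ v∈R) → apart v v∈R Pv ; (inj₂ gone) → remove-∉ (nbhd? (inj₁ v)) (inj₁ refl) gone }
        sub {σ} f = record
          { base = base f
          ; inside = λ w w∈ → Sum.map (λ p → p) (remove⊆ (nbhd? (inj₁ v))) (inside f w w∈)
          ; missed = missed′ }
          where
          missed′ : ∀ e → inj₂ e ∈ˢ P → Σ (Fin n) λ w → inj₁ w ∈ˢ P × Inc w e × w ∉ᵛ σ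
          missed′ e Pe with inc? v e
          ... | yes i = v , Pv , i , v∉sub f
          ... | no ¬i = let (w , Pw , i , w∉) = missed f e (remove⁺ (nbhd? (inj₁ v)) Pe λ { (inj₁ ()) ; (inj₂ (ev i)) → ¬i i })
                        in w , remove⊆ (nbhd? (inj₁ v)) Pw , i , w∉
        quo : ∀ {σ} → IsFace (R ∪ ⁅ v ⁆) Link σ → IsFace R P σ
        quo f = record
          { base = λ w w∈ → base f w (insert-mono R w∈)
          ; inside = λ w w∈ → case inside f w w∈ of λ
              { (inj₁ w∈R) → case insert-elim R w∈R of λ { (inj₁ refl) → inj₂ Pv ; (inj₂ q) → inj₁ q }
              ; (inj₂ Pw) → inj₂ (remove⊆ (_≟ inj₁ v) Pw) }
          ; missed = λ e Pe → let (w , Pw , i , w∉) = missed f e (remove⁺ (_≟ inj₁ v) Pe λ ()) in w , remove⊆ (_≟ inj₁ v) Pw , i , w∉ }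
        to-Link : ∀ {σ} → IsFace R P σ → v ∈ᵛ σ → IsFace (R ∪ ⁅ v ⁆) Link σ
        to-Link {σ} f v∈ = record
          { base = λ w w∈ → case insert-elim R w∈ of λ { (inj₁ refl) → v∈ ; (inj₂ q) → base f w q }
          ; inside = inside′
          ; missed = λ e Pe → case missed f e (remove⊆ (_≟ inj₁ v) Pe) of λ { (w , Pw , i , w∉) →
              w , remove⁺ (_≟ inj₁ v) Pw (λ { refl → ∈ᵛ-∉ᵛ {σ = σ} v∈ w∉ }) , i , w∉ } }
          where
          inside′ : ∀ w → w ∈ᵛ σ → w ∈ᵛ R ∪ ⁅ v ⁆ ⊎ inj₁ w ∈ˢ Link
          inside′ w w∈ with w Finₚ.≟ v | inside f w w∈
          ... | yes refl | _       = inj₁ (insert-same R v)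
          ... | no _     | inj₁ q  = inj₁ (insert-mono R q)
          ... | no w≢v   | inj₂ Pw = inj₂ (remove⁺ (_≟ inj₁ v) Pw λ { refl → w≢v refl })
        cover : ∀ {σ} → IsFace R P σ → IsFace R Deletion σ ⊎ IsFace (R ∪ ⁅ v ⁆) Link σ
        cover {σ} f with ∈ᵛ-or v σ
        ... | inj₁ v∈ = inj₂ (to-Link f v∈)
        ... | inj₂ v∉ = inj₁ (to-Deletion f v∉)
        clash : ∀ {σ} → IsFace R Deletion σ → IsFace (R ∪ ⁅ v ⁆) Link σ → ⊥
        clash {σ} f g = ∈ᵛ-∉ᵛ {σ = σ} (base g v (insert-same R v)) (v∉sub f)
        lower : ∀ {τ w} → IsFace R Deletion (τ ∪ ⁅ w ⁆) → IsFace R P τ → IsFace R Deletion τ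
        lower {τ} f g = to-Deletion g (insert-∉ᵛ τ (v∉sub f))

      apart-Deletion : Apart R Deletion
      apart-Deletion w w∈ = apart w w∈ ∘ remove⊆ (nbhd? (inj₁ v))

      apart-Link : Apart (R ∪ ⁅ v ⁆) Link
      apart-Link w w∈ Pw with insert-elim R w∈
      ... | inj₁ refl = remove-∉ (_≟ inj₁ v) refl Pw
      ... | inj₂ q    = apart w q (remove⊆ (_≟ inj₁ v) Pw)

    module EdgeSplit (R : Subset n) (P : Sub Node) (apart : Apart R P) {e : E} (Pe : inj₂ e ∈ˢ P) where

      Without Inside : Sub Node
      Without = remove P (_≟ inj₂ e)
      Inside  = remove P (nbhd? (inj₂ e))

      e-part : Fin n → Bool
      e-part v = P (inj₁ v) ∧ does (inc? v e)

      R⁺ : Subset n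
      R⁺ = R ∪ tabulate e-part

      e-part⁺ : ∀ {v} → inj₁ v ∈ˢ P → Inc v e → v ∈ᵛ R⁺
      e-part⁺ {v} Pv i = trans (lookup-∪ R _ v) (trans (cong (lookup R v ∨_) (trans (Vecₚ.lookup∘tabulate e-part v) lemma)) (∨-zeroʳ (lookup R v)))
        where
        lemma : e-part v ≡ true
        lemma rewrite holds Pv with inc? v e
        ... | yes _ = refl
        ... | no ¬i = ⊥-elim (¬i i)

      R⁺-mono : ∀ {v} → v ∈ᵛ R → v ∈ᵛ R⁺
      R⁺-mono {v} p = trans (lookup-∪ R _ v) (cong (_∨ lookup (tabulate e-part) v) p)

      R⁺-elim : ∀ {v} → v ∈ᵛ R⁺ → v ∈ᵛ R ⊎ (inj₁ v ∈ˢ P × Inc v e)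
      R⁺-elim {v} p with ∈ᵛ-or v R
      ... | inj₁ v∈ = inj₁ v∈
      ... | inj₂ v∉ = inj₂ (decode (trans (sym (trans (lookup-∪ R _ v) (cong₂ _∨_ v∉ (Vecₚ.lookup∘tabulate e-part v)))) p))
        where
        decode : e-part v ≡ true → inj₁ v ∈ˢ P × Inc v e
        decode q with P (inj₁ v) in pv | inc? v e
        decode q  | true  | yes i = mem pv , i
        decode () | true  | no _
        decode () | false | _

      -- Dropping the condition at `e` enlarges the complex. The new faces are those containing
      -- every vertex of `e` left in `P`; these vertices move to `R⁺`, and the other edges must be
      -- missed elsewhere.
      split : Split (complex R Without) (complex R P) (complex R⁺ Inside)
      split = record { S⊆D = sub ; Q⊆D = quo ; cover = cover ; apart = clash ; lower = lower }
        where
        Misses : Subset n → Set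
        Misses σ = Σ (Fin n) λ v → inj₁ v ∈ˢ P × Inc v e × v ∉ᵛ σ
        misses? : ∀ σ → Dec (Misses σ)
        misses? σ = Finₚ.any? (λ v → ∈ˢ? (inj₁ v) P ×-dec (inc? v e ×-dec (lookup σ v Boolₚ.≟ false)))
        sub : ∀ {σ} → IsFace R P σ → IsFace R Without σ
        sub f = record
          { base = base f
          ; inside = λ w w∈ → Sum.map (λ p → p) (λ Pw → remove⁺ (_≟ inj₂ e) Pw λ ()) (inside f w w∈)
          ; missed = λ e′ e∈ → let (w , Pw , i , w∉) = missed f e′ (remove⊆ (_≟ inj₂ e) e∈) in w , remove⁺ (_≟ inj₂ e) Pw (λ ()) , i , w∉ }
        back-to : ∀ {σ} → IsFace R Without σ → Misses σ → IsFace R P σ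
        back-to {σ} f m = record
          { base = base f
          ; inside = λ w w∈ → Sum.map (λ p → p) (remove⊆ (_≟ inj₂ e)) (inside f w w∈)
          ; missed = missed′ }
          where
          missed′ : ∀ e′ → inj₂ e′ ∈ˢ P → Σ (Fin n) λ w → inj₁ w ∈ˢ P × Inc w e′ × w ∉ᵛ σ
          missed′ e′ Pe′ with e′ ≟ᴱ e
          ... | yes refl = m
          ... | no ne = let (w , Pw , i , w∉) = missed f e′ (remove⁺ (_≟ inj₂ e) Pe′ λ { refl → ne refl }) in w , remove⊆ (_≟ inj₂ e) Pw , i , w∉
        to-Inside : ∀ {σ} → IsFace R Without σ → ¬ Misses σ → IsFace R⁺ Inside σ
        to-Inside {σ} f full = record
          { base = λ w w∈ → case R⁺-elim w∈ of λ { (inj₁ q) → base f w q ; (inj₂ (Pw , i)) → e⊆ Pw i }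
          ; inside = inside′
          ; missed = λ e′ e∈ → let (Pe′ , far) = remove⁻ (nbhd? (inj₂ e)) e∈
                                   (w , Pw , i , w∉) = missed f e′ (remove⁺ (_≟ inj₂ e) Pe′ (far ∘ inj₁))
                               in w , remove⁺ (nbhd? (inj₂ e)) (remove⊆ (_≟ inj₂ e) Pw)
                                    (λ { (inj₁ ()) ; (inj₂ (ve j)) → ∈ᵛ-∉ᵛ {σ = σ} (e⊆ (remove⊆ (_≟ inj₂ e) Pw) j) w∉ }) , i , w∉ }
          where
          e⊆ : ∀ {w} → inj₁ w ∈ˢ P → Inc w e → w ∈ᵛ σ
          e⊆ {w} Pw i = [ (λ q → q) , (λ w∉ → ⊥-elim (full (w , Pw , i , w∉))) ]′ (∈ᵛ-or w σ)
          inside′ : ∀ w → w ∈ᵛ σ → w ∈ᵛ R⁺ ⊎ inj₁ w ∈ˢ Inside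
          inside′ w w∈ with inside f w w∈
          ... | inj₁ q = inj₁ (R⁺-mono q)
          ... | inj₂ Pw with inc? w e
          ...   | yes i = inj₁ (e-part⁺ (remove⊆ (_≟ inj₂ e) Pw) i)
          ...   | no ¬i = inj₂ (remove⁺ (nbhd? (inj₂ e)) (remove⊆ (_≟ inj₂ e) Pw) λ { (inj₁ ()) ; (inj₂ (ve i)) → ¬i i })
        quo : ∀ {σ} → IsFace R⁺ Inside σ → IsFace R Without σ
        quo {σ} f = record
          { base = λ w w∈ → base f w (R⁺-mono w∈)
          ; inside = λ w w∈ → case inside f w w∈ of λ
              { (inj₁ q) → case R⁺-elim q of λ { (inj₁ r) → inj₁ r ; (inj₂ (Pw , _)) → inj₂ (remove⁺ (_≟ inj₂ e) Pw λ ()) }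
              ; (inj₂ Pw) → inj₂ (remove⁺ (_≟ inj₂ e) (remove⊆ (nbhd? (inj₂ e)) Pw) λ ()) }
          ; missed = λ e′ e∈ → let (Pe′ , ne) = remove⁻ (_≟ inj₂ e) e∈
                                   (w , Pw , i , w∉) = missed f e′ (remove⁺ (nbhd? (inj₂ e)) Pe′ λ { (inj₁ p) → ne p ; (inj₂ ()) })
                               in w , remove⁺ (_≟ inj₂ e) (remove⊆ (nbhd? (inj₂ e)) Pw) (λ ()) , i , w∉ }
        cover : ∀ {σ} → IsFace R Without σ → IsFace R P σ ⊎ IsFace R⁺ Inside σ
        cover {σ} f with misses? σ
        ... | yes m = inj₁ (back-to f m)
        ... | no ¬m = inj₂ (to-Inside f ¬m)
        clash : ∀ {σ} → IsFace R P σ → IsFace R⁺ Inside σ → ⊥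
        clash {σ} f g = let (w , Pw , i , w∉) = missed f e Pe in ∈ᵛ-∉ᵛ {σ = σ} (base g w (e-part⁺ Pw i)) w∉
        lower : ∀ {τ w} → IsFace R P (τ ∪ ⁅ w ⁆) → IsFace R Without τ → IsFace R P τ
        lower {τ} f g = back-to g (let (u , Pu , i , u∉) = missed f e Pe in u , Pu , i , insert-∉ᵛ τ u∉)

      apart-Without : Apart R Without
      apart-Without w w∈ = apart w w∈ ∘ remove⊆ (_≟ inj₂ e)

      apart-Inside : Apart R⁺ Inside
      apart-Inside w w∈ Pw with R⁺-elim w∈
      ... | inj₁ q       = apart w q (remove⊆ (nbhd? (inj₂ e)) Pw)
      ... | inj₂ (_ , i) = remove-∉ (nbhd? (inj₂ e)) (inj₂ (ve i)) Pw

    -- Codimension and the rules for acyclic and spherical subgraphs.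

    ground : Subset n → Sub Node → Fin n → Bool
    ground R P v = lookup R v ∨ P (inj₁ v)

    size : Subset n → Sub Node → ℕ
    size R P = countFin (ground R P)

    bool-ext : ∀ {a b : Bool} → (a ≡ true → b ≡ true) → (b ≡ true → a ≡ true) → a ≡ b
    bool-ext {true}  {true}  f g = refl
    bool-ext {true}  {false} f g = sym (f refl)
    bool-ext {false} {true}  f g = g refl
    bool-ext {false} {false} f g = refl

    ground⁻ : ∀ R P {v} → ground R P v ≡ true → v ∈ᵛ R ⊎ inj₁ v ∈ˢ P
    ground⁻ R P {v} p with lookup R v
    ... | true  = inj₁ refl
    ... | false = inj₂ (mem p)

    ground⁺ : ∀ R P {v} → v ∈ᵛ R ⊎ inj₁ v ∈ˢ P → ground R P v ≡ true
    ground⁺ R P {v} (inj₁ q) = cong (_∨ P (inj₁ v)) q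
    ground⁺ R P {v} (inj₂ q) = trans (cong (lookup R v ∨_) (holds q)) (∨-zeroʳ (lookup R v))

    size-cong : ∀ R R′ P P′ → (∀ {v} → v ∈ᵛ R ⊎ inj₁ v ∈ˢ P → v ∈ᵛ R′ ⊎ inj₁ v ∈ˢ P′) →
      (∀ {v} → v ∈ᵛ R′ ⊎ inj₁ v ∈ˢ P′ → v ∈ᵛ R ⊎ inj₁ v ∈ˢ P) → size R P ≡ size R′ P′
    size-cong R R′ P P′ f g = countFin-cong {f = ground R P} {g = ground R′ P′} λ v →
      bool-ext (λ p → ground⁺ R′ P′ {v} (f (ground⁻ R P p))) (λ p → ground⁺ R P {v} (g (ground⁻ R′ P′ p)))

    -- All admissible `R` are taken at once, because the cuts move vertices from `P` into `R`.
    Con : Sub Node → Set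
    Con P = ∀ R → Apart R P → Acyclic (complex R P)

    -- The index k is replaced by the complementary number t, which is the one of the Alexander dual sphere.
    Sph : Sub Node → ℕ → Set
    Sph P t = ∀ R → Apart R P → Σ ℕ λ k → k ℕ.+ t ≡ size R P × SphereAt (complex R P) k

    -- An isolated vertex is the apex of a cone. An isolated edge has no vertex left at which it
    -- could be missed, so there is no face at all.
    isolated : ∀ {P x} → x ∈ˢ P → (∀ y → y ∈ˢ P → ¬ (x ~ y)) → Con P
    isolated {P} {inj₁ v} Pv alone R apart = Cone.acyclic v add drop
      where
      add : ∀ {σ} → IsFace R P σ → IsFace R P (σ ∪ ⁅ v ⁆)
      add {σ} f = record
        { base = λ w w∈ → insert-mono σ (base f w w∈)
        ; inside = λ w w∈ → case insert-elim σ w∈ of λ { (inj₁ refl) → inj₂ Pv ; (inj₂ q) → inside f w q }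
        ; missed = λ e Pe → case missed f e Pe of λ { (w , Pw , i , w∉) →
            w , Pw , i , trans (insert-other σ (λ { refl → alone (inj₂ e) Pe (ve i) })) w∉ } }
      drop : ∀ {τ} → v ∉ᵛ τ → IsFace R P (τ ∪ ⁅ v ⁆) → IsFace R P τ
      drop {τ} v∉ f = record
        { base = λ w w∈ → case insert-elim τ (base f w w∈) of λ { (inj₁ refl) → ⊥-elim (apart w w∈ Pv) ; (inj₂ q) → q }
        ; inside = λ w w∈ → inside f w (insert-mono τ w∈)
        ; missed = λ e Pe → let (w , Pw , i , w∉) = missed f e Pe in w , Pw , i , insert-∉ᵛ τ w∉ }
    isolated {P} {inj₂ e} Pe alone R apart k c (s , _) = zeroC , zero-supported , λ {τ} f → ⊥-elim (empty f)
      where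
      empty : ∀ {τ} → IsFace R P τ → ⊥
      empty f = let (w , Pw , i , _) = missed f e Pe in alone (inj₁ w) Pw (ev i)

    con-step : ∀ {P x} → x ∈ˢ P → Con (remove P (_≟ x)) → Con (remove P (nbhd? x)) → Con P
    con-step {P} {inj₁ v} Pv con con′ R apart = LongExact.acyclic-total split (con′ R apart-Deletion) (con (R ∪ ⁅ v ⁆) apart-Link)
      where open VertexSplit R P apart Pv
    con-step {P} {inj₂ e} Pe con con′ R apart = LongExact.acyclic-sub split (con R apart-Without) (con′ R⁺ apart-Inside)
      where open EdgeSplit R P apart Pe

    sph-delete : ∀ {P x t} → x ∈ˢ P → Sph (remove P (_≟ x)) t → Con (remove P (nbhd? x)) → Sph P t
    sph-delete {P} {inj₁ v} Pv sph con R apart with sph (R ∪ ⁅ v ⁆) (VertexSplit.apart-Link R P apart Pv)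
    ... | k , eq , S = k , trans eq (size-cong (R ∪ ⁅ v ⁆) R Link P fwd bwd) , LongExact.sphere-total-quotient split (con R apart-Deletion) S
      where
      open VertexSplit R P apart Pv
      fwd : ∀ {w} → w ∈ᵛ R ∪ ⁅ v ⁆ ⊎ inj₁ w ∈ˢ Link → w ∈ᵛ R ⊎ inj₁ w ∈ˢ P
      fwd (inj₁ q) = case insert-elim R q of λ { (inj₁ refl) → inj₂ Pv ; (inj₂ r) → inj₁ r }
      fwd (inj₂ q) = inj₂ (remove⊆ (_≟ inj₁ v) q)
      bwd : ∀ {w} → w ∈ᵛ R ⊎ inj₁ w ∈ˢ P → w ∈ᵛ R ∪ ⁅ v ⁆ ⊎ inj₁ w ∈ˢ Link
      bwd (inj₁ q) = inj₁ (insert-mono R q)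
      bwd {w} (inj₂ q) with w Finₚ.≟ v
      ... | yes refl = inj₁ (insert-same R v)
      ... | no w≢v   = inj₂ (remove⁺ (_≟ inj₁ v) q λ { refl → w≢v refl })
    sph-delete {P} {inj₂ e} Pe sph con R apart with sph R (EdgeSplit.apart-Without R P apart Pe)
    ... | k , eq , S = k , trans eq (size-cong R R Without P (Sum.map (λ q → q) (remove⊆ (_≟ inj₂ e))) (Sum.map (λ q → q) (λ q → remove⁺ (_≟ inj₂ e) q λ ())))
                     , LongExact.sphere-sub-total split (con R⁺ apart-Inside) S
      where open EdgeSplit R P apart Pe

    -- For a vertex node the index stays while `v` leaves the ground set; for an edge node the
    -- ground set stays while the connecting map lowers the index. Both raise the codimension by
    -- one.
    sph-link : ∀ {P x t} → x ∈ˢ P → Con (remove P (_≟ x)) → Sph (remove P (nbhd? x)) t → Sph P (suc t)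
    sph-link {P} {inj₁ v} {t} Pv con sph R apart with sph R (VertexSplit.apart-Deletion R P apart Pv)
    ... | k , eq , S = k , trans (ℕₚ.+-suc k t) (trans (cong suc eq) (sym larger)) , LongExact.sphere-total-sub split (con (R ∪ ⁅ v ⁆) apart-Link) S
      where
      open VertexSplit R P apart Pv
      larger : size R P ≡ suc (size R Deletion)
      larger = trans (countFin-insert (ground R Deletion) (ground R P) v same gone)
        (cong (λ b → (if b then 1 else 0) ℕ.+ size R Deletion) (ground⁺ R P (inj₂ Pv)))
        where
        same : ∀ w → w ≢ v → ground R P w ≡ ground R Deletion w
        same w w≢v = bool-ext
          (λ p → ground⁺ R Deletion (Sum.map (λ q → q) (λ q → remove⁺ (nbhd? (inj₁ v)) q λ { (inj₁ refl) → w≢v refl ; (inj₂ ()) }) (ground⁻ R P p)))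
          (λ p → ground⁺ R P (Sum.map (λ q → q) (remove⊆ (nbhd? (inj₁ v))) (ground⁻ R Deletion p)))
        gone : ground R Deletion v ≡ false
        gone = Boolₚ.¬-not λ p → [ (λ q → apart v q Pv) , remove-∉ (nbhd? (inj₁ v)) (inj₁ refl) ]′ (ground⁻ R Deletion p)
    sph-link {P} {inj₂ e} {t} Pe con sph R apart with sph (EdgeSplit.R⁺ R P apart Pe) (EdgeSplit.apart-Inside R P apart Pe)
    ... | k , eq , S with LongExact.sphere-sub-quotient (EdgeSplit.split R P apart Pe) (con R (EdgeSplit.apart-Without R P apart Pe)) S
    ...   | l , refl , S′ = l , trans (ℕₚ.+-suc l t) (trans eq (size-cong R⁺ R Inside P fwd bwd)) , S′
      where
      open EdgeSplit R P apart Pe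
      fwd : ∀ {w} → w ∈ᵛ R⁺ ⊎ inj₁ w ∈ˢ Inside → w ∈ᵛ R ⊎ inj₁ w ∈ˢ P
      fwd (inj₁ q) = Sum.map (λ r → r) proj₁ (R⁺-elim q)
      fwd (inj₂ q) = inj₂ (remove⊆ (nbhd? (inj₂ e)) q)
      bwd : ∀ {w} → w ∈ᵛ R ⊎ inj₁ w ∈ˢ P → w ∈ᵛ R⁺ ⊎ inj₁ w ∈ˢ Inside
      bwd (inj₁ q) = inj₁ (R⁺-mono q)
      bwd {w} (inj₂ q) with inc? w e
      ... | yes i = inj₁ (e-part⁺ q i)
      ... | no ¬i = inj₂ (remove⁺ (nbhd? (inj₂ e)) q λ { (inj₁ ()) ; (inj₂ (ve i)) → ¬i i })

    -- The only face is `R`, so the homology is ℤ in index `∣ R ∣`, which is also the size of the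
    -- ground set.
    sph-empty : ∀ {P} → (∀ x → x ∉ˢ P) → Sph P 0
    sph-empty {P} none R apart = ∣ R ∣ , trans (ℕₚ.+-identityʳ ∣ R ∣) (trans (∣∣-countFin R) (countFin-cong {g = ground R P} λ v →
        bool-ext (λ p → ground⁺ R P {v} (inj₁ p)) (λ p → [ (λ q → q) , (λ q → ⊥-elim (none _ q)) ]′ (ground⁻ R P p))))
      , (point , (point-supported , λ {τ} f → ∂-zero point τ λ v v∉ → point-off (λ eq → insert-≢ eq v∉ f)) , generated , free) , vanishing
      where
      face-R : IsFace R P R
      face-R = record { base = λ _ p → p ; inside = λ _ p → inj₁ p ; missed = λ e Pe → ⊥-elim (none _ Pe) }
      only-R : ∀ {σ} → IsFace R P σ → σ ≡ R
      only-R {σ} f = lookup-ext λ v → bool-ext (λ p → [ (λ q → q) , (λ q → ⊥-elim (none _ q)) ]′ (inside f v p)) (base f v)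
      insert-≢ : ∀ {τ v} → τ ∪ ⁅ v ⁆ ≡ R → v ∉ᵛ τ → IsFace R P τ → ⊥
      insert-≢ {τ} {v} eq v∉ f = ∈ᵛ-∉ᵛ {σ = τ} (subst (v ∈ᵛ_) (trans eq (sym (only-R f))) (insert-same τ v)) v∉
      point : Chain n
      point = restrict (complex R P) (λ _ → + 1)
      point-off : ∀ {σ} → σ ≢ R → point σ ≡ +0
      point-off ne = restrict-∉ (complex R P) (λ _ → + 1) (ne ∘ only-R)
      point-at : point R ≡ + 1
      point-at = restrict-∈ (complex R P) (λ _ → + 1) face-R
      point-supported : Supported (complex R P) ∣ R ∣ point
      point-supported .support σ ne with restrict-nonzero (complex R P) (λ _ → + 1) ne
      ... | f , _ = f , cong ∣_∣ (only-R f)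
      no-chain : ∀ {k d} → k ≢ ∣ R ∣ → Supported (complex R P) k d → ∀ σ → d σ ≡ +0
      no-chain {d = d} k≢ s σ = decidable-stable (d σ ℤₚ.≟ +0) λ ne → let (f , len) = support s σ ne in k≢ (trans (sym len) (cong ∣_∣ (only-R f)))
      zero-boundary : ∀ {k c} → (∀ σ → c σ ≡ +0) → RelativeBoundary (complex R P) k c
      zero-boundary z = zeroC , zero-supported , λ {τ} _ → trans (∂-zero zeroC τ λ _ _ → refl) (sym (z τ))
      generated : ∀ c → RelativeCycle (complex R P) ∣ R ∣ c → Σ ℤ λ a → RelativeBoundary (complex R P) ∣ R ∣ (c -ᶜ a *ᶜ point)
      generated c (s , _) = c R , zero-boundary pointwise
        where
        at-face : ∀ {σ} → Dec (IsFace R P σ) → (c -ᶜ c R *ᶜ point) σ ≡ +0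
        at-face (no ¬f) = cong₂ _-_ (supported-∉ s ¬f) (trans (cong (c R *_) (restrict-∉ (complex R P) (λ _ → + 1) ¬f)) (ℤₚ.*-zeroʳ (c R)))
        at-face (yes f) with only-R f
        ... | refl = trans (cong (λ x → c R - c R * x) point-at) (trans (cong (_-_ (c R)) (ℤₚ.*-identityʳ (c R))) (ℤₚ.+-inverseʳ (c R)))
        pointwise : ∀ σ → (c -ᶜ c R *ᶜ point) σ ≡ +0
        pointwise σ = at-face (isFace? R P σ)
      free : ∀ a → RelativeBoundary (complex R P) ∣ R ∣ (a *ᶜ point) → a ≡ +0
      free a (d , s , bd) = trans (sym (trans (cong (a *_) point-at) (ℤₚ.*-identityʳ a)))
        (trans (sym (bd face-R)) (∂-zero d R λ _ _ → no-chain (ℕₚ.m≢1+m+n ∣ R ∣ ∘ sym ∘ trans (cong suc (ℕₚ.+-identityʳ ∣ R ∣))) s _))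
      vanishing : ∀ j → j ≢ ∣ R ∣ → Vanishes (complex R P) j
      vanishing j j≢ c (s , _) = zero-boundary (no-chain j≢ s)

    apart-∅ : ∀ {P} → Apart ∅ P
    apart-∅ v v∈ _ = Subsetₚ.∉⊥ (Vecₚ.lookup⇒[]= v ∅ v∈)

    sph-unique : ∀ {P s t} → Sph P s → Sph P t → s ≡ t
    sph-unique S T with S ∅ apart-∅ | T ∅ apart-∅
    ... | k , eq , C | l , eq′ , C′ with sphere-index-unique C C′
    ...   | refl = ℕₚ.+-cancelˡ-≡ k _ _ (trans eq (sym eq′))

    con-sph : ∀ {P t} → Con P → ¬ Sph P t
    con-sph con S = let (k , _ , C) = S ∅ apart-∅ in acyclic-not-sphere (con ∅ apart-∅) C

-- Back to the hypergraph: Berge cycles, homology and domination.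

module Domination where

  open import Data.Bool.Properties using (∨-zeroʳ)
  import Data.Bool.Properties as Boolₚ
  open import Data.Nat as ℕ using (zero; suc; _≤_; s≤s; _%_)
  import Data.Nat.Properties as ℕₚ
  open import Data.Nat.DivMod using (m<n⇒m%n≡m; n%n≡0; m≡m%n+[m/n]*n; m%n<n)
  open import Data.Nat.Divisibility using (_∣_; divides)
  open import Data.Integer using (+_; _*_; +0)
  open import Data.List using (List; []; _∷_; _++_; length; map; allFin)
  open import Data.List.Properties using (length-++; length-map)
  open import Data.List.Membership.Propositional using (_∈_)
  open import Data.List.Membership.Propositional.Properties using (∈-++⁺ˡ; ∈-++⁺ʳ; ∈-map⁺; ∈-map⁻; ∈-allFin)
  open import Data.List.Relation.Unary.Any using (here; there)
  open import Data.List.Relation.Unary.All using (All; []; _∷_)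
  import Data.List.Relation.Unary.All as All
  open import Data.List.Relation.Unary.AllPairs using (AllPairs; []; _∷_)
  import Data.List.Relation.Unary.AllPairs as AllPairs
  import Data.List.Relation.Unary.AllPairs.Properties as AllPairsₚ
  open import Data.List.Relation.Unary.Unique.Propositional using (Unique)
  import Data.List.Relation.Unary.Unique.Propositional.Properties as Uniq
  open import Data.Fin as Fin using (Fin; toℕ; fromℕ; inject₁)
  import Data.Fin.Properties as Finₚ
  open import Data.Fin.Relation.Unary.Top using (view; ‵fromℕ; ‵inj₁)
  open import Data.Fin.Subset using (Subset; _∪_; _∩_; ⁅_⁆; ∣_∣; _⊆_; ∁) renaming (⊥ to ∅; _∈_ to _∈ₛ_; _∉_ to _∉ₛ_)
  import Data.Fin.Subset.Properties as Subsetₚ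
  open import Data.Vec using (lookup; []; _∷_)
  import Data.Vec.Properties as Vecₚ
  open Walks
  open Matchings
  open ChainAlgebra
  open RelativeHomology
  open IncidenceComplex

  allSubset? : ∀ {n} {Q : Subset n → Set} → (∀ e → Dec (Q e)) → Dec (∀ e → Q e)
  allSubset? Q? = map′ (λ none e → decidable-stable (Q? e) λ ¬q → none (e , ¬q)) (λ all (e , ¬q) → ¬q (all e)) (¬? (Subsetₚ.anySubset? (¬? ∘ Q?)))

  subsets : ∀ n → List (Subset n)
  subsets zero    = [] ∷ []
  subsets (suc n) = map (true ∷_) (subsets n) ++ map (false ∷_) (subsets n)

  ∈-subsets : ∀ {n} (σ : Subset n) → σ ∈ subsets n
  ∈-subsets []          = here refl
  ∈-subsets (true ∷ σ)  = ∈-++⁺ˡ (∈-map⁺ (true ∷_) (∈-subsets σ))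
  ∈-subsets (false ∷ σ) = ∈-++⁺ʳ (map (true ∷_) (subsets _)) (∈-map⁺ (false ∷_) (∈-subsets σ))

  elements : ∀ {n} → Subset n → List (Fin n)
  elements []          = []
  elements (true ∷ σ)  = Fin.zero ∷ map Fin.suc (elements σ)
  elements (false ∷ σ) = map Fin.suc (elements σ)

  length-elements : ∀ {n} (σ : Subset n) → length (elements σ) ≡ ∣ σ ∣
  length-elements []          = refl
  length-elements (true ∷ σ)  = cong suc (trans (length-map Fin.suc (elements σ)) (length-elements σ))
  length-elements (false ∷ σ) = trans (length-map Fin.suc (elements σ)) (length-elements σ)

  ∈-elements : ∀ {n} (σ : Subset n) {v} → v ∈ elements σ → v ∈ᵛ σ
  ∈-elements (true ∷ σ) (here refl) = refl
  ∈-elements (true ∷ σ) (there v∈) with ∈-map⁻ Fin.suc v∈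
  ... | w , w∈ , refl = ∈-elements σ w∈
  ∈-elements (false ∷ σ) v∈ with ∈-map⁻ Fin.suc v∈
  ... | w , w∈ , refl = ∈-elements σ w∈

  elements-unique : ∀ {n} (σ : Subset n) → Unique (elements σ)
  elements-unique []          = []
  elements-unique (true ∷ σ)  = unique-∷ (λ z∈ → case ∈-map⁻ Fin.suc z∈ of λ ()) (Uniq.map⁺ Finₚ.suc-injective (elements-unique σ))
  elements-unique (false ∷ σ) = Uniq.map⁺ Finₚ.suc-injective (elements-unique σ)

  next-inject₁ : ∀ m (j : Fin (suc m)) → next m (inject₁ j) ≡ Fin.suc j
  next-inject₁ m j = Finₚ.toℕ-injective (begin
    toℕ (next m (inject₁ j))                     ≡⟨ Finₚ.toℕ-fromℕ< (m%n<n (suc (toℕ (inject₁ j))) (2 ℕ.+ m)) ⟩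
    suc (toℕ (inject₁ j)) % (2 ℕ.+ m)            ≡⟨ cong (λ i → suc i % (2 ℕ.+ m)) (Finₚ.toℕ-inject₁ j) ⟩
    suc (toℕ j) % (2 ℕ.+ m)                      ≡⟨ m<n⇒m%n≡m (s≤s (Finₚ.toℕ<n j)) ⟩
    suc (toℕ j) ∎)
    where open ≡-Reasoning

  next-fromℕ : ∀ m → next m (fromℕ (suc m)) ≡ Fin.zero
  next-fromℕ m = Finₚ.toℕ-injective (begin
    toℕ (next m (fromℕ (suc m)))                 ≡⟨ Finₚ.toℕ-fromℕ< (m%n<n (suc (toℕ (fromℕ (suc m)))) (2 ℕ.+ m)) ⟩
    suc (toℕ (fromℕ (suc m))) % (2 ℕ.+ m)        ≡⟨ cong (λ i → suc i % (2 ℕ.+ m)) (Finₚ.toℕ-fromℕ (suc m)) ⟩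
    (2 ℕ.+ m) % (2 ℕ.+ m)                        ≡⟨ n%n≡0 (2 ℕ.+ m) ⟩
    0 ∎)
    where open ≡-Reasoning

  -- A Berge cycle of length `2 + m` has `4 + 2m` nodes in the incidence graph, and walks count all
  -- but the start. Remainder 2 means that 3 divides `m`, and then it divides `3 + 2m`.
  berge-residue : ∀ m → suc (suc m) % 3 ≡ 2 → 3 ∣ suc (suc m ℕ.+ suc m)
  berge-residue m r = divides (1 ℕ.+ (q ℕ.+ q)) (begin
    suc (suc m ℕ.+ suc m)            ≡⟨ cong (suc ∘ suc) (ℕₚ.+-suc m m) ⟩
    3 ℕ.+ (m ℕ.+ m)                  ≡⟨ cong (λ k → 3 ℕ.+ (k ℕ.+ k)) m≡3q ⟩
    3 ℕ.+ (q ℕ.* 3 ℕ.+ q ℕ.* 3)      ≡⟨ cong (3 ℕ.+_) (sym (ℕₚ.*-distribʳ-+ 3 q q)) ⟩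
    3 ℕ.+ (q ℕ.+ q) ℕ.* 3 ∎)
    where
    open ≡-Reasoning
    q : ℕ
    q = suc (suc m) ℕ./ 3
    m≡3q : m ≡ q ℕ.* 3
    m≡3q = ℕₚ.suc-injective (ℕₚ.suc-injective (trans (m≡m%n+[m/n]*n (suc (suc m)) 3) (cong (ℕ._+ q ℕ.* 3) r)))

  module _ {n : ℕ} (H : Hypergraph n) where

    IncidentEdge : Fin n → Subset n → Set
    IncidentEdge v e = v ∈ₛ e × isEdge H e ≡ true

    incidentEdge? : ∀ v e → Dec (IncidentEdge v e)
    incidentEdge? v e = (v Subsetₚ.∈? e) ×-dec (isEdge H e Boolₚ.≟ true)

    open Incidence n (Subset n) (Vecₚ.≡-dec Boolₚ._≟_) allSubset? IncidentEdge incidentEdge?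

    nodes : List Node
    nodes = map inj₁ (allFin n) ++ map inj₂ (subsets n)

    ∈-nodes : ∀ x → x ∈ nodes
    ∈-nodes (inj₁ v) = ∈-++⁺ˡ (∈-map⁺ inj₁ (∈-allFin v))
    ∈-nodes (inj₂ e) = ∈-++⁺ʳ (map inj₁ (allFin n)) (∈-map⁺ inj₂ (∈-subsets e))

    -- A walk of `2K + 1` steps taken apart into `K + 1` vertices and `K + 1` edges, indexed as in
    -- `BergeCycle`; only the closing incidence is still to come.
    record Alternation (v : Fin n) (xs : List Node) (e : Subset n) : Set where
      field
        K       : ℕ
        vtx     : Fin (suc K) → Fin n
        edg     : Fin (suc K) → Subset n
        start   : vtx Fin.zero ≡ v
        finish  : edg (fromℕ K) ≡ e
        at      : ∀ i → IncidentEdge (vtx i) (edg i)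
        step    : ∀ (i : Fin K) → IncidentEdge (vtx (Fin.suc i)) (edg (inject₁ i))
        len     : length xs ≡ suc (K ℕ.+ K)
        vtx∈    : ∀ i → inj₁ (vtx i) ∈ inj₁ v ∷ xs
        edg∈    : ∀ i → inj₂ (edg i) ∈ xs
        vtx-inj : Unique (inj₁ v ∷ xs) → ∀ {i j} → vtx i ≡ vtx j → i ≡ j
        edg-inj : Unique (inj₁ v ∷ xs) → ∀ {i j} → edg i ≡ edg j → i ≡ j

    alternation : ∀ {v xs e} → Walk _~_ (inj₁ v) xs (inj₂ e) → Alternation v xs e
    alternation {v} (ve {e = e} i ∷ []) = record
      { K = 0 ; vtx = λ _ → v ; edg = λ _ → e ; start = refl ; finish = refl ; at = λ _ → i ; step = λ ()
      ; len = refl ; vtx∈ = λ _ → here refl ; edg∈ = λ _ → here refl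
      ; vtx-inj = λ { _ {Fin.zero} {Fin.zero} _ → refl } ; edg-inj = λ { _ {Fin.zero} {Fin.zero} _ → refl } }
    alternation {v} (ve {e = e} i ∷ ev {v = w} j ∷ walk) = record
      { K = suc A.K
      ; vtx = λ { Fin.zero → v ; (Fin.suc k) → A.vtx k }
      ; edg = λ { Fin.zero → e ; (Fin.suc k) → A.edg k }
      ; start = refl ; finish = A.finish
      ; at = λ { Fin.zero → i ; (Fin.suc k) → A.at k }
      ; step = λ { Fin.zero → subst (λ u → IncidentEdge u e) (sym A.start) j ; (Fin.suc k) → A.step k }
      ; len = cong (suc ∘ suc) (trans A.len (sym (ℕₚ.+-suc A.K A.K)))
      ; vtx∈ = λ { Fin.zero → here refl ; (Fin.suc k) → there (there (A.vtx∈ k)) }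
      ; edg∈ = λ { Fin.zero → here refl ; (Fin.suc k) → there (there (A.edg∈ k)) }
      ; vtx-inj = λ { u {Fin.zero} {Fin.zero} _ → refl
                    ; u {Fin.zero} {Fin.suc k} p → ⊥-elim (unique-∉ u (there (subst (λ z → inj₁ z ∈ _) (sym p) (A.vtx∈ k))))
                    ; u {Fin.suc k} {Fin.zero} p → ⊥-elim (unique-∉ u (there (subst (λ z → inj₁ z ∈ _) p (A.vtx∈ k))))
                    ; u {Fin.suc k} {Fin.suc l} p → cong Fin.suc (A.vtx-inj (unique-tail (unique-tail u)) p) }
      ; edg-inj = λ { u {Fin.zero} {Fin.zero} _ → refl
                    ; u {Fin.zero} {Fin.suc k} p → ⊥-elim (unique-∉ (unique-tail u) (there (subst (λ z → inj₂ z ∈ _) (sym p) (A.edg∈ k))))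
                    ; u {Fin.suc k} {Fin.zero} p → ⊥-elim (unique-∉ (unique-tail u) (there (subst (λ z → inj₂ z ∈ _) p (A.edg∈ k))))
                    ; u {Fin.suc k} {Fin.suc l} p → cong Fin.suc (A.edg-inj (unique-tail (unique-tail u)) p) } }
      where module A = Alternation (alternation walk)

    module _ (noBerge : NoBerge01mod3 H) where

      cycle-from-vertex : ∀ {v xs e} → Walk _~_ (inj₁ v) xs (inj₂ e) → Unique (inj₁ v ∷ xs) → IncidentEdge v e → 2 ≤ length xs → 3 ∣ length xs
      cycle-from-vertex {v} {xs} {e} walk uniq close len≥2 with alternation walk
      ... | record { K = zero ; len = len } = case subst (2 ≤_) len len≥2 of λ { (s≤s ()) }
      ... | record { K = suc m ; vtx = vtx ; edg = edg ; start = start ; finish = finish ; at = at ; step = step ; len = len ; vtx-inj = vtx-inj ; edg-inj = edg-inj } =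
        subst (3 ∣_) (sym len) (berge-residue m (noBerge m record
          { vtx = vtx ; edg = edg ; vtx-inj = vtx-inj uniq ; edg-inj = edg-inj uniq
          ; edg-in-H = proj₂ ∘ at ; vtx-here = proj₁ ∘ at ; vtx-next = vtx-next }))
        where
        vtx-next : ∀ i → vtx (next m i) ∈ₛ edg i
        vtx-next i with view i
        -- `next` wraps around at the last index only, and there the closing edge of the cycle
        -- supplies the incidence.
        ... | ‵fromℕ rewrite next-fromℕ m | start | finish = proj₁ close
        ... | ‵inj₁ {i = j} _ rewrite next-inject₁ m j = proj₁ (step j)

      cycle-length : ∀ {x xs y} → Walk _~_ x xs y → Unique (x ∷ xs) → y ~ x → 2 ≤ length xs → 3 ∣ length xs
      cycle-length walk uniq (ev i) len≥2 = cycle-from-vertex walk uniq i len≥2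
      -- A cycle starting at an edge node is rotated by one place: its first node moves to the end
      -- of the walk.
      cycle-length {inj₂ e} {_ ∷ ys} (ev {v = v} i ∷ walk) uniq (ve j) len≥2 =
        subst (3 ∣_) length-eq (cycle-from-vertex (walk ++ʷ (ve j ∷ [])) (unique-++ (unique-tail uniq) ([] ∷ []) (λ { z∈ (here refl) → unique-∉ uniq z∈ })) i
          (subst (2 ≤_) (sym length-eq) len≥2))
        where
        length-eq : length (ys ++ inj₂ e ∷ []) ≡ suc (length ys)
        length-eq = trans (length-++ ys) (ℕₚ.+-comm (length ys) 1)

      open Classification Node _≟_ nodes ∈-nodes _~_ _~?_ ~-sym ~-irrefl cycle-length Con Sph isolated con-step sph-delete sph-link sph-empty sph-unique con-sph

      -- Every subset of vertices is a node of the ambient graph; those that are not edges of `H`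
      -- are left out here.
      whole : Sub Node
      whole (inj₁ v) = true
      whole (inj₂ e) = isEdge H e

      -- Comparison with the homology of the independence complex.

      independence : Family n
      independence = complex ∅ whole

      face⇒independent : ∀ {σ} → IsFace ∅ whole σ → Independent H σ
      face⇒independent {σ} f e edge e⊆σ = let (v , _ , (v∈e , _) , v∉σ) = IsFace.missed f e (mem edge) in
        ∈ᵛ-∉ᵛ {σ = σ} (Vecₚ.[]=⇒lookup (e⊆σ v∈e)) v∉σ

      independent⇒face : ∀ {σ} → Independent H σ → IsFace ∅ whole σ
      independent⇒face {σ} ind = record
        { base = λ v v∈ → ⊥-elim (Subsetₚ.∉⊥ (Vecₚ.lookup⇒[]= v ∅ v∈))
        ; inside = λ v _ → inj₂ (mem refl)
        ; missed = λ e (mem edge) → decidable-stable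
            (Finₚ.any? (λ v → ∈ˢ? (inj₁ v) whole ×-dec (incidentEdge? v e ×-dec (lookup σ v Boolₚ.≟ false))))
            λ none → ind e edge λ {v} v∈e → Vecₚ.lookup⇒[]= v σ
              (Boolₚ.¬-not λ v∉σ → none (v , mem refl , (v∈e , edge) , v∉σ)) }

      chain⇒supported : ∀ {k c} → IsChain H k c → Supported independence k c
      chain⇒supported ch .support σ ne = let (ind , len) = ch σ ne in independent⇒face ind , len

      supported⇒chain : ∀ {k c} → Supported independence k c → IsChain H k c
      supported⇒chain s σ ne = let (f , len) = support s σ ne in face⇒independent f , len

      -- Subsets of independent sets are independent, so `∂` never meets a face above a non-face.
      -- This makes the relative conditions, tested at faces only, equivalent to the absolute ones.
      ∂-off : ∀ {k c τ} → Supported independence k c → ¬ IsFace ∅ whole τ → ∂ c τ ≡ +0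
      ∂-off {c = c} {τ} s ¬f = ∂-zero c τ λ v _ → supported-∉ s λ f → ¬f (independent⇒face λ e edge e⊆τ →
        face⇒independent f e edge (Subsetₚ.p⊆p∪q ⁅ v ⁆ ∘ e⊆τ))

      cycle⇒relative : ∀ {k c} → IsCycle H k c → RelativeCycle independence k c
      cycle⇒relative (ch , closed) = chain⇒supported ch , λ {τ} _ → closed τ

      relative⇒cycle : ∀ {k c} → RelativeCycle independence k c → IsCycle H k c
      relative⇒cycle {c = c} (s , closed) = supported⇒chain s , λ τ → at τ (isFace? ∅ whole τ)
        where
        at : ∀ τ → Dec (IsFace ∅ whole τ) → ∂ c τ ≡ +0
        at τ (yes f) = closed f
        at τ (no ¬f) = ∂-off s ¬f

      boundary⇒relative : ∀ {k c} → IsBoundary H k c → RelativeBoundary independence k c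
      boundary⇒relative (d , ch , eq) = d , chain⇒supported ch , λ {τ} _ → eq τ

      relative⇒boundary : ∀ {k c} → Supported independence k c → RelativeBoundary independence k c → IsBoundary H k c
      relative⇒boundary {c = c} s (d , sd , eq) = d , supported⇒chain sd , λ τ → at τ (isFace? ∅ whole τ)
        where
        at : ∀ τ → Dec (IsFace ∅ whole τ) → ∂ d τ ≡ c τ
        at τ (yes f) = eq f
        at τ (no ¬f) = trans (∂-off sd ¬f) (sym (supported-∉ s ¬f))

      vanishes : ∀ {k} → Vanishes independence k → HomologyVanishes H k
      vanishes van c cyc = relative⇒boundary (proj₁ (cycle⇒relative cyc)) (van c (cycle⇒relative cyc))

      infinite-cyclic : ∀ {k} → IsInfiniteCyclic independence k → HomologyIsℤ H k
      infinite-cyclic (z , zc , gen , free) = z , relative⇒cycle zc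
        , (λ c cyc → let (a , bd) = gen c (cycle⇒relative cyc) in
             a , relative⇒boundary (supported-minus (proj₁ (cycle⇒relative cyc)) (supported-scale a (proj₁ zc))) bd)
        , λ a bd → free a (boundary⇒relative bd)

      size-whole : size ∅ whole ≡ n
      size-whole = trans (countFin-cong {f = ground ∅ whole} {g = λ _ → true} (λ v → ∨-zeroʳ (lookup ∅ v))) (countFin-true n)
        where
        countFin-true : ∀ k → countFin {k} (λ _ → true) ≡ k
        countFin-true zero    = refl
        countFin-true (suc k) = cong suc (countFin-true k)

      -- Induced matchings and dominating sets.

      vertexOf : ∀ {a b : Node} → a ~ b → Fin n
      vertexOf (ve {v = v} _) = v
      vertexOf (ev {v = v} _) = v

      record Matched (M : List (Node × Node)) : Set where
        field
          S      : Subset n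
          card   : ∣ S ∣ ≡ length M
          only   : ∀ {v} → v ∈ᵛ S → Σ (Node × Node) λ e → e ∈ M × inj₁ v ∈ᵉ e

      open InducedMatching

      tail-matching : ∀ {P e M} → InducedMatching P (e ∷ M) → InducedMatching P M
      tail-matching I = record { edges = edges I ∘ there ; separate = AllPairs.tail (separate I) }

      matched : ∀ {M} → InducedMatching whole M → Matched M
      matched {[]} I = record { S = ∅ ; card = Subsetₚ.∣⊥∣≡0 n ; only = λ {v} v∈ → ⊥-elim (Subsetₚ.∉⊥ (Vecₚ.lookup⇒[]= v ∅ v∈)) }
      matched {(a , b) ∷ M} I = record
        { S = R.S ∪ ⁅ v ⁆
        ; card = trans (∣insert∣ R.S new) (cong suc R.card)
        ; only = λ w∈ → case insert-elim R.S w∈ of λ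
            { (inj₁ refl) → (a , b) , here refl , v∈e a~b
            ; (inj₂ q) → let (e , e∈ , w∈e) = R.only q in e , there e∈ , w∈e } }
        where
        module R = Matched (matched (tail-matching I))
        a~b : a ~ b
        a~b = proj₂ (proj₂ (edges I (here refl)))
        v : Fin n
        v = vertexOf a~b
        v∈e : ∀ {a b} (p : a ~ b) → inj₁ (vertexOf p) ∈ᵉ (a , b)
        v∈e (ve _) = inj₁ refl
        v∈e (ev _) = inj₂ refl
        other : ∀ {a b} (p : a ~ b) → Σ Node λ y → y ∈ᵉ (a , b) × y ~ inj₁ (vertexOf p)
        other (ve i) = _ , inj₂ refl , ev i
        other (ev i) = _ , inj₁ refl , ev i
        new : v ∉ᵛ R.S
        new = ∉ᵛ-intro {σ = R.S} λ v∈ → let (e , e∈ , v∈e′) = R.only v∈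
                                            (y , y∈ , y~v) = other a~b
                                        in All.lookup (AllPairs.head (separate I)) e∈ y∈ v∈e′ y~v

      -- Let `v` in `S` be matched to the edge `e`. Another vertex of `e` in `S` would lie in a
      -- different matching pair and be adjacent to `e`, against inducedness. So the rest of `e`
      -- lies in the complement of `S` and dominates `v`.
      dominating-from-matching : ∀ {M} → InducedMatching whole M → Σ (Subset n) λ W → IsDominating H W × ∣ W ∣ ≡ n ℕ.∸ length M
      dominating-from-matching {M} I = ∁ S , dominating , trans (Subsetₚ.∣∁p∣≡n∸∣p∣ S) (cong (n ℕ.∸_) card)
        where
        open Matched (matched I)
        split-edge : ∀ {v e} → v ∈ₛ e → ⁅ v ⁆ ∪ (e ∩ ∁ ⁅ v ⁆) ≡ e
        split-edge {v} {e} v∈e = Subsetₚ.⊆-antisym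
          (λ x∈ → case Subsetₚ.x∈p∪q⁻ ⁅ v ⁆ (e ∩ ∁ ⁅ v ⁆) x∈ of λ
            { (inj₁ q) → subst (_∈ₛ e) (sym (Subsetₚ.x∈⁅y⁆⇒x≡y v q)) v∈e ; (inj₂ q) → Subsetₚ.p∩q⊆p e (∁ ⁅ v ⁆) q })
          (λ {x} x∈ → Subsetₚ.x∈p∪q⁺ {p = ⁅ v ⁆} (case x Finₚ.≟ v of λ
            { (yes refl) → inj₁ (Subsetₚ.x∈⁅x⁆ v) ; (no x≢v) → inj₂ (Subsetₚ.x∈p∩q⁺ (x∈ , Subsetₚ.x∉p⇒x∈∁p (x≢v ∘ Subsetₚ.x∈⁅y⁆⇒x≡y v))) }))
        by-pair : ∀ {v m} → m ∈ M → inj₁ v ∈ᵉ m → Dominates H (∁ S) v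
        by-edge : ∀ {v e m} → m ∈ M → inj₁ v ∈ᵉ m → inj₂ e ∈ᵉ m → IncidentEdge v e → Dominates H (∁ S) v
        by-edge {v} {e} {m} m∈ v∈m e∈m (v∈e , edge) = inj₂ (e ∩ ∁ ⁅ v ⁆ , private-part , subst (λ f → isEdge H f ≡ true) (sym (split-edge v∈e)) edge)
          where
          private-part : e ∩ ∁ ⁅ v ⁆ ⊆ ∁ S
          private-part {x} x∈ = Subsetₚ.x∉p⇒x∈∁p λ x∈S → clash (only (Vecₚ.[]=⇒lookup x∈S))
            where
            x∈e : x ∈ₛ e
            x∈e = Subsetₚ.p∩q⊆p e (∁ ⁅ v ⁆) x∈
            x≢v : x ≢ v
            x≢v refl = Subsetₚ.x∈∁p⇒x∉p (proj₂ (Subsetₚ.x∈p∩q⁻ e (∁ ⁅ v ⁆) x∈)) (Subsetₚ.x∈⁅x⁆ v)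
            both : ∀ {m} → inj₁ v ∈ᵉ m → inj₁ x ∈ᵉ m → inj₂ e ∈ᵉ m → ⊥
            both (inj₁ refl) (inj₁ refl) _           = x≢v refl
            both (inj₂ refl) (inj₂ refl) _           = x≢v refl
            both (inj₁ refl) (inj₂ refl) (inj₁ ())
            both (inj₁ refl) (inj₂ refl) (inj₂ ())
            both (inj₂ refl) (inj₁ refl) (inj₁ ())
            both (inj₂ refl) (inj₁ refl) (inj₂ ())
            clash : (Σ (Node × Node) λ m′ → m′ ∈ M × inj₁ x ∈ᵉ m′) → ⊥
            clash (m′ , m′∈ , x∈m′) with equal-or-separate (separate I) m∈ m′∈
            ... | inj₁ refl = both v∈m x∈m′ e∈m
            ... | inj₂ s    = s e∈m x∈m′ (ev (x∈e , edge))
        by-pair {v} {a , b} m∈ v∈m with proj₂ (proj₂ (edges I m∈))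
        by-pair m∈ (inj₁ refl) | ve i = by-edge m∈ (inj₁ refl) (inj₂ refl) i
        by-pair m∈ (inj₂ refl) | ev i = by-edge m∈ (inj₂ refl) (inj₁ refl) i
        dominating : IsDominating H (∁ S)
        dominating v with ∈ᵛ-or v S
        ... | inj₂ v∉ = inj₁ (Subsetₚ.x∉p⇒x∈∁p λ v∈ → ∈ᵛ-∉ᵛ {σ = S} (Vecₚ.[]=⇒lookup v∈) v∉)
        ... | inj₁ v∈ = let (m , m∈ , v∈m) = only v∈ in by-pair m∈ v∈m

      -- A vertex outside `W` is dominated through an edge whose other vertices lie in `W`. This
      -- edge contains no second vertex outside `W`, so the pairs obtained are separate.
      matching-from-dominating : ∀ W → IsDominating H W → Σ (List (Node × Node)) λ M → InducedMatching whole M × length M ≡ n ℕ.∸ ∣ W ∣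
      matching-from-dominating W dom = map pair (elements (∁ W))
        , record { edges = λ m∈ → edges′ m∈ ; separate = AllPairsₚ.map⁺ (separate′ (elements (∁ W)) (elements-unique (∁ W)) (λ p → p)) }
        , trans (length-map pair (elements (∁ W))) (trans (length-elements (∁ W)) (Subsetₚ.∣∁p∣≡n∸∣p∣ W))
        where
        edgeOf : Fin n → Subset n
        edgeOf v = [ (λ _ → ∅) , (λ (W′ , _) → ⁅ v ⁆ ∪ W′) ]′ (dom v)
        pair : Fin n → Node × Node
        pair v = inj₁ v , inj₂ (edgeOf v)
        outside : ∀ {v} → v ∈ elements (∁ W) → v ∉ₛ W
        outside {v} v∈ = Subsetₚ.x∈∁p⇒x∉p (Vecₚ.lookup⇒[]= v (∁ W) (∈-elements (∁ W) v∈))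
        incident : ∀ {v} → v ∉ₛ W → IncidentEdge v (edgeOf v)
        incident {v} v∉ with dom v
        ... | inj₁ v∈ = ⊥-elim (v∉ v∈)
        ... | inj₂ (W′ , _ , edge) = Subsetₚ.x∈p∪q⁺ (inj₁ (Subsetₚ.x∈⁅x⁆ v)) , edge
        private-edge : ∀ {v w} → v ∉ₛ W → w ∈ₛ edgeOf v → w ∉ₛ W → w ≡ v
        private-edge {v} {w} v∉ w∈ w∉ with dom v
        ... | inj₁ v∈ = ⊥-elim (v∉ v∈)
        ... | inj₂ (W′ , W′⊆ , _) with Subsetₚ.x∈p∪q⁻ ⁅ v ⁆ W′ w∈
        ...   | inj₁ q = Subsetₚ.x∈⁅y⁆⇒x≡y v q
        ...   | inj₂ q = ⊥-elim (w∉ (W′⊆ q))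
        edges′ : ∀ {a b} → (a , b) ∈ map pair (elements (∁ W)) → a ∈ˢ whole × b ∈ˢ whole × a ~ b
        edges′ m∈ with ∈-map⁻ pair m∈
        ... | v , v∈ , refl = mem refl , mem (proj₂ (incident (outside v∈))) , ve (incident (outside v∈))
        apart : ∀ {v w} → v ∉ₛ W → w ∉ₛ W → v ≢ w → Separate (pair v) (pair w)
        apart v∉ w∉ v≢w (inj₁ refl) (inj₁ refl) ()
        apart v∉ w∉ v≢w (inj₁ refl) (inj₂ refl) (ve (v∈ , _)) = v≢w (private-edge w∉ v∈ v∉)
        apart v∉ w∉ v≢w (inj₂ refl) (inj₁ refl) (ev (w∈ , _)) = v≢w (sym (private-edge v∉ w∈ w∉))
        apart v∉ w∉ v≢w (inj₂ refl) (inj₂ refl) ()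
        separate′ : ∀ vs → Unique vs → (∀ {v} → v ∈ vs → v ∈ elements (∁ W)) → AllPairs (λ v w → Separate (pair v) (pair w)) vs
        separate′ []       u sub = []
        separate′ (v ∷ vs) u sub = All.tabulate (λ {w} w∈ {_} {_} → apart (outside (sub (here refl))) (outside (sub (there w∈))) (λ { refl → unique-∉ u w∈ }))
          ∷ separate′ vs (unique-tail u) (sub ∘ there)

      -- Here `k + t = n` and `t` is the largest size of an induced matching; the two translations
      -- identify `k` as the smallest size of a dominating set.
      sphere-conclusion : ∀ {t M} → Sph whole t → InducedMatching whole M → length M ≡ t → (∀ {M′} → InducedMatching whole M′ → length M′ ≤ t) →
        Σ ℕ (λ g → IsDominationNumber H g × HomologySphere H g)
      sphere-conclusion {t} {M} sph I len max = k , (smallest , least) , infinite-cyclic (proj₁ sphere) , λ j j≢k → vanishes (proj₂ sphere j j≢k)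
        where
        k : ℕ
        k = proj₁ (sph ∅ apart-∅)
        k+t≡n : k ℕ.+ t ≡ n
        k+t≡n = trans (proj₁ (proj₂ (sph ∅ apart-∅))) size-whole
        sphere : SphereAt independence k
        sphere = proj₂ (proj₂ (sph ∅ apart-∅))
        smallest : Σ (Subset n) λ W → IsDominating H W × ∣ W ∣ ≡ k
        smallest = let (W , dom , card) = dominating-from-matching I in
          W , dom , trans card (trans (cong₂ ℕ._∸_ (sym k+t≡n) len) (ℕₚ.m+n∸n≡m k t))
        least : ∀ W → IsDominating H W → k ≤ ∣ W ∣
        least W dom = let (_ , J , len′) = matching-from-dominating W dom in
          -- After adding `t` on both sides: `n` is at most `∣ W ∣ + (n ∸ ∣ W ∣)`, and the matching
          -- made from `W` has size `n ∸ ∣ W ∣`, hence at most `t`.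
          ℕₚ.+-cancelʳ-≤ t k ∣ W ∣ (subst (_≤ ∣ W ∣ ℕ.+ t) (sym k+t≡n)
            (ℕₚ.≤-trans (ℕₚ.m≤n+m∸n n ∣ W ∣) (ℕₚ.+-monoʳ-≤ ∣ W ∣ (subst (_≤ t) len′ (max J)))))

      result-conclusion : Result whole → HomologyContractible H ⊎ Σ ℕ (λ g → IsDominationNumber H g × HomologySphere H g)
      result-conclusion (inj₁ (con , _))                        = inj₁ λ k → vanishes (con ∅ apart-∅ k)
      result-conclusion (inj₂ (t , sph , _ , (M , I , len) , max)) = inj₂ (sphere-conclusion sph I len max)

      dichotomy : HomologyContractible H ⊎ Σ ℕ (λ g → IsDominationNumber H g × HomologySphere H g)
      dichotomy = result-conclusion (classify whole)

theorem1p4 : (n : ℕ) (H : Hypergraph n) → NoBerge01mod3 H →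
    HomologyContractible H
    ⊎ Σ ℕ (λ g → IsDominationNumber H g × HomologySphere H g)
theorem1p4 n H noBerge = Domination.dichotomy H noBerge
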